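{- For all $0<\varepsilon<1$, $A^\varepsilon(n,d)\le O(4.075^d\,\varepsilon^{ -2}\log n)$, where the implied constant is absolute (independent of $n\ge2$, $d$ and $\varepsilon$).
   Context: For a homogeneous polynomial $g\in\mathbb{C}[x_1,\ldots,x_n]_d$, the Waring rank $\mathbf{R}(g)$ is the minimum $r$ such that $g=\ell_1^d+\cdots+\ell_r^d$ for some complex linear forms $\ell_i$ in $x_1,\ldots,x_n$. $A^\varepsilon(n,d)$ is the minimum of $\mathbf{R}(g)$ over all $g\in\mathbb{R}[x_1,\ldots,x_n]_d$ whose set of monomials with nonzero coefficient is exactly the set of all multilinear monomials $x_{i_1}\cdots x_{i_d}$, $1\le i_1<\cdots<i_d\le n$, and whose nonzero coefficients lie in $[1-\varepsilon,1+\varepsilon]$. -}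

module Defs where

open import Algebra.Bundles.Raw using (RawRing; RawSemiring)
import Algebra.Definitions.RawSemiring as RawSemiringDefs
open import Data.Bool.Base using (if_then_else_)
open import Data.Fin.Base as Fin using (Fin)
import Data.Fin.Properties as Fin
open import Data.Integer.Base as ℤ using (+_; +[1+_])
import Data.Integer.Properties as ℤ
open import Data.List.Base as List using (List; []; _∷_; _++_; cartesianProductWith)
open import Data.Nat.Base as ℕ using (ℕ; zero; suc)
open import Data.Nat.Induction using (<-wellFounded)
open import Data.Nat.Logarithm
import Data.Nat.Properties as ℕ
open import Data.Product.Base using (Σ; ∃; _×_; _,_; proj₁; proj₂; map₁)
open import Data.Rational.Base as ℚ using (ℚ; 0ℚ; 1ℚ; ½; ∣_∣; mkℚ)
import Data.Rational.Properties as ℚ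
open import Data.Rational.Solver using (module +-*-Solver)
import Data.Rational.Unnormalised.Base as ℚᵘ
import Data.Rational.Unnormalised.Properties as ℚᵘ
open import Data.Sum.Base using (inj₁; inj₂)
open import Data.Vec.Base as Vec using (Vec; replicate; zipWith; tabulate)
open import Data.Vec.Functional as Vector using (Vector)
import Data.Vec.Properties as Vec
open import Function.Base using (_∘_)
open import Function.Bundles using (_⇔_)
open import Induction.WellFounded using (Acc; acc)
open import Level using (Level; 0ℓ; _⊔_)
open import Relation.Binary.PropositionalEquality
  using (_≡_; _≢_; refl; sym; trans; cong; cong₂; subst; subst₂; module ≡-Reasoning)
open import Relation.Nullary using (¬_; does; yes; no; contradiction)

IsLeast : (ℕ → Set) → ℕ → Set
IsLeast P m = P m × (∀ k → P k → m ℕ.≤ k)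

-- ℝ is the ring of rational Cauchy sequences; _≃_ identifies two sequences
-- whose difference tends to 0.

IsCauchy : (ℕ → ℚ) → Set
IsCauchy s = ∀ δ → 0ℚ ℚ.< δ →
  ∃ λ N → ∀ m n → N ℕ.≤ m → N ℕ.≤ n → ∣ s m ℚ.- s n ∣ ℚ.< δ

record ℝ : Set where
  constructor mkℝ
  field
    seq    : ℕ → ℚ
    cauchy : IsCauchy seq

open ℝ public

Eventually : (ℕ → Set) → Set
Eventually P = ∃ λ N → ∀ m → N ℕ.≤ m → P m

infix 4 _≃_ _<_ _≤_

_≃_ : ℝ → ℝ → Set
x ≃ y = ∀ δ → 0ℚ ℚ.< δ → Eventually λ m → ∣ seq x m ℚ.- seq y m ∣ ℚ.< δ

_<_ : ℝ → ℝ → Set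
x < y = ∃ λ δ → 0ℚ ℚ.< δ × Eventually λ m → seq x m ℚ.+ δ ℚ.< seq y m

_≤_ : ℝ → ℝ → Set
x ≤ y = ∀ δ → 0ℚ ℚ.< δ → Eventually λ m → seq x m ℚ.< seq y m ℚ.+ δ

private
  ∣p-p∣≡0 : ∀ p → ∣ p ℚ.- p ∣ ≡ 0ℚ
  ∣p-p∣≡0 p = cong ∣_∣ (ℚ.+-inverseʳ p)

  half : ∀ δ → ½ ℚ.* δ ℚ.+ ½ ℚ.* δ ≡ δ
  half = solve 1 (λ δ → con ½ :* δ :+ con ½ :* δ := δ) refl
    where open +-*-Solver

  pos-* : ∀ {p q} → 0ℚ ℚ.< p → 0ℚ ℚ.< q → 0ℚ ℚ.< p ℚ.* q
  pos-* {p} {q} 0<p 0<q = ℚ.positive⁻¹ (p ℚ.* q)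
    {{ℚ.pos*pos⇒pos p {{ℚ.positive 0<p}} q {{ℚ.positive 0<q}}}}

  0<½ : 0ℚ ℚ.< ½
  0<½ = ℚ.positive⁻¹ ½

  inv : ∀ p → 0ℚ ℚ.< p → ℚ
  inv p 0<p = ℚ.1/_ p {{ℚ.>-nonZero 0<p}}

  inv-pos : ∀ p (0<p : 0ℚ ℚ.< p) → 0ℚ ℚ.< inv p 0<p
  inv-pos p 0<p = ℚ.positive⁻¹ (inv p 0<p) {{ℚ.1/pos⇒pos p {{ℚ.positive 0<p}}}}

  *-inv : ∀ p (0<p : 0ℚ ℚ.< p) → p ℚ.* inv p 0<p ≡ 1ℚ
  *-inv p 0<p = ℚ.*-inverseʳ p {{ℚ.>-nonZero 0<p}}

  ∣*∣-< : ∀ {K} (0<K : 0ℚ ℚ.< K) δ {t s} →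
          ∣ t ∣ ℚ.≤ K → ∣ s ∣ ℚ.< δ ℚ.* inv K 0<K → ∣ t ℚ.* s ∣ ℚ.< δ
  ∣*∣-< {K} 0<K δ {t} {s} t≤K s<δ/K = begin-strict
    ∣ t ℚ.* s ∣             ≡⟨ ℚ.∣p*q∣≡∣p∣*∣q∣ t s ⟩
    ∣ t ∣ ℚ.* ∣ s ∣         ≤⟨ ℚ.*-monoʳ-≤-nonNeg ∣ s ∣ {{ℚ.∣-∣-nonNeg s}} t≤K ⟩
    K ℚ.* ∣ s ∣             <⟨ ℚ.*-monoʳ-<-pos K {{ℚ.positive 0<K}} s<δ/K ⟩
    K ℚ.* (δ ℚ.* inv K 0<K) ≡⟨ solve 3 (λ K δ i → K :* (δ :* i) := δ :* (K :* i)) refl K δ (inv K 0<K) ⟩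
    δ ℚ.* (K ℚ.* inv K 0<K) ≡⟨ cong (δ ℚ.*_) (*-inv K 0<K) ⟩
    δ ℚ.* 1ℚ                ≡⟨ ℚ.*-identityʳ δ ⟩
    δ ∎
    where
    open ℚ.≤-Reasoning
    open +-*-Solver

  bounded : ∀ x → ∃ λ K → 0ℚ ℚ.< K × Eventually λ m → ∣ seq x m ∣ ℚ.≤ K
  bounded x with cauchy x 1ℚ (ℚ.positive⁻¹ 1ℚ)
  ... | N , h = ∣ seq x N ∣ ℚ.+ 1ℚ
              , ℚ.<-≤-trans (ℚ.positive⁻¹ 1ℚ)
                  (ℚ.≤-trans (ℚ.≤-reflexive (sym (ℚ.+-identityˡ 1ℚ)))
                    (ℚ.+-monoˡ-≤ 1ℚ (ℚ.0≤∣p∣ (seq x N))))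
              , N , bound
    where
    open ℚ.≤-Reasoning
    open +-*-Solver
    bound : ∀ m → N ℕ.≤ m → ∣ seq x m ∣ ℚ.≤ ∣ seq x N ∣ ℚ.+ 1ℚ
    bound m N≤m = begin
      ∣ seq x m ∣
        ≡⟨ cong ∣_∣ (solve 2 (λ a b → a := b :+ (a :- b)) refl (seq x m) (seq x N)) ⟩
      ∣ seq x N ℚ.+ (seq x m ℚ.- seq x N) ∣
        ≤⟨ ℚ.∣p+q∣≤∣p∣+∣q∣ (seq x N) _ ⟩
      ∣ seq x N ∣ ℚ.+ ∣ seq x m ℚ.- seq x N ∣
        ≤⟨ ℚ.+-monoʳ-≤ ∣ seq x N ∣ (ℚ.<⇒≤ (h m N N≤m ℕ.≤-refl)) ⟩
      ∣ seq x N ∣ ℚ.+ 1ℚ ∎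

  ⊔⁻ˡ : ∀ {a b m} → a ℕ.⊔ b ℕ.≤ m → a ℕ.≤ m
  ⊔⁻ˡ {a} {b} = ℕ.≤-trans (ℕ.m≤m⊔n a b)

  ⊔⁻ʳ : ∀ {a b m} → a ℕ.⊔ b ℕ.≤ m → b ℕ.≤ m
  ⊔⁻ʳ {a} {b} = ℕ.≤-trans (ℕ.m≤n⊔m a b)

  ∣+∣-< : ∀ δ {s t} → ∣ s ∣ ℚ.< ½ ℚ.* δ → ∣ t ∣ ℚ.< ½ ℚ.* δ → ∣ s ℚ.+ t ∣ ℚ.< δ
  ∣+∣-< δ {s} {t} hs ht =
    ℚ.≤-<-trans (ℚ.∣p+q∣≤∣p∣+∣q∣ s t)
      (ℚ.<-≤-trans (ℚ.+-mono-< hs ht) (ℚ.≤-reflexive (half δ)))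

fromℚ : ℚ → ℝ
fromℚ q = mkℝ (λ _ → q) λ δ 0<δ →
  0 , λ _ _ _ _ → subst (ℚ._< δ) (sym (∣p-p∣≡0 q)) 0<δ

fromℕ : ℕ → ℝ
fromℕ n = fromℚ (+ n ℚ./ 1)

0ℝ 1ℝ : ℝ
0ℝ = fromℚ 0ℚ
1ℝ = fromℚ 1ℚ

infixl 6 _+_ _-_
infixl 7 _*_
infix  8 -_

_+_ : ℝ → ℝ → ℝ
seq (x + y) m = seq x m ℚ.+ seq y m
cauchy (x + y) δ 0<δ
  with cauchy x (½ ℚ.* δ) (pos-* 0<½ 0<δ) | cauchy y (½ ℚ.* δ) (pos-* 0<½ 0<δ)
... | M , hx | N , hy = M ℕ.⊔ N , λ m n ≤m ≤n →
  subst (λ z → ∣ z ∣ ℚ.< δ)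
    (solve 4 (λ a b c d → (a :- c) :+ (b :- d) := (a :+ b) :- (c :+ d)) refl
      (seq x m) (seq y m) (seq x n) (seq y n))
    (∣+∣-< δ (hx m n (⊔⁻ˡ ≤m) (⊔⁻ˡ ≤n)) (hy m n (⊔⁻ʳ {M} ≤m) (⊔⁻ʳ {M} ≤n)))
  where open +-*-Solver

-_ : ℝ → ℝ
seq (- x) m = ℚ.- seq x m
cauchy (- x) δ 0<δ with cauchy x δ 0<δ
... | N , h = N , λ m n ≤m ≤n → subst (ℚ._< δ)
  (trans (sym (ℚ.∣-p∣≡∣p∣ (seq x m ℚ.- seq x n)))
         (cong ∣_∣ (ℚ.neg-distrib-+ (seq x m) (ℚ.- seq x n))))
  (h m n ≤m ≤n)

_-_ : ℝ → ℝ → ℝ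
x - y = x + (- y)

private
  *-diff : ∀ a b c d → a ℚ.* (b ℚ.- d) ℚ.+ d ℚ.* (a ℚ.- c) ≡ a ℚ.* b ℚ.- c ℚ.* d
  *-diff = solve 4 (λ a b c d → a :* (b :- d) :+ d :* (a :- c) := a :* b :- c :* d) refl
    where open +-*-Solver

  *-cauchy : ∀ x y → IsCauchy (λ m → seq x m ℚ.* seq y m)
  *-cauchy x y δ 0<δ = (A ℕ.⊔ B) ℕ.⊔ (M ℕ.⊔ N) , λ m n ≤m ≤n →
    subst (λ z → ∣ z ∣ ℚ.< δ) (*-diff (seq x m) (seq y m) (seq x n) (seq y n))
      (∣+∣-< δ
        (∣*∣-< 0<K (½ ℚ.* δ) (x≤K m (⊔⁻ˡ (⊔⁻ˡ ≤m)))
          (hy m n (⊔⁻ˡ (⊔⁻ʳ {A ℕ.⊔ B} ≤m)) (⊔⁻ˡ (⊔⁻ʳ {A ℕ.⊔ B} ≤n))))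
        (∣*∣-< 0<L (½ ℚ.* δ) (y≤L n (⊔⁻ʳ {A} (⊔⁻ˡ ≤n)))
          (hx m n (⊔⁻ʳ {M} (⊔⁻ʳ {A ℕ.⊔ B} ≤m)) (⊔⁻ʳ {M} (⊔⁻ʳ {A ℕ.⊔ B} ≤n)))))
    where
    K = proj₁ (bounded x)
    0<K = proj₁ (proj₂ (bounded x))
    A = proj₁ (proj₂ (proj₂ (bounded x)))
    x≤K = proj₂ (proj₂ (proj₂ (bounded x)))
    L = proj₁ (bounded y)
    0<L = proj₁ (proj₂ (bounded y))
    B = proj₁ (proj₂ (proj₂ (bounded y)))
    y≤L = proj₂ (proj₂ (proj₂ (bounded y)))
    Hy = cauchy y (½ ℚ.* δ ℚ.* inv K 0<K) (pos-* (pos-* 0<½ 0<δ) (inv-pos K 0<K))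
    Hx = cauchy x (½ ℚ.* δ ℚ.* inv L 0<L) (pos-* (pos-* 0<½ 0<δ) (inv-pos L 0<L))
    M = proj₁ Hy
    hy = proj₂ Hy
    N = proj₁ Hx
    hx = proj₂ Hx

_*_ : ℝ → ℝ → ℝ
x * y = mkℝ (λ m → seq x m ℚ.* seq y m) (*-cauchy x y)

private
  module Recip (x : ℝ) (0<x : 0ℝ < x) where
    η : ℚ
    η = proj₁ 0<x

    0<η : 0ℚ ℚ.< η
    0<η = proj₁ (proj₂ 0<x)

    N : ℕ
    N = proj₁ (proj₂ (proj₂ 0<x))

    η< : ∀ m → η ℚ.< seq x (N ℕ.+ m)
    η< m = subst (ℚ._< seq x (N ℕ.+ m)) (ℚ.+-identityˡ η)
      (proj₂ (proj₂ (proj₂ 0<x)) (N ℕ.+ m) (ℕ.m≤m+n N m))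

    pos : ∀ m → 0ℚ ℚ.< seq x (N ℕ.+ m)
    pos m = ℚ.<-trans 0<η (η< m)

    recip : ℕ → ℚ
    recip m = inv (seq x (N ℕ.+ m)) (pos m)

    η⁻¹ : ℚ
    η⁻¹ = inv η 0<η

    recip≤ : ∀ m → recip m ℚ.≤ η⁻¹
    recip≤ m = ℚ.*-cancelˡ-≤-pos η {{ℚ.positive 0<η}} (begin
      η ℚ.* recip m
        ≤⟨ ℚ.*-monoʳ-≤-nonNeg (recip m)
             {{ℚ.nonNegative (ℚ.<⇒≤ (inv-pos (seq x (N ℕ.+ m)) (pos m)))}} (ℚ.<⇒≤ (η< m)) ⟩
      seq x (N ℕ.+ m) ℚ.* recip m
        ≡⟨ *-inv (seq x (N ℕ.+ m)) (pos m) ⟩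
      1ℚ
        ≡⟨ sym (*-inv η 0<η) ⟩
      η ℚ.* η⁻¹ ∎)
      where open ℚ.≤-Reasoning

    ∣recip∣≤ : ∀ m → ∣ recip m ∣ ℚ.≤ η⁻¹
    ∣recip∣≤ m = subst (ℚ._≤ η⁻¹)
      (sym (ℚ.0≤p⇒∣p∣≡p (ℚ.<⇒≤ (inv-pos (seq x (N ℕ.+ m)) (pos m))))) (recip≤ m)

    recip-diff : ∀ m n → recip m ℚ.* (recip n ℚ.* (seq x (N ℕ.+ n) ℚ.- seq x (N ℕ.+ m)))
                         ≡ recip m ℚ.- recip n
    recip-diff m n = begin
      u ℚ.* (v ℚ.* (b ℚ.- a))
        ≡⟨ solve 4 (λ a b u v → u :* (v :* (b :- a)) := (b :* v) :* u :- (a :* u) :* v)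
             refl a b u v ⟩
      (b ℚ.* v) ℚ.* u ℚ.- (a ℚ.* u) ℚ.* v
        ≡⟨ cong₂ (λ s t → s ℚ.* u ℚ.- t ℚ.* v) (*-inv b (pos n)) (*-inv a (pos m)) ⟩
      1ℚ ℚ.* u ℚ.- 1ℚ ℚ.* v
        ≡⟨ cong₂ ℚ._-_ (ℚ.*-identityˡ u) (ℚ.*-identityˡ v) ⟩
      u ℚ.- v ∎
      where
      open ≡-Reasoning
      open +-*-Solver
      a = seq x (N ℕ.+ m)
      b = seq x (N ℕ.+ n)
      u = recip m
      v = recip n

    0<η⁻¹ : 0ℚ ℚ.< η⁻¹
    0<η⁻¹ = inv-pos η 0<η

    recip-cauchy : IsCauchy recip
    recip-cauchy δ 0<δ = proj₁ H , λ m n ≤m ≤n →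
      subst (λ z → ∣ z ∣ ℚ.< δ) (recip-diff m n)
        (∣*∣-< 0<η⁻¹ δ (∣recip∣≤ m)
          (∣*∣-< 0<η⁻¹ (δ ℚ.* η′) (∣recip∣≤ n)
            (proj₂ H (N ℕ.+ n) (N ℕ.+ m) (ℕ.m≤n⇒m≤o+n N ≤n) (ℕ.m≤n⇒m≤o+n N ≤m))))
      where
      η′ = inv η⁻¹ 0<η⁻¹
      0<η′ = inv-pos η⁻¹ 0<η⁻¹
      H = cauchy x (δ ℚ.* η′ ℚ.* η′) (pos-* (pos-* 0<δ 0<η′) 0<η′)

-- The reciprocals are taken from the index on where the sequence is known to
-- be bounded away from 0.
recip : (x : ℝ) → 0ℝ < x → ℝ
recip x 0<x = mkℝ (Recip.recip x 0<x) (Recip.recip-cauchy x 0<x)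

ℝ-rawRing : RawRing 0ℓ 0ℓ
ℝ-rawRing = record
  { _≈_ = _≃_ ; _+_ = _+_ ; _*_ = _*_ ; -_ = -_ ; 0# = 0ℝ ; 1# = 1ℝ }

ℝ-rawSemiring : RawSemiring 0ℓ 0ℓ
ℝ-rawSemiring = RawRing.rawSemiring ℝ-rawRing

open RawSemiringDefs ℝ-rawSemiring public using (_^_)

private
  2*⌊n/2⌋≤n : ∀ n → 2 ℕ.* ℕ.⌊ n /2⌋ ℕ.≤ n
  2*⌊n/2⌋≤n n = begin
    2 ℕ.* ℕ.⌊ n /2⌋            ≡⟨ cong (ℕ.⌊ n /2⌋ ℕ.+_) (ℕ.+-identityʳ _) ⟩
    ℕ.⌊ n /2⌋ ℕ.+ ℕ.⌊ n /2⌋    ≤⟨ ℕ.+-monoʳ-≤ ℕ.⌊ n /2⌋ (ℕ.⌊n/2⌋≤⌈n/2⌉ n) ⟩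
    ℕ.⌊ n /2⌋ ℕ.+ ℕ.⌈ n /2⌉    ≡⟨ ℕ.⌊n/2⌋+⌈n/2⌉≡n n ⟩
    n                          ∎
    where open ℕ.≤-Reasoning

  2^⌊log₂n⌋≤n : ∀ n .{{_ : ℕ.NonZero n}} → 2 ℕ.^ ⌊log₂ n ⌋ ℕ.≤ n
  2^⌊log₂n⌋≤n n = go n (<-wellFounded n)
    where
    go : ∀ n .{{_ : ℕ.NonZero n}} → Acc ℕ._<_ n → 2 ℕ.^ ⌊log₂ n ⌋ ℕ.≤ n
    go 1 _ = ℕ.≤-refl
    go n@(suc (suc n-2)) (acc rs) = begin
      2 ℕ.^ ⌊log₂ n ⌋
        ≤⟨ ℕ.^-monoʳ-≤ 2 (ℕ.≤-trans (ℕ.m≤n+m∸n ⌊log₂ n ⌋ 1)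
             (ℕ.≤-reflexive (cong suc (sym (⌊log₂⌊n/2⌋⌋≡⌊log₂n⌋∸1 n))))) ⟩
      2 ℕ.* 2 ℕ.^ ⌊log₂ ℕ.⌊ n /2⌋ ⌋
        ≤⟨ ℕ.*-monoʳ-≤ 2 (go ℕ.⌊ n /2⌋ (rs (ℕ.⌊n/2⌋<n (suc n-2)))) ⟩
      2 ℕ.* ℕ.⌊ n /2⌋
        ≤⟨ 2*⌊n/2⌋≤n n ⟩
      n ∎
      where open ℕ.≤-Reasoning

  n<2^[1+⌊log₂n⌋] : ∀ n → n ℕ.< 2 ℕ.^ suc ⌊log₂ n ⌋
  n<2^[1+⌊log₂n⌋] n = ℕ.≰⇒> λ 2^≤n → ℕ.<-irrefl refl
    (ℕ.≤-trans (ℕ.≤-reflexive (sym (⌊log₂[2^n]⌋≡n (suc ⌊log₂ n ⌋)))) (⌊log₂⌋-mono-≤ 2^≤n))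

  log-compare : ∀ n .{{_ : ℕ.NonZero n}} j k →
                ⌊log₂ n ℕ.^ suc j ⌋ ℕ.* suc k ℕ.< suc ⌊log₂ n ℕ.^ suc k ⌋ ℕ.* suc j
  log-compare n j k = ℕ.≰⇒> λ le → ℕ.<-irrefl refl (begin-strict
    n ℕ.^ (suc k ℕ.* suc j)   ≡⟨ sym (ℕ.^-*-assoc n (suc k) (suc j)) ⟩
    (n ℕ.^ suc k) ℕ.^ suc j   <⟨ ℕ.^-monoˡ-< (suc j) (n<2^[1+⌊log₂n⌋] (n ℕ.^ suc k)) ⟩
    (2 ℕ.^ suc b) ℕ.^ suc j   ≡⟨ ℕ.^-*-assoc 2 (suc b) (suc j) ⟩
    2 ℕ.^ (suc b ℕ.* suc j)   ≤⟨ ℕ.^-monoʳ-≤ 2 le ⟩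
    2 ℕ.^ (a ℕ.* suc k)       ≡⟨ sym (ℕ.^-*-assoc 2 a (suc k)) ⟩
    (2 ℕ.^ a) ℕ.^ suc k       ≤⟨ ℕ.^-monoˡ-≤ (suc k) (2^⌊log₂n⌋≤n (n ℕ.^ suc j) {{ℕ.m^n≢0 n (suc j)}}) ⟩
    (n ℕ.^ suc j) ℕ.^ suc k   ≡⟨ ℕ.^-*-assoc n (suc j) (suc k) ⟩
    n ℕ.^ (suc j ℕ.* suc k)   ≡⟨ cong (n ℕ.^_) (ℕ.*-comm (suc j) (suc k)) ⟩
    n ℕ.^ (suc k ℕ.* suc j)   ∎)
    where
    open ℕ.≤-Reasoning
    a = ⌊log₂ n ℕ.^ suc j ⌋
    b = ⌊log₂ n ℕ.^ suc k ⌋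

  /-mono-< : ∀ a j b k → a ℕ.* suc k ℕ.< b ℕ.* suc j → (+ a) ℚ./ suc j ℚ.< (+ b) ℚ./ suc k
  /-mono-< a j b k lt = ℚ.toℚᵘ-cancel-<
    (ℚᵘ.<-respʳ-≃ (ℚᵘ.≃-sym (ℚ.toℚᵘ-fromℚᵘ (ℚᵘ.mkℚᵘ (+ b) k)))
      (ℚᵘ.<-respˡ-≃ (ℚᵘ.≃-sym (ℚ.toℚᵘ-fromℚᵘ (ℚᵘ.mkℚᵘ (+ a) j)))
        (ℚᵘ.*<* (subst₂ ℤ._<_ (ℤ.pos-* a (suc k)) (ℤ.pos-* b (suc j)) (ℤ.+<+ lt)))))

  suc-/ : ∀ b k → (+ suc b) ℚ./ suc k ≡ (+ b) ℚ./ suc k ℚ.+ (+ 1) ℚ./ suc k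
  suc-/ b k = ℚ.toℚᵘ-injective (begin
    ℚ.toℚᵘ ((+ suc b) ℚ./ suc k)             ≈⟨ ℚ.toℚᵘ-fromℚᵘ (ℚᵘ.mkℚᵘ (+ suc b) k) ⟩
    ℚᵘ.mkℚᵘ (+ suc b) k                      ≈⟨ ℚᵘ.*≡* eq ⟩
    ℚᵘ.mkℚᵘ (+ b) k ℚᵘ.+ ℚᵘ.mkℚᵘ (+ 1) k
      ≈⟨ ℚᵘ.+-cong (ℚᵘ.≃-sym (ℚ.toℚᵘ-fromℚᵘ (ℚᵘ.mkℚᵘ (+ b) k)))
                   (ℚᵘ.≃-sym (ℚ.toℚᵘ-fromℚᵘ (ℚᵘ.mkℚᵘ (+ 1) k))) ⟩
    ℚ.toℚᵘ ((+ b) ℚ./ suc k) ℚᵘ.+ ℚ.toℚᵘ ((+ 1) ℚ./ suc k)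
      ≈⟨ ℚᵘ.≃-sym (ℚ.toℚᵘ-homo-+ ((+ b) ℚ./ suc k) ((+ 1) ℚ./ suc k)) ⟩
    ℚ.toℚᵘ ((+ b) ℚ./ suc k ℚ.+ (+ 1) ℚ./ suc k) ∎)
    where
    open ℚᵘ.≃-Reasoning
    K = + suc k
    eq : + suc b ℤ.* + (suc k ℕ.* suc k) ≡ (+ b ℤ.* K ℤ.+ + 1 ℤ.* K) ℤ.* K
    eq = trans (cong (+ suc b ℤ.*_) (ℤ.pos-* (suc k) (suc k)))
      (trans (sym (ℤ.*-assoc (+ suc b) K K))
        (cong (ℤ._* K) (trans (cong (ℤ._* K) (ℤ.+-comm (+ 1) (+ b)))
          (ℤ.*-distribʳ-+ K (+ b) (+ 1)))))

  ∣-∣-< : ∀ {p q δ} → p ℚ.< q ℚ.+ δ → q ℚ.< p ℚ.+ δ → ∣ p ℚ.- q ∣ ℚ.< δ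
  ∣-∣-< {p} {q} {δ} p<q+δ q<p+δ with ℚ.∣p∣≡p∨∣p∣≡-p (p ℚ.- q)
  ... | inj₁ eq = subst₂ ℚ._<_ (sym eq)
    (solve 2 (λ q δ → (q :+ δ) :- q := δ) refl q δ) (ℚ.+-monoˡ-< (ℚ.- q) p<q+δ)
    where open +-*-Solver
  ... | inj₂ eq = subst₂ ℚ._<_
    (trans (solve 2 (λ p q → q :- p := :- (p :- q)) refl p q) (sym eq))
    (solve 2 (λ p δ → (p :+ δ) :- p := δ) refl p δ) (ℚ.+-monoˡ-< (ℚ.- p) q<p+δ)
    where open +-*-Solver

  archimedean : ∀ δ → 0ℚ ℚ.< δ → Eventually λ m → (+ 1) ℚ./ suc m ℚ.< δ
  archimedean δ@(mkℚ (+ zero) _ _) 0<δ with ℚ.positive 0<δ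
  ... | ()
  archimedean δ@(mkℚ +[1+ p ] q _) 0<δ = suc q , λ m q<m →
    subst ((+ 1) ℚ./ suc m ℚ.<_) (ℚ.↥p/↧p≡p δ)
      (/-mono-< 1 m (suc p) q
        (ℕ.≤-trans (ℕ.s≤s (ℕ.≤-trans (ℕ.≤-reflexive (ℕ.*-identityˡ (suc q))) q<m))
          (ℕ.m≤m+n (suc m) (p ℕ.* suc m))))
  archimedean δ@(mkℚ ℤ.-[1+ _ ] _ _) 0<δ with ℚ.positive 0<δ
  ... | ()

-- The binary logarithm as a real number: since
-- 2 ^ ⌊log₂ n ^ k ⌋ ≤ n ^ k < 2 ^ (1 + ⌊log₂ n ^ k ⌋), the rational
-- ⌊log₂ n ^ k ⌋ / k is within 1 / k of log₂ n.  The value at 0 is a dummy.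
log₂ : ℕ → ℝ
log₂ zero      = 0ℝ
log₂ n@(suc _) = mkℝ approx λ δ 0<δ →
  proj₁ (archimedean δ 0<δ) , λ j k ≤j ≤k →
    ∣-∣-< (approx-< j k (proj₂ (archimedean δ 0<δ) k ≤k))
          (approx-< k j (proj₂ (archimedean δ 0<δ) j ≤j))
  where
  approx : ℕ → ℚ
  approx j = (+ ⌊log₂ n ℕ.^ suc j ⌋) ℚ./ suc j

  approx-< : ∀ j k {δ} → (+ 1) ℚ./ suc k ℚ.< δ → approx j ℚ.< approx k ℚ.+ δ
  approx-< j k 1/k<δ = ℚ.<-trans
    (subst (approx j ℚ.<_) (suc-/ ⌊log₂ n ℕ.^ suc k ⌋ k)
      (/-mono-< ⌊log₂ n ℕ.^ suc j ⌋ j (suc ⌊log₂ n ℕ.^ suc k ⌋) k (log-compare n j k)))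
    (ℚ.+-monoʳ-< (approx k) 1/k<δ)

record ℂ : Set where
  constructor mkℂ
  field
    re im : ℝ

open ℂ public

ℂ-rawRing : RawRing 0ℓ 0ℓ
ℂ-rawRing = record
  { Carrier = ℂ
  ; _≈_ = λ z w → re z ≃ re w × im z ≃ im w
  ; _+_ = λ z w → mkℂ (re z + re w) (im z + im w)
  ; _*_ = λ z w → mkℂ (re z * re w - im z * im w) (re z * im w + im z * re w)
  ; -_  = λ z → mkℂ (- re z) (- im z)
  ; 0#  = mkℂ 0ℝ 0ℝ
  ; 1#  = mkℂ 1ℝ 0ℝ
  }

ℂ-rawSemiring : RawSemiring 0ℓ 0ℓ
ℂ-rawSemiring = RawRing.rawSemiring ℂ-rawRing

ℝ⇒ℂ : ℝ → ℂ
ℝ⇒ℂ x = mkℂ x 0ℝ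

-- A monomial in x₁, …, xₙ is its vector of exponents.
Monomial : ℕ → Set
Monomial n = Vec ℕ n

module _ {n : ℕ} where

  𝟏 : Monomial n
  𝟏 = replicate n 0

  infixl 7 _·_
  _·_ : Monomial n → Monomial n → Monomial n
  _·_ = zipWith ℕ._+_

  var : Fin n → Monomial n
  var i = tabulate λ j → if does (i Fin.≟ j) then 1 else 0

  deg : Monomial n → ℕ
  deg = Vec.sum

  -- e = x_{i₁} ⋯ x_{i_d} for some i₁ < ⋯ < i_d
  IsMultilinear : ℕ → Monomial n → Set
  IsMultilinear d e = Σ (Fin d → Fin n) λ i →
    (∀ {j k} → j Fin.< k → i j Fin.< i k) × e ≡ Vector.foldr _·_ 𝟏 (var ∘ i)

-- Polynomials are formal sums of terms, compared through their coefficients;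
-- a monomial may occur in several terms.
module Polynomial {c ℓ : Level} (R : RawSemiring c ℓ) where

  open RawSemiring R using (Carrier; _≈_; 0#; 1#)
    renaming (_+_ to _+ᴿ_; _*_ to _*ᴿ_)

  Poly : ℕ → Set c
  Poly n = List (Carrier × Monomial n)

  coeff : ∀ {n} → Poly n → Monomial n → Carrier
  coeff []            e = 0#
  coeff ((a , m) ∷ p) e =
    if does (Vec.≡-dec ℕ._≟_ m e) then a +ᴿ coeff p e else coeff p e

  rawSemiring : ℕ → RawSemiring c ℓ
  rawSemiring n = record
    { Carrier = Poly n
    ; _≈_ = λ p q → ∀ e → coeff p e ≈ coeff q e
    ; _+_ = _++_
    ; _*_ = cartesianProductWith λ where (a , m) (b , m′) → a *ᴿ b , m · m′
    ; 0#  = []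
    ; 1#  = (1# , 𝟏) ∷ []
    }

  IsHomogeneous : ∀ {n} → ℕ → Poly n → Set ℓ
  IsHomogeneous d p = ∀ e → deg e ≢ d → coeff p e ≈ 0#

  LinearForm : ℕ → Set c
  LinearForm n = Vector Carrier n

  toPoly : ∀ {n} → LinearForm n → Poly n
  toPoly ℓ = List.tabulate λ i → ℓ i , var i

module ℝ[x] = Polynomial ℝ-rawSemiring
module ℂ[x] = Polynomial ℂ-rawSemiring

module _ {n : ℕ} where

  open RawSemiring (ℂ[x].rawSemiring n) using (_≈_)
  open RawSemiringDefs (ℂ[x].rawSemiring n) using (sum) renaming (_^_ to _^ᴾ_)

  IsSumOfPowers : (d : ℕ) → ℂ[x].Poly n → ℕ → Set
  IsSumOfPowers d g r = Σ (Fin r → ℂ[x].LinearForm n) λ ℓ →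
    g ≈ sum λ k → ℂ[x].toPoly (ℓ k) ^ᴾ d

  -- 𝐑(g) = r, where g is homogeneous of degree d.  The degree has to be given
  -- because 0 is homogeneous of every degree.
  HasWaringRank : (d : ℕ) → ℂ[x].Poly n → ℕ → Set
  HasWaringRank d g = IsLeast (IsSumOfPowers d g)

  complexify : ℝ[x].Poly n → ℂ[x].Poly n
  complexify = List.map (map₁ ℝ⇒ℂ)

-- The polynomials g over which A^ε(n,d) is the minimum of 𝐑(g).
record IsAdmissible (n d : ℕ) (ε : ℝ) (g : ℝ[x].Poly n) : Set where
  field
    homogeneous : ℝ[x].IsHomogeneous d g
    support     : ∀ e → (¬ (ℝ[x].coeff g e ≃ 0ℝ)) ⇔ IsMultilinear d e
    range       : ∀ e → ¬ (ℝ[x].coeff g e ≃ 0ℝ) →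
                  1ℝ - ε ≤ ℝ[x].coeff g e × ℝ[x].coeff g e ≤ 1ℝ + ε

-- A^ε(n,d) = a
IsA : (n d : ℕ) → ℝ → ℕ → Set
IsA n d ε = IsLeast λ r → Σ (ℝ[x].Poly n) λ g →
  IsAdmissible n d ε g × HasWaringRank d (complexify g) r

module Submission where

-- Colour the variables at random with k ≈ 31 d/20 colours and let x_v become
-- the variable of its colour.  The elementary symmetric polynomial e_d(k) of the
-- colours then keeps the multilinear monomials on which the colouring is
-- injective (rainbow), and it is a combination of the d-th powers
-- (Σ ± colours)^d with at most d/2 minus signs: multiplying by
-- (number of odd exponents) - (d - 2 i) for 1 ≤ i ≤ d/2 kills all
-- exponent vectors of degree d but the squarefree ones, and has degree d/2 in
-- the signs.  By a Chernoff bound, O(d ε⁻² log n / p) colourings suffice to make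
-- all coefficients of the averaged sum lie within 1 ± ε, where p = k!/(k-d)!/k^d
-- is the probability that a d-set is rainbow.  Finally
-- Σ_{i ≤ d/2} binomial(k, i) / p ≤ O(4.0748^d).


-- Used on all n variables, the sign identity would cost on the order of n^(d/2) powers. Colouring
-- leaves only k variables, a multiple of d; the price is a factor 1/p, a factor log n for
-- controlling all d-sets at once, and coefficients that are only approximately equal. A larger k
-- raises p but also the number of sign vectors; 31/20 balances the two. No measure and no
-- exponential function occur. Probabilities are counts over all lists of colourings, and every
-- estimate compares products of natural powers, with e entering through (1 + 1/t)^t ≤ (1 +
-- 1/s)^(s+1). The coefficient of a sign vector can be negative, and for even d a negative number
-- has no real d-th root. Two conjugate complex powers replace the missing one, which doubles the
-- count. Being a sum of r powers is not known to be decidable, so the minima are shown to exist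
-- only up to double negation; the bound on them compares natural numbers and can be proved from
-- doubly negated existence.

module Estimates where

  open import Data.Nat.Base
  open import Data.Nat.Properties
  open import Data.Nat.Tactic.RingSolver using (solve-∀)
  open import Data.Product.Base using (_,_)
  open import Relation.Binary.PropositionalEquality
  open import Data.Unit using (tt)

  -- Enclosing e by powers of natural numbers

  ^-distribʳ-* : ∀ a b n → (a * b) ^ n ≡ a ^ n * b ^ n
  ^-distribʳ-* a b zero = refl
  ^-distribʳ-* a b (suc n) = trans (cong ((a * b) *_) (^-distribʳ-* a b n)) (lem a b (a ^ n) (b ^ n))
    where
    lem : ∀ a b c e → (a * b) * (c * e) ≡ (a * c) * (b * e)
    lem = solve-∀

  -- This is 1 + j/M ≤ (1 + 1/M)^j with denominators cleared. The induction step gives away only the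
  -- term M^j j.
  bernoulli⁺ : ∀ M j → M ^ j * (M + j) ≤ (M + 1) ^ j * M
  bernoulli⁺ M zero    = ≤-reflexive (cong (_+ 0) (+-identityʳ M))
  bernoulli⁺ M (suc j) = begin
    M * M ^ j * (M + suc j)                  ≤⟨ m≤m+n _ (M ^ j * j) ⟩
    M * M ^ j * (M + suc j) + M ^ j * j      ≡⟨ lem M j (M ^ j) ⟩
    (M + 1) * (M ^ j * (M + j))              ≤⟨ *-monoʳ-≤ (M + 1) (bernoulli⁺ M j) ⟩
    (M + 1) * ((M + 1) ^ j * M)              ≡⟨ sym (*-assoc (M + 1) _ M) ⟩
    (M + 1) * (M + 1) ^ j * M                ∎
    where
    open ≤-Reasoning
    lem : ∀ M j p → M * p * (M + (1 + j)) + p * j ≡ (M + 1) * (p * (M + j))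
    lem = solve-∀

  -- This is 1 - j/(1+M) ≤ (1 - 1/(1+M))^j with denominators cleared and the subtracted term moved
  -- to the right, so that no truncated subtraction occurs.
  bernoulli⁻ : ∀ M j → (1 + M) ^ j * (1 + M) ≤ M ^ j * (1 + M) + j * (1 + M) ^ j
  bernoulli⁻ M zero    = ≤-reflexive (sym (+-identityʳ _))
  bernoulli⁻ M (suc j) = begin
    (1 + M) * (1 + M) ^ j * (1 + M)                    ≡⟨ *-assoc (1 + M) ((1 + M) ^ j) (1 + M) ⟩
    (1 + M) * ((1 + M) ^ j * (1 + M))                  ≤⟨ *-monoʳ-≤ (1 + M) (bernoulli⁻ M j) ⟩
    (1 + M) * (M ^ j * (1 + M) + j * (1 + M) ^ j)      ≡⟨ lem₁ M (M ^ j) j ((1 + M) ^ j) ⟩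
    M * M ^ j * (1 + M) + (1 + M) * M ^ j + (1 + M) * (j * (1 + M) ^ j)
      ≤⟨ +-monoˡ-≤ _ (+-monoʳ-≤ (M * M ^ j * (1 + M)) (*-monoʳ-≤ (1 + M) {M ^ j} {(1 + M) ^ j} (^-monoˡ-≤ j (n≤1+n M)))) ⟩
    M * M ^ j * (1 + M) + (1 + M) * (1 + M) ^ j + (1 + M) * (j * (1 + M) ^ j)
      ≡⟨ lem₂ M (M ^ j) j ((1 + M) ^ j) ⟩
    M * M ^ j * (1 + M) + suc j * ((1 + M) * (1 + M) ^ j) ∎
    where
    open ≤-Reasoning
    lem₁ : ∀ M p j r → (1 + M) * (p * (1 + M) + j * r) ≡ M * p * (1 + M) + (1 + M) * p + (1 + M) * (j * r)
    lem₁ = solve-∀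
    lem₂ : ∀ M p j r → M * p * (1 + M) + (1 + M) * r + (1 + M) * (j * r)
                       ≡ M * p * (1 + M) + (1 + j) * ((1 + M) * r)
    lem₂ = solve-∀

  *-^-mono : ∀ {a b c e} n → a * b ≤ c * e → a ^ n * b ^ n ≤ c ^ n * e ^ n
  *-^-mono {a} {b} {c} {e} n le =
    subst₂ _≤_ (^-distribʳ-* a b n) (^-distribʳ-* c e n) (^-monoˡ-≤ n le)

  -- Both sides straddle e: (1 + 1/t)^t ≤ (1 + 1/s)^(s+1).  With M = t (s + 1),
  -- Bernoulli gives 1 + 1/t ≤ (1 + 1/M)^(s+1) and 1 - 1/(s+1) ≤ (1 - 1/M)^t,
  -- and (1 + 1/M) (1 - 1/M) ≤ 1.
  e-bounds : ∀ t s → (1 + t) ^ t * s ^ (1 + s) ≤ t ^ t * (1 + s) ^ (1 + s)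
  e-bounds zero s = +-monoˡ-≤ 0 (^-monoˡ-≤ (1 + s) (n≤1+n s))
  e-bounds t@(suc t′) s = *-cancelˡ-≤ (M ^ M * M ^ M) {{m*n≢0 (M ^ M) (M ^ M) {{m^n≢0 M M}} {{m^n≢0 M M}}}} (begin
    (M ^ M * M ^ M) * ((1 + t) ^ t * s ^ (1 + s))
      ≡⟨ lem₃ (M ^ M) ((1 + t) ^ t) (s ^ (1 + s)) ⟩
    (M ^ M * (1 + t) ^ t) * (M ^ M * s ^ (1 + s))
      ≤⟨ *-mono-≤ up down ⟩
    ((M + 1) ^ M * t ^ t) * (M′ ^ M * (1 + s) ^ (1 + s))
      ≡⟨ lem₄ ((M + 1) ^ M) (t ^ t) (M′ ^ M) ((1 + s) ^ (1 + s)) ⟩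
    ((M + 1) ^ M * M′ ^ M) * (t ^ t * (1 + s) ^ (1 + s))
      ≤⟨ *-monoˡ-≤ _ (*-^-mono {M + 1} {M′} {M} {M} M (≤-trans (n≤1+n _) (≤-reflexive (lem₅ M′)))) ⟩
    (M ^ M * M ^ M) * (t ^ t * (1 + s) ^ (1 + s)) ∎)
    where
    open ≤-Reasoning
    M′ = s + t′ * (1 + s)
    M  = 1 + M′
    lem₃ : ∀ a b c → (a * a) * (b * c) ≡ (a * b) * (a * c)
    lem₃ = solve-∀
    lem₄ : ∀ a b c e → (a * b) * (c * e) ≡ (a * c) * (b * e)
    lem₄ = solve-∀
    lem₅ : ∀ x → 1 + ((1 + x) + 1) * x ≡ (1 + x) * (1 + x)
    lem₅ = solve-∀
    M≡ : M ≡ (1 + s) * t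
    M≡ = lem s t′
      where
      lem : ∀ s t′ → 1 + (s + t′ * (1 + s)) ≡ (1 + s) * (1 + t′)
      lem = solve-∀
    step⁺ : M ^ (1 + s) * (1 + t) ≤ (M + 1) ^ (1 + s) * t
    step⁺ = *-cancelˡ-≤ (1 + s) (begin
      (1 + s) * (M ^ (1 + s) * (1 + t)) ≡⟨ lem s t′ (M ^ (1 + s)) ⟩
      M ^ (1 + s) * (M + (1 + s))       ≤⟨ bernoulli⁺ M (1 + s) ⟩
      (M + 1) ^ (1 + s) * M             ≡⟨ lem′ s t′ ((M + 1) ^ (1 + s)) ⟩
      (1 + s) * ((M + 1) ^ (1 + s) * t) ∎)
      where
      lem : ∀ s t′ p → (1 + s) * (p * (1 + (1 + t′))) ≡ p * ((1 + (s + t′ * (1 + s))) + (1 + s))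
      lem = solve-∀
      lem′ : ∀ s t′ p → p * (1 + (s + t′ * (1 + s))) ≡ (1 + s) * (p * (1 + t′))
      lem′ = solve-∀
    step⁻ : M ^ t * s ≤ M′ ^ t * (1 + s)
    step⁻ = *-cancelˡ-≤ t (+-cancelʳ-≤ (t * M ^ t) _ _ (begin
      t * (M ^ t * s) + t * M ^ t             ≡⟨ lem s t′ (M ^ t) ⟩
      M ^ t * M                               ≤⟨ bernoulli⁻ M′ t ⟩
      M′ ^ t * M + t * M ^ t                  ≡⟨ cong (_+ t * M ^ t) (lem′ s t′ (M′ ^ t)) ⟩
      t * (M′ ^ t * (1 + s)) + t * M ^ t      ∎))
      where
      lem : ∀ s t′ p → (1 + t′) * (p * s) + (1 + t′) * p ≡ p * (1 + (s + t′ * (1 + s)))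
      lem = solve-∀
      lem′ : ∀ s t′ p → p * (1 + (s + t′ * (1 + s))) ≡ (1 + t′) * (p * (1 + s))
      lem′ = solve-∀
    up : M ^ M * (1 + t) ^ t ≤ (M + 1) ^ M * t ^ t
    up = subst₂ (λ a b → a * (1 + t) ^ t ≤ b * t ^ t) (pow M) (pow (M + 1))
           (*-^-mono {M ^ (1 + s)} {1 + t} {(M + 1) ^ (1 + s)} {t} t step⁺)
      where
      pow : ∀ x → (x ^ (1 + s)) ^ t ≡ x ^ M
      pow x = trans (^-*-assoc x (1 + s) t) (cong (x ^_) (sym M≡))
    down : M ^ M * s ^ (1 + s) ≤ M′ ^ M * (1 + s) ^ (1 + s)
    down = subst₂ (λ a b → a * s ^ (1 + s) ≤ b * (1 + s) ^ (1 + s)) (pow M) (pow M′)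
             (*-^-mono {M ^ t} {s} {M′ ^ t} {1 + s} (1 + s) step⁻)
      where
      pow : ∀ x → (x ^ t) ^ (1 + s) ≡ x ^ M
      pow x = trans (^-*-assoc x t (1 + s)) (cong (x ^_) (trans (*-comm t (1 + s)) (sym M≡)))

  -- e < 193/71 with relative error 1.1e-5, by e-bounds at s = 2^16, where the
  -- 2^16-th powers are computed by 16 squarings.
  square : ℕ → ℕ → ℕ
  square zero    x = x
  square (suc i) x = square i (x * x)

  square-^ : ∀ i x → square i x ≡ x ^ (2 ^ i)
  square-^ zero    x = sym (*-identityʳ x)
  square-^ (suc i) x = trans (square-^ i (x * x)) (trans (^-distribʳ-* x x (2 ^ i))
    (trans (sym (^-distribˡ-+-* x (2 ^ i) (2 ^ i))) (cong (λ y → x ^ (2 ^ i + y)) (sym (+-identityʳ (2 ^ i))))))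


  e<193/71 : ∀ j → (1 + j) ^ j * 71 ≤ 193 * j ^ j
  e<193/71 j = bound 16 (≤ᵇ⇒≤ _ _ tt)
    where
    open ≤-Reasoning
    bound : ∀ i → (1 + 2 ^ i) * square i (1 + 2 ^ i) * 71 ≤ 193 * (2 ^ i * square i (2 ^ i)) →
            (1 + j) ^ j * 71 ≤ 193 * j ^ j
    bound i check = go (2 ^ i) {{m^n≢0 2 i}} (subst₂ (λ a b → (1 + 2 ^ i) * a * 71 ≤ 193 * (2 ^ i * b))
        (square-^ i (1 + 2 ^ i)) (square-^ i (2 ^ i)) check)
      where
      lem₁ : ∀ s a → s * (a * 71) ≡ a * s * 71
      lem₁ = solve-∀
      lem₂ : ∀ a b → a * b * 71 ≡ a * (b * 71)
      lem₂ = solve-∀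
      lem₃ : ∀ a b → a * (193 * b) ≡ b * (193 * a)
      lem₃ = solve-∀
      go : ∀ s .{{_ : NonZero s}} → (1 + s) * (1 + s) ^ s * 71 ≤ 193 * (s * s ^ s) →
           (1 + j) ^ j * 71 ≤ 193 * j ^ j
      go s check = *-cancelˡ-≤ (s ^ (1 + s)) {{m^n≢0 s (1 + s)}} (begin
        s ^ (1 + s) * ((1 + j) ^ j * 71)  ≡⟨ lem₁ (s ^ (1 + s)) ((1 + j) ^ j) ⟩
        (1 + j) ^ j * s ^ (1 + s) * 71    ≤⟨ *-monoˡ-≤ 71 (e-bounds j s) ⟩
        j ^ j * (1 + s) ^ (1 + s) * 71    ≡⟨ lem₂ (j ^ j) ((1 + s) ^ (1 + s)) ⟩
        j ^ j * ((1 + s) ^ (1 + s) * 71)  ≤⟨ *-monoʳ-≤ (j ^ j) check ⟩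
        j ^ j * (193 * s ^ (1 + s))       ≡⟨ lem₃ (j ^ j) (s ^ (1 + s)) ⟩
        s ^ (1 + s) * (193 * j ^ j)       ∎)

  -- The probability that a d-set is rainbow

  falling : ℕ → ℕ → ℕ
  falling k zero    = 1
  falling k (suc d) = k * falling (pred k) d

  falling-! : ∀ v d → falling (d + v) d * v ! ≡ (d + v) !
  falling-! v zero    = +-identityʳ (v !)
  falling-! v (suc d) = trans (*-assoc (suc (d + v)) (falling (d + v) d) (v !)) (cong (suc (d + v) *_) (falling-! v d))

  falling≤^ : ∀ k d → falling k d ≤ k ^ d
  falling≤^ k zero    = ≤-refl
  falling≤^ k (suc d) = *-monoʳ-≤ k (≤-trans (falling≤^ (pred k) d) (^-monoˡ-≤ d (pred[n]≤n {k})))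

  1≤falling : ∀ v d → 1 ≤ falling (d + v) d
  1≤falling v zero    = ≤-refl
  1≤falling v (suc d) = *-mono-≤ {1} {suc (d + v)} (s≤s z≤n) (1≤falling v d)

  -- From k to k + 1 the quotient k^k/k! grows by (1 + 1/k)^k, which is below 193/71. Multiplying d
  -- such steps from v to d + v compares two factorials directly, so no constant factor of
  -- Stirling's formula comes in.
  stirling : ∀ v d → (d + v) ^ (d + v) * v ! * 71 ^ d ≤ 193 ^ d * (d + v) ! * v ^ v
  stirling v zero    = ≤-reflexive (lem (v ^ v) (v !))
    where
    lem : ∀ a b → a * b * 1 ≡ (b + 0) * a
    lem = solve-∀
  stirling v (suc d) = begin
    suc k * suc k ^ k * v ! * (71 * 71 ^ d)   ≡⟨ lem₁ (suc k) (suc k ^ k) (v !) (71 ^ d) ⟩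
    suc k * (suc k ^ k * 71) * (v ! * 71 ^ d) ≤⟨ *-monoˡ-≤ _ (*-monoʳ-≤ (suc k) (e<193/71 k)) ⟩
    suc k * (193 * k ^ k) * (v ! * 71 ^ d)    ≡⟨ lem₂ (suc k) (k ^ k) (v !) (71 ^ d) ⟩
    suc k * 193 * (k ^ k * v ! * 71 ^ d)      ≤⟨ *-monoʳ-≤ (suc k * 193) (stirling v d) ⟩
    suc k * 193 * (193 ^ d * k ! * v ^ v)     ≡⟨ lem₃ (suc k) (193 ^ d) (k !) (v ^ v) ⟩
    193 * 193 ^ d * (suc k * k !) * v ^ v     ∎
    where
    open ≤-Reasoning
    k = d + v
    lem₁ : ∀ a b c e → a * b * c * (71 * e) ≡ a * (b * 71) * (c * e)
    lem₁ = solve-∀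
    lem₂ : ∀ a b c e → a * (193 * b) * (c * e) ≡ a * 193 * (b * c * e)
    lem₂ = solve-∀
    lem₃ : ∀ a b c e → a * 193 * (b * c * e) ≡ 193 * b * (a * c) * e
    lem₃ = solve-∀

  -- With k = d + v, dividing `stirling` by k^v gives k^d / falling k d ≤ (193/71)^d (v/k)^v, and
  -- v/k ≤ 11/31 by hypothesis.
  1/probability : ∀ v d .{{_ : NonZero d}} → 31 * v ≤ 11 * (d + v) →
    (d + v) ^ d * 31 ^ v * 71 ^ d ≤ 193 ^ d * 11 ^ v * falling (d + v) d
  1/probability v d@(suc d′) 31v≤11k = *-cancelˡ-≤ (k ^ v * v !)
    {{m*n≢0 (k ^ v) (v !) {{m^n≢0 k v}} {{v !≢0}}}} (begin
    k ^ v * v ! * (k ^ d * 31 ^ v * 71 ^ d)        ≡⟨ lem₁ (k ^ v) (v !) (k ^ d) (31 ^ v) (71 ^ d) ⟩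
    k ^ d * k ^ v * v ! * 71 ^ d * 31 ^ v
      ≡⟨ cong (λ x → x * v ! * 71 ^ d * 31 ^ v) (sym (^-distribˡ-+-* k d v)) ⟩
    k ^ k * v ! * 71 ^ d * 31 ^ v                  ≤⟨ *-monoˡ-≤ (31 ^ v) (stirling v d) ⟩
    193 ^ d * k ! * v ^ v * 31 ^ v                 ≡⟨ *-assoc (193 ^ d * k !) (v ^ v) (31 ^ v) ⟩
    193 ^ d * k ! * (v ^ v * 31 ^ v)
      ≤⟨ *-monoʳ-≤ (193 ^ d * k !) (*-^-mono {v} {31} {11} {k} v (subst (_≤ 11 * k) (*-comm 31 v) 31v≤11k)) ⟩
    193 ^ d * k ! * (11 ^ v * k ^ v)
      ≡⟨ cong (λ x → 193 ^ d * x * (11 ^ v * k ^ v)) (sym (falling-! v d)) ⟩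
    193 ^ d * (falling k d * v !) * (11 ^ v * k ^ v)
      ≡⟨ lem₂ (193 ^ d) (falling k d) (v !) (11 ^ v) (k ^ v) ⟩
    k ^ v * v ! * (193 ^ d * 11 ^ v * falling k d) ∎)
    where
    open ≤-Reasoning
    k = d + v
    lem₁ : ∀ a b c e f → a * b * (c * e * f) ≡ c * a * b * f * e
    lem₁ = solve-∀
    lem₂ : ∀ a b c e f → a * (b * c) * (e * f) ≡ f * c * (a * e * b)
    lem₂ = solve-∀

  -- Counting sign vectors with few minus signs

  binomials≤ : ℕ → ℕ → ℕ
  binomials≤ zero    m       = 1
  binomials≤ (suc k) zero    = 1
  binomials≤ (suc k) (suc m) = binomials≤ k (suc m) + binomials≤ k m

  -- x^m Σ_{i ≤ m} binomial(k, i) ≤ (1 + x)^k at x = 10/21.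
  binomials≤-bound : ∀ k m → binomials≤ k m * 21 ^ k * 10 ^ m ≤ 31 ^ k * 21 ^ m
  binomials≤-bound zero    m    = ≤-trans (≤-reflexive (+-identityʳ (10 ^ m)))
    (≤-trans (^-monoˡ-≤ m (≤ᵇ⇒≤ 10 21 tt)) (≤-reflexive (sym (+-identityʳ (21 ^ m)))))
  binomials≤-bound (suc k) zero = ≤-trans (≤-reflexive (lem (21 ^ suc k)))
    (*-monoˡ-≤ 1 (^-monoˡ-≤ (suc k) (≤ᵇ⇒≤ 21 31 tt)))
    where
    lem : ∀ a → 1 * a * 1 ≡ a * 1
    lem = solve-∀
  binomials≤-bound (suc k) (suc m) = begin
    (b₁ + b₂) * (21 * 21 ^ k) * (10 * 10 ^ m)                     ≡⟨ lem₁ b₁ b₂ (21 ^ k) (10 ^ m) ⟩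
    21 * (b₁ * 21 ^ k * (10 * 10 ^ m)) + 210 * (b₂ * 21 ^ k * 10 ^ m)
      ≤⟨ +-mono-≤ (*-monoʳ-≤ 21 (binomials≤-bound k (suc m))) (*-monoʳ-≤ 210 (binomials≤-bound k m)) ⟩
    21 * (31 ^ k * (21 * 21 ^ m)) + 210 * (31 ^ k * 21 ^ m)       ≡⟨ lem₂ (31 ^ k) (21 ^ m) ⟩
    31 * 31 ^ k * (21 * 21 ^ m)                                   ∎
    where
    open ≤-Reasoning
    b₁ = binomials≤ k (suc m)
    b₂ = binomials≤ k m
    lem₁ : ∀ b c x y → (b + c) * (21 * x) * (10 * y) ≡ 21 * (b * x * (10 * y)) + 210 * (c * x * y)
    lem₁ = solve-∀
    lem₂ : ∀ x y → 21 * (x * (21 * y)) + 210 * (x * y) ≡ 31 * x * (21 * y)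
    lem₂ = solve-∀

  -- The exponential rate 4.075

  ratio-mono : ∀ {a b i j} → b ≤ a → i ≤ j → a ^ i * b ^ j ≤ a ^ j * b ^ i
  ratio-mono {a} {b} {i} {j} b≤a i≤j with m≤n⇒∃[o]m+o≡n i≤j
  ... | l , refl = begin
    a ^ i * b ^ (i + l)       ≡⟨ cong (a ^ i *_) (^-distribˡ-+-* b i l) ⟩
    a ^ i * (b ^ i * b ^ l)   ≤⟨ *-monoʳ-≤ (a ^ i) (*-monoʳ-≤ (b ^ i) (^-monoˡ-≤ l b≤a)) ⟩
    a ^ i * (b ^ i * a ^ l)   ≡⟨ lem (a ^ i) (b ^ i) (a ^ l) ⟩
    a ^ i * a ^ l * b ^ i     ≡⟨ cong (_* b ^ i) (sym (^-distribˡ-+-* a i l)) ⟩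
    a ^ (i + l) * b ^ i       ∎
    where
    open ≤-Reasoning
    lem : ∀ x y z → x * (y * z) ≡ x * z * y
    lem = solve-∀

  ^-cancelˡ-≤ : ∀ n .{{_ : NonZero n}} {a b} → a ^ n ≤ b ^ n → a ≤ b
  ^-cancelˡ-≤ n le = ≮⇒≥ λ b<a → <⇒≱ (^-monoˡ-< n b<a) le

  ^-comm-exp : ∀ x i j → (x ^ i) ^ j ≡ (x ^ j) ^ i
  ^-comm-exp x i j = trans (^-*-assoc x i j) (trans (cong (x ^_) (*-comm i j)) (sym (^-*-assoc x j i)))

  ratio-mono-^ : ∀ {a b} i p j q → b ≤ a → i * p ≤ j * q → (a ^ i) ^ p * (b ^ j) ^ q ≤ (a ^ j) ^ q * (b ^ i) ^ p
  ratio-mono-^ {a} {b} i p j q b≤a le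
    rewrite ^-*-assoc a i p | ^-*-assoc b j q | ^-*-assoc a j q | ^-*-assoc b i p = ratio-mono b≤a le

  -- The first four inequalities are multiplied together, the fifth, a comparison of constants, is
  -- applied to the product of their right sides, and the common factor b₁ b₂ f b₄ is cancelled.
  combine : ∀ {a₁ b₁ c₁ e₁ a₂ b₂ c₂ e₂ f a₃ h g c₃ y b₄ g₀ c₄ E T F S} →
    .{{NonZero b₁}} → .{{NonZero b₂}} → .{{NonZero f}} → .{{NonZero b₄}} →
    a₁ * b₁ ≤ c₁ * e₁ → a₂ * b₂ ≤ c₂ * e₂ → f * a₃ ≤ h * (g * c₃) → y * b₄ ≤ g₀ * c₄ →
    c₁ * c₂ * E * c₃ * c₄ * T ≤ F * b₁ * b₂ * S * f * b₄ →
    (a₁ * a₂ * E * a₃) * (y * T) ≤ (e₁ * e₂ * g * S) * (F * (g₀ * h))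
  combine {a₁} {b₁} {c₁} {e₁} {a₂} {b₂} {c₂} {e₂} {f} {a₃} {h} {g} {c₃} {y} {b₄} {g₀} {c₄} {E} {T} {F} {S} p₁ p₂ p₃ p₄ p₅ =
    *-cancelˡ-≤ (b₁ * b₂ * f * b₄)
      {{m*n≢0 (b₁ * b₂ * f) b₄ {{m*n≢0 (b₁ * b₂) f {{m*n≢0 b₁ b₂}}}}}} (begin
    b₁ * b₂ * f * b₄ * ((a₁ * a₂ * E * a₃) * (y * T))           ≡⟨ lem₁ a₁ b₁ a₂ b₂ f a₃ y b₄ E T ⟩
    (a₁ * b₁) * (a₂ * b₂) * (f * a₃) * (y * b₄) * (E * T)
      ≤⟨ *-monoˡ-≤ (E * T) (*-mono-≤ (*-mono-≤ (*-mono-≤ p₁ p₂) p₃) p₄) ⟩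
    (c₁ * e₁) * (c₂ * e₂) * (h * (g * c₃)) * (g₀ * c₄) * (E * T) ≡⟨ lem₂ c₁ e₁ c₂ e₂ h g c₃ g₀ c₄ E T ⟩
    c₁ * c₂ * E * c₃ * c₄ * T * (e₁ * e₂ * g * g₀ * h)          ≤⟨ *-monoˡ-≤ _ p₅ ⟩
    F * b₁ * b₂ * S * f * b₄ * (e₁ * e₂ * g * g₀ * h)           ≡⟨ lem₃ F b₁ b₂ S f b₄ e₁ e₂ g g₀ h ⟩
    b₁ * b₂ * f * b₄ * ((e₁ * e₂ * g * S) * (F * (g₀ * h)))     ∎)
    where
    open ≤-Reasoning
    lem₁ : ∀ a₁ b₁ a₂ b₂ f a₃ y b₄ E T → b₁ * b₂ * f * b₄ * ((a₁ * a₂ * E * a₃) * (y * T))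
           ≡ (a₁ * b₁) * (a₂ * b₂) * (f * a₃) * (y * b₄) * (E * T)
    lem₁ = solve-∀
    lem₂ : ∀ c₁ e₁ c₂ e₂ h g c₃ g₀ c₄ E T → (c₁ * e₁) * (c₂ * e₂) * (h * (g * c₃)) * (g₀ * c₄) * (E * T)
           ≡ c₁ * c₂ * E * c₃ * c₄ * T * (e₁ * e₂ * g * g₀ * h)
    lem₂ = solve-∀
    lem₃ : ∀ F b₁ b₂ S f b₄ e₁ e₂ g g₀ h → F * b₁ * b₂ * S * f * b₄ * (e₁ * e₂ * g * g₀ * h)
           ≡ b₁ * b₂ * f * b₄ * ((e₁ * e₂ * g * S) * (F * (g₀ * h)))
    lem₃ = solve-∀

  -- The optimum of the exponential rate over k/d is 4.0747…, attained near
  -- k/d = 31/20; the factor ((G + 1)/G)^d absorbs d + 2 and still fits below 4.075.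
  G : ℕ
  G = 20000

  rate-check : 31 ^ 31 * 21 ^ 10 * 193 ^ 20 * 11 ^ 11 * (1 + G) ^ 20 * 1000 ^ 20
               ≤ 4075 ^ 20 * 21 ^ 31 * 10 ^ 10 * 71 ^ 20 * 31 ^ 11 * G ^ 20
  rate-check = ≤ᵇ⇒≤ _ _ tt

  ^-distribʳ-*₆ : ∀ a b c e f g n → (a * b * c * e * f * g) ^ n ≡ a ^ n * b ^ n * c ^ n * e ^ n * f ^ n * g ^ n
  ^-distribʳ-*₆ a b c e f g n
    rewrite ^-distribʳ-* (a * b * c * e * f) g n | ^-distribʳ-* (a * b * c * e) f n
          | ^-distribʳ-* (a * b * c) e n | ^-distribʳ-* (a * b) c n | ^-distribʳ-* a b n = refl

  -- Bernoulli's inequality 1 + d/g ≤ (1 + 1/g)^d. It absorbs a factor linear in d at the cost of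
  -- the constant g and a base only slightly above 1.
  linear≤exp : ∀ g d .{{_ : NonZero g}} → (d + g) * g ^ d ≤ g * (1 + g) ^ d
  linear≤exp g d = begin
    (d + g) * g ^ d     ≡⟨ trans (*-comm (d + g) (g ^ d)) (cong (g ^ d *_) (+-comm d g)) ⟩
    g ^ d * (g + d)     ≤⟨ bernoulli⁺ g d ⟩
    (g + 1) ^ d * g     ≡⟨ trans (*-comm _ g) (cong (λ x → g * x ^ d) (+-comm g 1)) ⟩
    g * (1 + g) ^ d     ∎
    where open ≤-Reasoning


  -- The constants are variables so that no power of a literal gets evaluated.
  module Rate (N A B C a b c e E S T F g : ℕ)
    {{N≢0 : NonZero N}} {{a≢0 : NonZero a}} {{b≢0 : NonZero b}} {{c≢0 : NonZero c}} {{g≢0 : NonZero g}} {{e≢0 : NonZero e}}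
    (b≤a : b ≤ a) (c≤b : c ≤ b) (e≤a : e ≤ a) (2≤g : 2 ≤ g)
    (check : a ^ A * b ^ C * E ^ N * e ^ B * (1 + g) ^ N * T ^ N
             ≤ F ^ N * b ^ A * c ^ C * S ^ N * a ^ B * g ^ N)
    (d v m : ℕ) (Nk≤Ad : (d + v) * N ≤ A * d) (Bd≤Nv+N : B * d ≤ v * N + N)
    (Nm≤Cd : m * N ≤ C * d) where

    -- The exponents d + v, v and m are known only through bounds on their N-fold multiples, N being
    -- a common denominator of their ratios to d. The comparison is therefore made for N-th powers,
    -- and `rate` extracts the root.
    rate^N :
      ((a ^ (d + v)) ^ N * (b ^ m) ^ N * (E ^ N) ^ d * (e ^ v) ^ N) * ((2 + d) ^ N * (T ^ N) ^ d)
      ≤ ((b ^ (d + v)) ^ N * (c ^ m) ^ N * (a ^ v) ^ N * (S ^ N) ^ d) * ((F ^ N) ^ d * (g ^ N * a ^ N))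
    rate^N = combine
      {(a ^ (d + v)) ^ N} {_} {(a ^ A) ^ d} {(b ^ (d + v)) ^ N} {(b ^ m) ^ N} {_} {(b ^ C) ^ d} {(c ^ m) ^ N}
      {_} {(e ^ v) ^ N} {a ^ N} {(a ^ v) ^ N} {(e ^ B) ^ d} {(2 + d) ^ N} {_} {g ^ N} {_} {_} {_} {(F ^ N) ^ d}
      {{m^n≢0 (b ^ A) d {{m^n≢0 b A}}}} {{m^n≢0 (c ^ C) d {{m^n≢0 c C}}}}
      {{m^n≢0 (a ^ B) d {{m^n≢0 a B}}}} {{m^n≢0 (g ^ N) d {{m^n≢0 g N}}}}
      (ratio-mono-^ {a} {b} (d + v) N A d b≤a Nk≤Ad)
      (ratio-mono-^ {b} {c} m N C d c≤b Nm≤Cd)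
      p₃ p₄ p₅
      where
      open ≤-Reasoning
      -- Here rounding acts against the estimate: (e/a)^v decreases in v, and v is rounded down.
      -- Losing at most 1 in v costs the factor a, the 31 in the final constant.
      p₃ : (a ^ B) ^ d * (e ^ v) ^ N ≤ a ^ N * ((a ^ v) ^ N * (e ^ B) ^ d)
      p₃ = begin
        (a ^ B) ^ d * (e ^ v) ^ N             ≡⟨ cong₂ _*_ (^-*-assoc a B d) (^-*-assoc e v N) ⟩
        a ^ (B * d) * e ^ (v * N)             ≤⟨ *-monoʳ-≤ (a ^ (B * d)) (^-monoʳ-≤ e (m≤m+n (v * N) N)) ⟩
        a ^ (B * d) * e ^ (v * N + N)
          ≤⟨ ratio-mono {a} {e} e≤a Bd≤Nv+N ⟩
        a ^ (v * N + N) * e ^ (B * d)        ≡⟨ cong (_* e ^ (B * d)) (^-distribˡ-+-* a (v * N) N) ⟩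
        a ^ (v * N) * a ^ N * e ^ (B * d)
          ≡⟨ sym (cong₂ (λ x y → x * a ^ N * y) (^-*-assoc a v N) (^-*-assoc e B d)) ⟩
        (a ^ v) ^ N * a ^ N * (e ^ B) ^ d    ≡⟨ lem ((a ^ v) ^ N) (a ^ N) ((e ^ B) ^ d) ⟩
        a ^ N * ((a ^ v) ^ N * (e ^ B) ^ d)  ∎
        where
        lem : ∀ a b c → a * b * c ≡ b * (a * c)
        lem = solve-∀
      p₄ : (2 + d) ^ N * (g ^ N) ^ d ≤ g ^ N * ((1 + g) ^ N) ^ d
      p₄ = subst₂ (λ x y → (2 + d) ^ N * x ≤ g ^ N * y) (^-comm-exp g d N) (^-comm-exp (1 + g) d N)
        (*-^-mono {2 + d} {g ^ d} {g} {(1 + g) ^ d} N (≤-trans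
          (*-monoˡ-≤ (g ^ d) (subst (2 + d ≤_) (+-comm g d) (+-monoˡ-≤ d 2≤g)))
          (linear≤exp g d)))
      p₅ : (a ^ A) ^ d * (b ^ C) ^ d * (E ^ N) ^ d * (e ^ B) ^ d * ((1 + g) ^ N) ^ d * (T ^ N) ^ d
           ≤ (F ^ N) ^ d * (b ^ A) ^ d * (c ^ C) ^ d * (S ^ N) ^ d * (a ^ B) ^ d * (g ^ N) ^ d
      p₅ = subst₂ _≤_
        (^-distribʳ-*₆ (a ^ A) (b ^ C) (E ^ N) (e ^ B) ((1 + g) ^ N) (T ^ N) d)
        (^-distribʳ-*₆ (F ^ N) (b ^ A) (c ^ C) (S ^ N) (a ^ B) (g ^ N) d)
        (^-monoˡ-≤ d check)

    rate : (a ^ (d + v) * b ^ m * E ^ d * e ^ v) * ((2 + d) * T ^ d)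
           ≤ (b ^ (d + v) * c ^ m * a ^ v * S ^ d) * (F ^ d * (g * a))
    rate = ^-cancelˡ-≤ N (subst₂ _≤_
      (lem N (a ^ (d + v)) (b ^ m) (^-comm-exp E N d) (e ^ v) (2 + d) (^-comm-exp T N d))
      (lem′ N (b ^ (d + v)) (c ^ m) (a ^ v) (^-comm-exp S N d) (^-comm-exp F N d))
      rate^N)
      where
      lem : ∀ n a b {c c′} → c′ ≡ c ^ n → ∀ e y {t t′} → t′ ≡ t ^ n →
            (a ^ n * b ^ n * c′ * e ^ n) * (y ^ n * t′) ≡ ((a * b * c * e) * (y * t)) ^ n
      lem n a b {c} refl e y {t} refl
        rewrite ^-distribʳ-* (a * b * c * e) (y * t) n | ^-distribʳ-* (a * b * c) e n
              | ^-distribʳ-* (a * b) c n | ^-distribʳ-* a b n | ^-distribʳ-* y t n = refl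
      lem′ : ∀ n x y z {s s′} → s′ ≡ s ^ n → ∀ {f f′} → f′ ≡ f ^ n →
             (x ^ n * y ^ n * z ^ n * s′) * (f′ * (g ^ n * a ^ n)) ≡ ((x * y * z * s) * (f * (g * a))) ^ n
      lem′ n x y z {s} refl {f} refl
        rewrite ^-distribʳ-* (x * y * z * s) (f * (g * a)) n | ^-distribʳ-* (x * y * z) s n
              | ^-distribʳ-* (x * y) z n | ^-distribʳ-* x y n | ^-distribʳ-* f (g * a) n | ^-distribʳ-* g a n = refl

  -- With p = falling k d / k^d the last hypothesis says R ≤ c (2 + d) · binomials≤ k m / p. The two
  -- preceding estimates bound binomials≤ k m / p by Num/Den, a quotient of pure powers, and `rate`
  -- compares (2 + d) Num/Den with 31 G · 4.075^d.
  size-bound : ∀ d v m R c .{{_ : NonZero d}} → (d + v) * 20 ≤ 31 * d → 11 * d ≤ v * 20 + 20 → m * 20 ≤ 10 * d →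
    R * falling (d + v) d ≤ c * (2 + d) * binomials≤ (d + v) m * (d + v) ^ d →
    R * 1000 ^ d ≤ c * (G * 31) * 4075 ^ d
  size-bound d v m R c 20k≤31d 11d≤20v+20 20m≤10d h = *-cancelˡ-≤ Den
    {{m*n≢0 _ (71 ^ d) {{m*n≢0 _ (31 ^ v) {{m*n≢0 (21 ^ k) (10 ^ m) {{m^n≢0 21 k}} {{m^n≢0 10 m}}}} {{m^n≢0 31 v}}}} {{m^n≢0 71 d}}}}
    (begin
    Den * (R * 1000 ^ d)               ≡⟨ lem₁ Den R (1000 ^ d) ⟩
    R * Den * 1000 ^ d                 ≤⟨ *-monoˡ-≤ (1000 ^ d) RDen≤ ⟩
    c * (2 + d) * Num * 1000 ^ d       ≡⟨ lem₂ c (2 + d) Num (1000 ^ d) ⟩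
    c * (Num * ((2 + d) * 1000 ^ d))   ≤⟨ *-monoʳ-≤ c rate ⟩
    c * (Den * (4075 ^ d * (G * 31)))  ≡⟨ lem₃ c Den (4075 ^ d) (G * 31) ⟩
    Den * (c * (G * 31) * 4075 ^ d)    ∎)
    where
    open ≤-Reasoning
    k = d + v
    -- All ratios follow from k/d = 31/20: v/d = 11/20 and v/k = 11/31, while m/d = 10/20 gives m/k
    -- = 10/31. The minimum of (1 + x)^k / x^m lies where x/(1 + x) = m/k, hence x = 10/21.
    open Rate 20 31 11 10 31 21 10 11 193 71 1000 4075 G (≤ᵇ⇒≤ 21 31 tt) (≤ᵇ⇒≤ 10 21 tt) (≤ᵇ⇒≤ 11 31 tt) (≤ᵇ⇒≤ 2 G tt)
      rate-check d v m 20k≤31d 11d≤20v+20 20m≤10d using (rate)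
    A = falling k d
    Bn = binomials≤ k m
    Den = 21 ^ k * 10 ^ m * 31 ^ v * 71 ^ d
    Num = 31 ^ k * 21 ^ m * 193 ^ d * 11 ^ v
    lem₁ : ∀ a b c → a * (b * c) ≡ b * a * c
    lem₁ = solve-∀
    lem₂ : ∀ a b c e → a * b * c * e ≡ a * (c * (b * e))
    lem₂ = solve-∀
    lem₃ : ∀ a b c e → a * (b * (c * e)) ≡ b * (a * e * c)
    lem₃ = solve-∀
    lem₄ : ∀ R A a b c e → A * (R * (a * b * c * e)) ≡ R * A * (a * b * (c * e))
    lem₄ = solve-∀
    lem₆ : ∀ y q r s t A → y * ((q * r) * (s * t * A)) ≡ A * (y * (q * r * s * t))
    lem₆ = solve-∀
    31v≤11k : 31 * v ≤ 11 * k
    31v≤11k = +-cancelʳ-≤ (20 * d) _ _ (begin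
      31 * v + 20 * d         ≡⟨ lem d v ⟩
      (d + v) * 20 + 11 * v   ≤⟨ +-monoˡ-≤ (11 * v) 20k≤31d ⟩
      31 * d + 11 * v         ≡⟨ lem′ d v ⟩
      11 * k + 20 * d         ∎)
      where
      lem : ∀ d v → 31 * v + 20 * d ≡ (d + v) * 20 + 11 * v
      lem = solve-∀
      lem′ : ∀ d v → 31 * d + 11 * v ≡ 11 * (d + v) + 20 * d
      lem′ = solve-∀
    RDen≤ : R * Den ≤ c * (2 + d) * Num
    RDen≤ = *-cancelˡ-≤ A {{>-nonZero (1≤falling v d)}} (begin
      A * (R * Den)                                        ≡⟨ lem₄ R A (21 ^ k) (10 ^ m) (31 ^ v) (71 ^ d) ⟩
      R * A * (21 ^ k * 10 ^ m * (31 ^ v * 71 ^ d))        ≤⟨ *-monoˡ-≤ _ h ⟩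
      c * (2 + d) * Bn * k ^ d * (21 ^ k * 10 ^ m * (31 ^ v * 71 ^ d))
        ≡⟨ lem₇ (c * (2 + d)) Bn (k ^ d) (21 ^ k) (10 ^ m) (31 ^ v) (71 ^ d) ⟩
      c * (2 + d) * ((Bn * 21 ^ k * 10 ^ m) * (k ^ d * 31 ^ v * 71 ^ d))
        ≤⟨ *-monoʳ-≤ (c * (2 + d)) (*-mono-≤ (binomials≤-bound k m) (1/probability v d 31v≤11k)) ⟩
      c * (2 + d) * ((31 ^ k * 21 ^ m) * (193 ^ d * 11 ^ v * A))
        ≡⟨ lem₆ (c * (2 + d)) (31 ^ k) (21 ^ m) (193 ^ d) (11 ^ v) A ⟩
      A * (c * (2 + d) * Num)                              ∎)
      where
      lem₇ : ∀ y b p q r s t → y * b * p * (q * r * (s * t)) ≡ y * ((b * q * r) * (p * s * t))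
      lem₇ = solve-∀

-- Finite averages over colourings

module Colourings where

  open Estimates
  open import Data.Fin.Base using (Fin; zero; suc)
  open import Data.List.Base as List using (List; []; _∷_; _++_; map; concatMap; length; tabulate; allFin)
  import Data.List.Properties as List
  open import Data.List.Membership.Propositional using (_∈_)
  open import Data.List.Membership.Propositional.Properties using (∈-map⁺; ∈-++⁺ˡ; ∈-++⁺ʳ)
  open import Data.List.Relation.Unary.Any using (here; there)
  open import Data.List.Relation.Unary.All as All using (All; []; _∷_)
  import Data.List.Relation.Unary.All.Properties as All
  open import Data.Nat.Base
  open import Data.Nat.Properties
  open import Data.Nat.Tactic.RingSolver using (solve-∀)
  open import Data.Product.Base using (∃; _×_; _,_; proj₁; proj₂)
  open import Data.Sum.Base using (_⊎_; inj₁; inj₂)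
  open import Data.Vec.Base as Vec using (Vec; []; _∷_; replicate; updateAt; toList)
  import Data.Vec.Properties as Vec
  open import Function.Base using (_∘_; id)
  open import Level using (Level)
  open import Relation.Binary.PropositionalEquality
  open import Relation.Nullary using (yes; no)

  private
    variable
      ℓ : Level
      X Y : Set ℓ

  ∑ : List X → (X → ℕ) → ℕ
  ∑ []       f = 0
  ∑ (x ∷ xs) f = f x + ∑ xs f

  ∑-cong : ∀ (xs : List X) {f g} → (∀ x → f x ≡ g x) → ∑ xs f ≡ ∑ xs g
  ∑-cong []       eq = refl
  ∑-cong (x ∷ xs) eq = cong₂ _+_ (eq x) (∑-cong xs eq)

  ∑-++ : ∀ (xs ys : List X) f → ∑ (xs ++ ys) f ≡ ∑ xs f + ∑ ys f
  ∑-++ []       ys f = refl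
  ∑-++ (x ∷ xs) ys f = trans (cong (f x +_) (∑-++ xs ys f)) (sym (+-assoc (f x) _ _))

  ∑-map : ∀ (g : X → Y) xs f → ∑ (map g xs) f ≡ ∑ xs (f ∘ g)
  ∑-map g []       f = refl
  ∑-map g (x ∷ xs) f = cong (f (g x) +_) (∑-map g xs f)

  ∑-concatMap : ∀ (g : X → List Y) xs f → ∑ (concatMap g xs) f ≡ ∑ xs (λ x → ∑ (g x) f)
  ∑-concatMap g []       f = refl
  ∑-concatMap g (x ∷ xs) f = trans (∑-++ (g x) _ f) (cong (∑ (g x) f +_) (∑-concatMap g xs f))

  ∑-+ : ∀ (xs : List X) f g → ∑ xs (λ x → f x + g x) ≡ ∑ xs f + ∑ xs g
  ∑-+ []       f g = refl
  ∑-+ (x ∷ xs) f g = trans (cong (f x + g x +_) (∑-+ xs f g)) (lem (f x) (g x) (∑ xs f) (∑ xs g))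
    where
    lem : ∀ a b c e → a + b + (c + e) ≡ a + c + (b + e)
    lem = solve-∀

  ∑-*ˡ : ∀ c (xs : List X) f → ∑ xs (λ x → c * f x) ≡ c * ∑ xs f
  ∑-*ˡ c []       f = sym (*-zeroʳ c)
  ∑-*ˡ c (x ∷ xs) f = trans (cong (c * f x +_) (∑-*ˡ c xs f)) (sym (*-distribˡ-+ c (f x) _))

  ∑-const : ∀ (xs : List X) c → ∑ xs (λ _ → c) ≡ length xs * c
  ∑-const []       c = refl
  ∑-const (x ∷ xs) c = cong (c +_) (∑-const xs c)

  ∑-swap : ∀ (xs : List X) (ys : List Y) (f : X → Y → ℕ) → ∑ xs (λ x → ∑ ys (f x)) ≡ ∑ ys (λ y → ∑ xs (λ x → f x y))
  ∑-swap []       ys f = sym (trans (∑-const ys 0) (*-zeroʳ (length ys)))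
  ∑-swap (x ∷ xs) ys f = trans (cong (∑ ys (f x) +_) (∑-swap xs ys f)) (sym (∑-+ ys (f x) (λ y → ∑ xs (λ x → f x y))))

  ∈⇒≤∑ : ∀ {x : X} {xs} f → x ∈ xs → f x ≤ ∑ xs f
  ∈⇒≤∑ {xs = _ ∷ xs} f (here refl) = m≤m+n _ (∑ xs f)
  ∈⇒≤∑ {xs = y ∷ _}  f (there x∈)  = ≤-trans (∈⇒≤∑ f x∈) (m≤n+m _ (f y))

  -- The existence step of the probabilistic method: if every value were at least c, so would be the
  -- average. On a list the witness is found by search.
  ∑<⇒∃< : ∀ (xs : List X) f c → ∑ xs f < length xs * c → ∃ λ x → f x < c
  ∑<⇒∃< (x ∷ xs) f c lt with f x <? c
  ... | yes fx<c = x , fx<c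
  ... | no  fx≮c = ∑<⇒∃< xs f c (+-cancelˡ-< c _ _ (≤-<-trans (+-monoˡ-≤ (∑ xs f) (≮⇒≥ fx≮c)) lt))

  ∑-tabulate : ∀ {n} (g : Fin n → X) (h : Fin n → Y) f f′ → (∀ i → f (g i) ≡ f′ (h i)) →
               ∑ (tabulate g) f ≡ ∑ (tabulate h) f′
  ∑-tabulate {n = zero}  g h f f′ eq = refl
  ∑-tabulate {n = suc n} g h f f′ eq = cong₂ _+_ (eq zero) (∑-tabulate (g ∘ suc) (h ∘ suc) f f′ (eq ∘ suc))

  ∑-allFin-suc : ∀ n (f : Fin (suc n) → ℕ) → ∑ (allFin (suc n)) f ≡ f zero + ∑ (allFin n) (f ∘ suc)
  ∑-allFin-suc n f = cong (f zero +_) (∑-tabulate suc id f (f ∘ suc) λ _ → refl)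

  vectors : List X → ∀ n → List (Vec X n)
  vectors xs zero    = [] ∷ []
  vectors xs (suc n) = concatMap (λ x → map (x ∷_) (vectors xs n)) xs

  ∑-vectors : ∀ (xs : List X) n f → ∑ (vectors xs (suc n)) f ≡ ∑ xs (λ x → ∑ (vectors xs n) (λ v → f (x ∷ v)))
  ∑-vectors xs n f = trans (∑-concatMap _ xs f) (∑-cong xs λ x → ∑-map (x ∷_) (vectors xs n) f)

  length≡∑ : ∀ (xs : List X) → length xs ≡ ∑ xs (λ _ → 1)
  length≡∑ xs = trans (sym (*-identityʳ _)) (sym (∑-const xs 1))

  ∏ : List X → (X → ℕ) → ℕ
  ∏ []       f = 1
  ∏ (x ∷ xs) f = f x * ∏ xs f

  -- Independence of N uniform draws from xs: the mean of a product of weights is the product of the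
  -- means.
  ∑-∏ : ∀ (xs : List X) f N → ∑ (vectors xs N) (λ v → ∏ (toList v) f) ≡ ∑ xs f ^ N
  ∑-∏ xs f zero    = refl
  ∑-∏ xs f (suc N) = begin
    ∑ (vectors xs (suc N)) (λ v → ∏ (toList v) f)               ≡⟨ ∑-vectors xs N _ ⟩
    ∑ xs (λ x → ∑ (vectors xs N) (λ v → f x * ∏ (toList v) f))
      ≡⟨ ∑-cong xs (λ x → trans (∑-*ˡ (f x) (vectors xs N) _) (cong (f x *_) (∑-∏ xs f N))) ⟩
    ∑ xs (λ x → f x * ∑ xs f ^ N)                               ≡⟨ ∑-cong xs (λ x → *-comm (f x) _) ⟩
    ∑ xs (λ x → ∑ xs f ^ N * f x)                               ≡⟨ ∑-*ˡ (∑ xs f ^ N) xs f ⟩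
    ∑ xs f ^ N * ∑ xs f                                         ≡⟨ *-comm _ (∑ xs f) ⟩
    ∑ xs f * ∑ xs f ^ N                                         ∎
    where open ≡-Reasoning

  length-vectors : ∀ (xs : List X) n → length (vectors xs n) ≡ length xs ^ n
  length-vectors xs n = begin
    length (vectors xs n)                                 ≡⟨ length≡∑ (vectors xs n) ⟩
    ∑ (vectors xs n) (λ _ → 1)                            ≡⟨ ∑-cong (vectors xs n) (λ v → sym (ones (toList v))) ⟩
    ∑ (vectors xs n) (λ v → ∏ (toList v) (λ _ → 1))       ≡⟨ ∑-∏ xs _ n ⟩
    ∑ xs (λ _ → 1) ^ n                                    ≡⟨ cong (_^ n) (sym (length≡∑ xs)) ⟩
    length xs ^ n                                         ∎
    where
    open ≡-Reasoning
    ones : ∀ (ys : List X) → ∏ ys (λ _ → 1) ≡ 1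
    ones []       = refl
    ones (y ∷ ys) = trans (+-identityʳ _) (ones ys)

  -- An inductive form of `IsMultilinear`: recursion over the coordinates suits counting and
  -- enumeration better than an increasing index function.
  data ZeroOne : ∀ {n} → ℕ → Vec ℕ n → Set where
    []  : ZeroOne 0 []
    0∷_ : ∀ {n d} {e : Vec ℕ n} → ZeroOne d e → ZeroOne d (0 ∷ e)
    1∷_ : ∀ {n d} {e : Vec ℕ n} → ZeroOne d e → ZeroOne (suc d) (1 ∷ e)

  ZeroOne⇒≤ : ∀ {n d} {e : Vec ℕ n} → ZeroOne d e → d ≤ n
  ZeroOne⇒≤ []     = z≤n
  ZeroOne⇒≤ (0∷ b) = m≤n⇒m≤1+n (ZeroOne⇒≤ b)
  ZeroOne⇒≤ (1∷ b) = s≤s (ZeroOne⇒≤ b)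

  ZeroOne-replicate : ∀ n → ZeroOne 0 (replicate n 0)
  ZeroOne-replicate zero    = []
  ZeroOne-replicate (suc n) = 0∷ ZeroOne-replicate n

  zeroOnes : ∀ n (d : ℕ) → List (Vec ℕ n)
  zeroOnes zero    zero    = [] ∷ []
  zeroOnes zero    (suc d) = []
  zeroOnes (suc n) zero    = map (0 ∷_) (zeroOnes n zero)
  zeroOnes (suc n) (suc d) = map (0 ∷_) (zeroOnes n (suc d)) ++ map (1 ∷_) (zeroOnes n d)

  zeroOnes-sound : ∀ n d → All (ZeroOne d) (zeroOnes n d)
  zeroOnes-sound zero    zero    = [] ∷ []
  zeroOnes-sound zero    (suc d) = []
  zeroOnes-sound (suc n) zero    = All.map⁺ (All.map 0∷_ (zeroOnes-sound n zero))
  zeroOnes-sound (suc n) (suc d) = All.++⁺ (All.map⁺ (All.map 0∷_ (zeroOnes-sound n (suc d))))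
                                           (All.map⁺ (All.map 1∷_ (zeroOnes-sound n d)))

  zeroOnes-complete : ∀ {n d} {e : Vec ℕ n} → ZeroOne d e → e ∈ zeroOnes n d
  zeroOnes-complete []                   = here refl
  zeroOnes-complete {d = zero}  (0∷ b)   = ∈-map⁺ (0 ∷_) (zeroOnes-complete b)
  zeroOnes-complete {d = suc d} (0∷ b)   = ∈-++⁺ˡ (∈-map⁺ (0 ∷_) (zeroOnes-complete b))
  zeroOnes-complete {suc n} {suc d} (1∷ b) = ∈-++⁺ʳ (map (0 ∷_) (zeroOnes n (suc d))) (∈-map⁺ (1 ∷_) (zeroOnes-complete b))

  -- A crude bound on binomial(n, d) is enough, since only its logarithm enters the number of
  -- colourings.
  length-zeroOnes : ∀ n (d : ℕ) → length (zeroOnes n d) ≤ n ^ d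
  length-zeroOnes zero    zero    = ≤-refl
  length-zeroOnes zero    (suc d) = z≤n
  length-zeroOnes (suc n) zero    = ≤-trans (≤-reflexive (List.length-map _ (zeroOnes n zero))) (length-zeroOnes n zero)
  length-zeroOnes (suc n) (suc d) = begin
    length (map (0 ∷_) (zeroOnes n (suc d)) ++ map (1 ∷_) (zeroOnes n d))
      ≡⟨ trans (List.length-++ (map (0 ∷_) (zeroOnes n (suc d))))
           (cong₂ _+_ (List.length-map _ (zeroOnes n (suc d))) (List.length-map _ (zeroOnes n d))) ⟩
    length (zeroOnes n (suc d)) + length (zeroOnes n d)   ≤⟨ +-mono-≤ (length-zeroOnes n (suc d)) (length-zeroOnes n d) ⟩
    n * n ^ d + n ^ d                                     ≡⟨ +-comm (n * n ^ d) _ ⟩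
    suc n * n ^ d                                         ≤⟨ *-monoʳ-≤ (suc n) (^-monoˡ-≤ d (n≤1+n n)) ⟩
    suc n * suc n ^ d                                     ∎
    where open ≤-Reasoning

  -- The exponents of the monomial e after each variable x_v is replaced by the
  -- variable of its colour χ v, multiplied by the monomial u.
  recolour : ∀ {k n} → Vec ℕ k → Vec (Fin k) n → Vec ℕ n → Vec ℕ k
  recolour u []      []      = u
  recolour u (c ∷ χ) (x ∷ e) = recolour (updateAt u c (x +_)) χ e

  -- An indicator with values 0 and 1 in ℕ rather than a predicate, so that summing it counts.
  squarefree : ∀ {k} → Vec ℕ k → ℕ
  squarefree []                = 1
  squarefree (0 ∷ u)           = squarefree u
  squarefree (1 ∷ u)           = squarefree u
  squarefree (suc (suc _) ∷ u) = 0

  squarefree-01 : ∀ {k} (u : Vec ℕ k) → squarefree u ≡ 0 ⊎ squarefree u ≡ 1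
  squarefree-01 []                = inj₂ refl
  squarefree-01 (0 ∷ u)           = squarefree-01 u
  squarefree-01 (1 ∷ u)           = squarefree-01 u
  squarefree-01 (suc (suc _) ∷ u) = inj₁ refl

  ZeroOne⇒squarefree : ∀ {k d} {u : Vec ℕ k} → ZeroOne d u → squarefree u ≡ 1
  ZeroOne⇒squarefree []     = refl
  ZeroOne⇒squarefree (0∷ b) = ZeroOne⇒squarefree b
  ZeroOne⇒squarefree (1∷ b) = ZeroOne⇒squarefree b

  squarefree-updateAt : ∀ {k} (u : Vec ℕ k) c x → squarefree u ≡ 0 → squarefree (updateAt u c (x +_)) ≡ 0
  squarefree-updateAt (0 ∷ u)           zero    0             eq = eq
  squarefree-updateAt (0 ∷ u)           zero    1             eq = eq
  squarefree-updateAt (0 ∷ u)           zero    (suc (suc x)) eq = refl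
  squarefree-updateAt (1 ∷ u)           zero    0             eq = eq
  squarefree-updateAt (1 ∷ u)           zero    (suc x)       eq rewrite +-comm x 1 = refl
  squarefree-updateAt (suc (suc y) ∷ u) zero    0             eq = refl
  squarefree-updateAt (suc (suc y) ∷ u) zero    (suc x)       eq rewrite +-suc x (suc y) = refl
  squarefree-updateAt (0 ∷ u)           (suc c) x             eq = squarefree-updateAt u c x eq
  squarefree-updateAt (1 ∷ u)           (suc c) x             eq = squarefree-updateAt u c x eq
  squarefree-updateAt (suc (suc y) ∷ u) (suc c) x             eq = refl

  -- Exponents only grow during recolouring, so a colour used twice stays used twice.
  squarefree-recolour : ∀ {k n} u (χ : Vec (Fin k) n) e → squarefree u ≡ 0 → squarefree (recolour u χ e) ≡ 0
  squarefree-recolour u []      []      eq = eq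
  squarefree-recolour u (c ∷ χ) (x ∷ e) eq =
    squarefree-recolour (updateAt u c (x +_)) χ e (squarefree-updateAt u c x eq)

  -- Among the k choices for the next colour, the m used ones produce a square and contribute 0;
  -- each of the others contributes s. F is arbitrary so that the induction over coordinates can
  -- prefix an entry to its argument.
  ∑-unused-colours : ∀ {k m} {u : Vec ℕ k} (F : Vec ℕ k → ℕ) s →
    (∀ {u′} → ZeroOne (suc m) u′ → F u′ ≡ s) → (∀ {u′} → squarefree u′ ≡ 0 → F u′ ≡ 0) →
    ZeroOne m u → ∑ (allFin k) (λ c → F (updateAt u c suc)) ≡ (k ∸ m) * s
  ∑-unused-colours F s eq eq₀ [] = refl
  ∑-unused-colours {suc k} {m} {0 ∷ u} F s eq eq₀ (0∷ b) = begin
    ∑ (allFin (suc k)) (λ c → F (updateAt (0 ∷ u) c suc))           ≡⟨ ∑-allFin-suc k _ ⟩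
    F (1 ∷ u) + ∑ (allFin k) (λ c → F (0 ∷ updateAt u c suc))
      ≡⟨ cong₂ _+_ (eq (1∷ b)) (∑-unused-colours (F ∘ (0 ∷_)) s (λ b′ → eq (0∷ b′)) eq₀ b) ⟩
    suc (k ∸ m) * s                                                 ≡⟨ cong (_* s) (sym (+-∸-assoc 1 (ZeroOne⇒≤ b))) ⟩
    (suc k ∸ m) * s                                                 ∎
    where open ≡-Reasoning
  ∑-unused-colours {suc k} {suc m} {1 ∷ u} F s eq eq₀ (1∷ b) = begin
    ∑ (allFin (suc k)) (λ c → F (updateAt (1 ∷ u) c suc))           ≡⟨ ∑-allFin-suc k _ ⟩
    F (2 ∷ u) + ∑ (allFin k) (λ c → F (1 ∷ updateAt u c suc))
      ≡⟨ cong₂ _+_ (eq₀ {2 ∷ u} refl) (∑-unused-colours (F ∘ (1 ∷_)) s (λ b′ → eq (1∷ b′)) eq₀ b) ⟩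
    (k ∸ m) * s                                                     ∎
    where open ≡-Reasoning

  colourings : ∀ k n → List (Vec (Fin k) n)
  colourings k n = vectors (allFin k) n

  length-colourings : ∀ k n → length (colourings k n) ≡ k ^ n
  length-colourings k n = trans (length-vectors (allFin k) n) (cong (_^ n) (List.length-tabulate id))

  count-squarefree : ∀ {k n d m} {u : Vec ℕ k} {e : Vec ℕ n} → ZeroOne m u → ZeroOne d e →
    ∑ (colourings k n) (λ χ → squarefree (recolour u χ e)) * k ^ d ≡ falling (k ∸ m) d * k ^ n
  count-squarefree {u = u} bᵤ [] rewrite ZeroOne⇒squarefree bᵤ = refl
  count-squarefree {k} {suc n} {d} {m} {u} {0 ∷ e} bᵤ (0∷ b) = begin
    ∑ (colourings k (suc n)) (λ χ → squarefree (recolour u χ (0 ∷ e))) * k ^ d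
      ≡⟨ cong (_* k ^ d) (trans (∑-vectors (allFin k) n _) (∑-cong (allFin k) λ c →
           cong (λ u′ → ∑ (colourings k n) (λ χ → squarefree (recolour u′ χ e))) (Vec.updateAt-id c u))) ⟩
    ∑ (allFin k) (λ _ → S) * k ^ d
      ≡⟨ cong (_* k ^ d) (trans (∑-const (allFin k) S) (cong (_* S) (List.length-tabulate {n = k} id))) ⟩
    k * S * k ^ d                      ≡⟨ *-assoc k S (k ^ d) ⟩
    k * (S * k ^ d)                    ≡⟨ cong (k *_) (count-squarefree bᵤ b) ⟩
    k * (falling (k ∸ m) d * k ^ n)    ≡⟨ lem k (falling (k ∸ m) d) (k ^ n) ⟩
    falling (k ∸ m) d * (k * k ^ n)    ∎
    where
    open ≡-Reasoning
    S = ∑ (colourings k n) (λ χ → squarefree (recolour u χ e))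
    lem : ∀ a b c → a * (b * c) ≡ b * (a * c)
    lem = solve-∀
  count-squarefree {k} {suc n} {suc d} {m} {u} {1 ∷ e} bᵤ (1∷ b) = begin
    ∑ (colourings k (suc n)) (λ χ → squarefree (recolour u χ (1 ∷ e))) * (k * k ^ d)
      ≡⟨ cong (_* (k * k ^ d)) (∑-vectors (allFin k) n _) ⟩
    ∑ (allFin k) (λ c → F (updateAt u c suc)) * (k * k ^ d)
      ≡⟨ lem (∑ (allFin k) (λ c → F (updateAt u c suc))) k (k ^ d) ⟩
    k * (k ^ d * ∑ (allFin k) (λ c → F (updateAt u c suc)))
      ≡⟨ cong (k *_) (sym (∑-*ˡ (k ^ d) (allFin k) _)) ⟩
    k * ∑ (allFin k) (λ c → k ^ d * F (updateAt u c suc))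
      ≡⟨ cong (k *_) (∑-unused-colours (λ u′ → k ^ d * F u′) (falling (k ∸ suc m) d * k ^ n)
           (λ {u′} bᵤ′ → trans (*-comm (k ^ d) (F u′)) (count-squarefree bᵤ′ b))
           (λ {u′} eq → trans (cong (k ^ d *_) (F₀ eq)) (*-zeroʳ (k ^ d))) bᵤ) ⟩
    k * ((k ∸ m) * (falling (k ∸ suc m) d * k ^ n))
      ≡⟨ cong (λ j → k * ((k ∸ m) * (falling j d * k ^ n))) (sym (pred[m∸n]≡m∸[1+n] k m)) ⟩
    k * ((k ∸ m) * (falling (pred (k ∸ m)) d * k ^ n))
      ≡⟨ lem′ k (k ∸ m) (falling (pred (k ∸ m)) d) (k ^ n) ⟩
    (k ∸ m) * falling (pred (k ∸ m)) d * (k * k ^ n) ∎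
    where
    open ≡-Reasoning
    F : Vec ℕ k → ℕ
    F u′ = ∑ (colourings k n) (λ χ → squarefree (recolour u′ χ e))
    F₀ : ∀ {u′} → squarefree u′ ≡ 0 → F u′ ≡ 0
    F₀ {u′} eq = trans (∑-cong (colourings k n) λ χ → squarefree-recolour u′ χ e eq)
      (trans (∑-const (colourings k n) 0) (*-zeroʳ (length (colourings k n))))
    lem : ∀ a b c → a * (b * c) ≡ b * (c * a)
    lem = solve-∀
    lem′ : ∀ a b c e → a * (b * (c * e)) ≡ b * c * (a * e)
    lem′ = solve-∀

  -- Chernoff bounds by exponential weights

  2^y*s^sy≤[1+s]^sy : ∀ s y .{{_ : NonZero s}} → 2 ^ y * s ^ (s * y) ≤ (1 + s) ^ (s * y)
  2^y*s^sy≤[1+s]^sy s y = begin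
    2 ^ y * s ^ (s * y)      ≡⟨ cong (2 ^ y *_) (sym (^-*-assoc s s y)) ⟩
    2 ^ y * (s ^ s) ^ y      ≡⟨ sym (^-distribʳ-* 2 (s ^ s) y) ⟩
    (2 * s ^ s) ^ y          ≤⟨ ^-monoˡ-≤ y double ⟩
    ((1 + s) ^ s) ^ y        ≡⟨ ^-*-assoc (1 + s) s y ⟩
    (1 + s) ^ (s * y)        ∎
    where
    open ≤-Reasoning
    double : 2 * s ^ s ≤ (1 + s) ^ s
    double = *-cancelʳ-≤ _ _ s (begin
      2 * s ^ s * s      ≡⟨ lem (s ^ s) s ⟩
      s ^ s * (s + s)    ≤⟨ bernoulli⁺ s s ⟩
      (s + 1) ^ s * s    ≡⟨ cong (λ x → x ^ s * s) (+-comm s 1) ⟩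
      (1 + s) ^ s * s    ∎)
      where
      lem : ∀ p s → 2 * p * s ≡ p * (s + s)
      lem = solve-∀

  -- A block of s y factors 1 + 1/s is worth at least 2^y, so it pays for a union bound over Q
  -- events.
  Q*s^sy<[1+s]^sy : ∀ {Q} s y .{{_ : NonZero s}} → Q < 2 ^ y → Q * s ^ (s * y) < (1 + s) ^ (s * y)
  Q*s^sy<[1+s]^sy s y Q<2^y = <-≤-trans (*-monoˡ-< (s ^ (s * y)) {{m^n≢0 s (s * y)}} Q<2^y) (2^y*s^sy≤[1+s]^sy s y)

  -- In the application P/(s W) is the mean of 1 + f/s over the W colourings, f being the rainbow
  -- indicator, and it is at most 1 + 1/t. Its N-th power is at most (1 + 1/s)^((3+s)K), and the
  -- further s y in the threshold a supplies the factor Q.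
  upper-tail : ∀ {Q P} s t W K y .{{_ : NonZero s}} .{{_ : NonZero t}} .{{_ : NonZero W}} →
    s ≤ t → Q < 2 ^ y → P * t ≤ s * W * (1 + t) →
    let N = (2 + t) * K ; a = (3 + s) * K + s * y in
    Q * (s ^ a * P ^ N) < (1 + s) ^ a * (s * W) ^ N
  upper-tail {Q} {P} s t W K y s≤t Q<2^y Pt≤ = *-cancelʳ-< (t ^ N) _ _ (begin-strict
    Q * (s ^ a * P ^ N) * t ^ N                ≡⟨ lem₁ Q (s ^ a) (P ^ N) (t ^ N) ⟩
    Q * s ^ a * (P ^ N * t ^ N)                ≤⟨ *-monoʳ-≤ (Q * s ^ a) (*-^-mono {P} {t} {s * W} {1 + t} N Pt≤) ⟩
    Q * s ^ a * ((s * W) ^ N * (1 + t) ^ N)    ≡⟨ lem₂ Q (s ^ a) ((s * W) ^ N) ((1 + t) ^ N) ⟩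
    (s * W) ^ N * (Q * (s ^ a * (1 + t) ^ N))
      <⟨ *-monoʳ-< ((s * W) ^ N) {{m^n≢0 (s * W) N {{m*n≢0 s W}}}} core ⟩
    (s * W) ^ N * ((1 + s) ^ a * t ^ N)        ≡⟨ lem₃ ((s * W) ^ N) ((1 + s) ^ a) (t ^ N) ⟩
    (1 + s) ^ a * (s * W) ^ N * t ^ N          ∎)
    where
    open ≤-Reasoning
    N = (2 + t) * K
    a = (3 + s) * K + s * y
    lem₁ : ∀ a b c e → a * (b * c) * e ≡ a * b * (c * e)
    lem₁ = solve-∀
    lem₂ : ∀ a b c e → a * b * (c * e) ≡ c * (a * (b * e))
    lem₂ = solve-∀
    lem₃ : ∀ a b c → a * (b * c) ≡ b * a * c
    lem₃ = solve-∀
    lem₄ : ∀ a b c e → a * ((b * c) * e) ≡ (a * c) * (e * b)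
    lem₄ = solve-∀
    lem₅ : ∀ a b c → a * (b * c) ≡ (c * a) * b
    lem₅ = solve-∀
    lem₆ : ∀ u v x y → u * (u * x) * (v * (v * y)) ≡ (u * v) * (u * v) * (x * y)
    lem₆ = solve-∀
    [1+t]s≤ : (1 + t) * s ≤ t * (1 + s)
    [1+t]s≤ = subst ((1 + t) * s ≤_) (sym (*-suc t s)) (+-monoˡ-≤ (t * s) s≤t)
    -- `e-bounds` compares (1 + 1/t)^t with (1 + 1/s)^(1+s); the two extra factors on each side need
    -- s ≤ t. The exponent 2 + t is the one that the lower tail requires, so both tails share the
    -- same N.
    base : (1 + t) ^ (2 + t) * s ^ (3 + s) ≤ t ^ (2 + t) * (1 + s) ^ (3 + s)
    base = subst₂ _≤_ (sym (lem₆ (1 + t) s ((1 + t) ^ t) (s ^ (1 + s)))) (sym (lem₆ t (1 + s) (t ^ t) ((1 + s) ^ (1 + s))))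
      (*-mono-≤ (*-mono-≤ [1+t]s≤ [1+t]s≤) (e-bounds t s))
    baseᴷ : (1 + t) ^ N * s ^ ((3 + s) * K) ≤ t ^ N * (1 + s) ^ ((3 + s) * K)
    baseᴷ = subst₂ _≤_ (cong₂ _*_ (^-*-assoc (1 + t) (2 + t) K) (^-*-assoc s (3 + s) K))
      (cong₂ _*_ (^-*-assoc t (2 + t) K) (^-*-assoc (1 + s) (3 + s) K))
      (*-^-mono {(1 + t) ^ (2 + t)} {s ^ (3 + s)} {t ^ (2 + t)} {(1 + s) ^ (3 + s)} K base)
    core : Q * (s ^ a * (1 + t) ^ N) < (1 + s) ^ a * t ^ N
    core = begin-strict
      Q * (s ^ a * (1 + t) ^ N)
        ≡⟨ cong (λ x → Q * (x * (1 + t) ^ N)) (^-distribˡ-+-* s ((3 + s) * K) (s * y)) ⟩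
      Q * ((s ^ ((3 + s) * K) * s ^ (s * y)) * (1 + t) ^ N)
        ≡⟨ lem₄ Q (s ^ ((3 + s) * K)) (s ^ (s * y)) ((1 + t) ^ N) ⟩
      (Q * s ^ (s * y)) * ((1 + t) ^ N * s ^ ((3 + s) * K))   ≤⟨ *-monoʳ-≤ (Q * s ^ (s * y)) baseᴷ ⟩
      (Q * s ^ (s * y)) * (t ^ N * (1 + s) ^ ((3 + s) * K))
        <⟨ *-monoˡ-< (t ^ N * (1 + s) ^ ((3 + s) * K))
             {{m*n≢0 _ _ {{m^n≢0 t N}} {{m^n≢0 (1 + s) ((3 + s) * K)}}}} (Q*s^sy<[1+s]^sy s y Q<2^y) ⟩
      (1 + s) ^ (s * y) * (t ^ N * (1 + s) ^ ((3 + s) * K))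
        ≡⟨ lem₅ ((1 + s) ^ (s * y)) (t ^ N) ((1 + s) ^ ((3 + s) * K)) ⟩
      ((1 + s) ^ ((3 + s) * K) * (1 + s) ^ (s * y)) * t ^ N
        ≡⟨ cong (_* t ^ N) (sym (^-distribˡ-+-* (1 + s) ((3 + s) * K) (s * y))) ⟩
      (1 + s) ^ a * t ^ N ∎

  -- Now P/((1+s) W) stands for the mean of 1 - f/(1+s) and is at most 1 - 1/(2+t). Since (1 -
  -- 1/(2+t))^(2+t) ≤ (s/(1+s))^s, its N-th power is at most (s/(1+s))^(s(κ+y)); the threshold s κ
  -- leaves a block of s y factors to beat Q.
  lower-tail : ∀ {Q P} s t W κ y .{{_ : NonZero s}} .{{_ : NonZero W}} →
    Q < 2 ^ y → P * (2 + t) ≤ (1 + s) * W * (1 + t) →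
    let N = (2 + t) * (κ + y) ; a = s * κ in
    Q * ((1 + s) ^ a * P ^ N) < s ^ a * ((1 + s) * W) ^ N
  lower-tail {Q} {P} s t W κ y Q<2^y Pt≤ = *-cancelʳ-< ((2 + t) ^ N) _ _ (begin-strict
    Q * ((1 + s) ^ a * P ^ N) * (2 + t) ^ N             ≡⟨ lem₁ Q ((1 + s) ^ a) (P ^ N) ((2 + t) ^ N) ⟩
    Q * (1 + s) ^ a * (P ^ N * (2 + t) ^ N)
      ≤⟨ *-monoʳ-≤ (Q * (1 + s) ^ a) (*-^-mono {P} {2 + t} {(1 + s) * W} {1 + t} N Pt≤) ⟩
    Q * (1 + s) ^ a * (((1 + s) * W) ^ N * (1 + t) ^ N) ≡⟨ lem₂ Q ((1 + s) ^ a) (((1 + s) * W) ^ N) ((1 + t) ^ N) ⟩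
    ((1 + s) * W) ^ N * (Q * ((1 + s) ^ a * (1 + t) ^ N))
      <⟨ *-monoʳ-< (((1 + s) * W) ^ N) {{m^n≢0 ((1 + s) * W) N {{m*n≢0 (1 + s) W}}}} core ⟩
    ((1 + s) * W) ^ N * (s ^ a * (2 + t) ^ N)           ≡⟨ lem₃ (((1 + s) * W) ^ N) (s ^ a) ((2 + t) ^ N) ⟩
    s ^ a * ((1 + s) * W) ^ N * (2 + t) ^ N             ∎)
    where
    open ≤-Reasoning
    N = (2 + t) * (κ + y)
    a = s * κ
    lem₁ : ∀ a b c e → a * (b * c) * e ≡ a * b * (c * e)
    lem₁ = solve-∀
    lem₂ : ∀ a b c e → a * b * (c * e) ≡ c * (a * (b * e))
    lem₂ = solve-∀
    lem₃ : ∀ a b c → a * (b * c) ≡ b * a * c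
    lem₃ = solve-∀
    lem₄ : ∀ a b c e → a * (b * c) * e ≡ (a * e) * (b * c)
    lem₄ = solve-∀
    lem₅ : ∀ a b c → a * (b * c) ≡ (b * a) * c
    lem₅ = solve-∀
    lem₆ : ∀ a b c → (a * b) * c ≡ (a * c) * b
    lem₆ = solve-∀
    split : ∀ x → x ^ (s * (κ + y)) ≡ x ^ a * x ^ (s * y)
    split x = trans (cong (x ^_) (*-distribˡ-+ s κ y)) (^-distribˡ-+-* x a (s * y))
    base : (1 + s) ^ s * (1 + t) ^ (2 + t) ≤ s ^ s * (2 + t) ^ (2 + t)
    base = e-bounds s (1 + t)
    baseᴷ : (1 + s) ^ (s * (κ + y)) * (1 + t) ^ N ≤ s ^ (s * (κ + y)) * (2 + t) ^ N
    baseᴷ = subst₂ _≤_ (cong₂ _*_ (^-*-assoc (1 + s) s (κ + y)) (^-*-assoc (1 + t) (2 + t) (κ + y)))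
      (cong₂ _*_ (^-*-assoc s s (κ + y)) (^-*-assoc (2 + t) (2 + t) (κ + y)))
      (*-^-mono {(1 + s) ^ s} {(1 + t) ^ (2 + t)} {s ^ s} {(2 + t) ^ (2 + t)} (κ + y) base)
    core : Q * ((1 + s) ^ a * (1 + t) ^ N) < s ^ a * (2 + t) ^ N
    core = *-cancelʳ-< (s ^ (s * y)) _ _ (begin-strict
      Q * ((1 + s) ^ a * (1 + t) ^ N) * s ^ (s * y)     ≡⟨ lem₄ Q ((1 + s) ^ a) ((1 + t) ^ N) (s ^ (s * y)) ⟩
      (Q * s ^ (s * y)) * ((1 + s) ^ a * (1 + t) ^ N)
        <⟨ *-monoˡ-< ((1 + s) ^ a * (1 + t) ^ N)
             {{m*n≢0 _ _ {{m^n≢0 (1 + s) a}} {{m^n≢0 (1 + t) N}}}} (Q*s^sy<[1+s]^sy s y Q<2^y) ⟩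
      (1 + s) ^ (s * y) * ((1 + s) ^ a * (1 + t) ^ N)   ≡⟨ lem₅ ((1 + s) ^ (s * y)) ((1 + s) ^ a) ((1 + t) ^ N) ⟩
      ((1 + s) ^ a * (1 + s) ^ (s * y)) * (1 + t) ^ N   ≡⟨ cong (_* (1 + t) ^ N) (sym (split (1 + s))) ⟩
      (1 + s) ^ (s * (κ + y)) * (1 + t) ^ N             ≤⟨ baseᴷ ⟩
      s ^ (s * (κ + y)) * (2 + t) ^ N                   ≡⟨ cong (_* (2 + t) ^ N) (split s) ⟩
      (s ^ a * s ^ (s * y)) * (2 + t) ^ N               ≡⟨ lem₆ (s ^ a) (s ^ (s * y)) ((2 + t) ^ N) ⟩
      s ^ a * (2 + t) ^ N * s ^ (s * y)                 ∎)

  -- For f in {0, 1} the weight 1 + f/s equals (1 + 1/s)^f, so the product depends only on the sum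
  -- of f.
  ∏⁺ : ∀ s (xs : List X) f → (∀ x → f x ≡ 0 ⊎ f x ≡ 1) →
       ∏ xs (λ x → s + f x) * s ^ ∑ xs f ≡ (1 + s) ^ ∑ xs f * s ^ length xs
  ∏⁺ s []       f f01 = refl
  ∏⁺ s (x ∷ xs) f f01 with f x | f01 x
  ... | _ | inj₁ refl = begin
    (s + 0) * ∏ xs (λ x → s + f x) * s ^ ∑ xs f      ≡⟨ lem s _ (s ^ ∑ xs f) ⟩
    s * (∏ xs (λ x → s + f x) * s ^ ∑ xs f)          ≡⟨ cong (s *_) (∏⁺ s xs f f01) ⟩
    s * ((1 + s) ^ ∑ xs f * s ^ length xs)           ≡⟨ lem′ s ((1 + s) ^ ∑ xs f) _ ⟩
    (1 + s) ^ ∑ xs f * (s * s ^ length xs)           ∎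
    where
    open ≡-Reasoning
    lem : ∀ s p r → (s + 0) * p * r ≡ s * (p * r)
    lem = solve-∀
    lem′ : ∀ s p r → s * (p * r) ≡ p * (s * r)
    lem′ = solve-∀
  ... | _ | inj₂ refl = begin
    (s + 1) * ∏ xs (λ x → s + f x) * (s * s ^ ∑ xs f)   ≡⟨ lem s (∏ xs (λ x → s + f x)) (s ^ ∑ xs f) ⟩
    (1 + s) * s * (∏ xs (λ x → s + f x) * s ^ ∑ xs f)   ≡⟨ cong ((1 + s) * s *_) (∏⁺ s xs f f01) ⟩
    (1 + s) * s * ((1 + s) ^ ∑ xs f * s ^ length xs)    ≡⟨ lem′ s ((1 + s) ^ ∑ xs f) (s ^ length xs) ⟩
    (1 + s) * (1 + s) ^ ∑ xs f * (s * s ^ length xs)    ∎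
    where
    open ≡-Reasoning
    lem : ∀ s p r → (s + 1) * p * (s * r) ≡ (1 + s) * s * (p * r)
    lem = solve-∀
    lem′ : ∀ s p r → (1 + s) * s * (p * r) ≡ (1 + s) * p * (s * r)
    lem′ = solve-∀

  -- The decreasing weight 1 - f/(1+s) equals (s/(1+s))^f for f in {0, 1}.
  ∏⁻ : ∀ s (xs : List X) f → (∀ x → f x ≡ 0 ⊎ f x ≡ 1) →
       ∏ xs (λ x → s + (1 ∸ f x)) * (1 + s) ^ ∑ xs f ≡ s ^ ∑ xs f * (1 + s) ^ length xs
  ∏⁻ s []       f f01 = refl
  ∏⁻ s (x ∷ xs) f f01 with f x | f01 x
  ... | _ | inj₁ refl = begin
    (s + 1) * ∏ xs (λ x → s + (1 ∸ f x)) * (1 + s) ^ ∑ xs f     ≡⟨ lem s (∏ xs (λ x → s + (1 ∸ f x))) ((1 + s) ^ ∑ xs f) ⟩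
    (1 + s) * (∏ xs (λ x → s + (1 ∸ f x)) * (1 + s) ^ ∑ xs f)   ≡⟨ cong ((1 + s) *_) (∏⁻ s xs f f01) ⟩
    (1 + s) * (s ^ ∑ xs f * (1 + s) ^ length xs)                ≡⟨ lem′ s (s ^ ∑ xs f) ((1 + s) ^ length xs) ⟩
    s ^ ∑ xs f * ((1 + s) * (1 + s) ^ length xs)                ∎
    where
    open ≡-Reasoning
    lem : ∀ s p r → (s + 1) * p * r ≡ (1 + s) * (p * r)
    lem = solve-∀
    lem′ : ∀ s p r → (1 + s) * (p * r) ≡ p * ((1 + s) * r)
    lem′ = solve-∀
  ... | _ | inj₂ refl = begin
    (s + 0) * ∏ xs (λ x → s + (1 ∸ f x)) * ((1 + s) * (1 + s) ^ ∑ xs f)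
      ≡⟨ lem s (∏ xs (λ x → s + (1 ∸ f x))) ((1 + s) ^ ∑ xs f) ⟩
    s * (1 + s) * (∏ xs (λ x → s + (1 ∸ f x)) * (1 + s) ^ ∑ xs f)
      ≡⟨ cong (s * (1 + s) *_) (∏⁻ s xs f f01) ⟩
    s * (1 + s) * (s ^ ∑ xs f * (1 + s) ^ length xs)
      ≡⟨ lem′ s (s ^ ∑ xs f) ((1 + s) ^ length xs) ⟩
    s * s ^ ∑ xs f * ((1 + s) * (1 + s) ^ length xs)             ∎
    where
    open ≡-Reasoning
    lem : ∀ s p r → (s + 0) * p * ((1 + s) * r) ≡ s * (1 + s) * (p * r)
    lem = solve-∀
    lem′ : ∀ s p r → s * (1 + s) * (p * r) ≡ s * p * ((1 + s) * r)
    lem′ = solve-∀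

  -- Markov's inequality read for a single list: a sum reaching a would push the product of weights
  -- up to (1 + 1/s)^a times s^length.
  upper-Markov : ∀ s .{{_ : NonZero s}} (xs : List X) f → (∀ x → f x ≡ 0 ⊎ f x ≡ 1) → ∀ a →
    s ^ a * ∏ xs (λ x → s + f x) < (1 + s) ^ a * s ^ length xs → ∑ xs f < a
  upper-Markov s xs f f01 a lt = ≰⇒> λ a≤∑ → let l , a+l≡∑ = m≤n⇒∃[o]m+o≡n a≤∑ in
    <⇒≱ lt (*-cancelʳ-≤ _ _ (s ^ l) {{m^n≢0 s l}} (begin
    (1 + s) ^ a * s ^ length xs * s ^ l            ≡⟨ lem₁ ((1 + s) ^ a) (s ^ length xs) (s ^ l) ⟩
    (1 + s) ^ a * s ^ l * s ^ length xs
      ≤⟨ *-monoˡ-≤ (s ^ length xs) (*-monoʳ-≤ ((1 + s) ^ a) (^-monoˡ-≤ l (n≤1+n s))) ⟩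
    (1 + s) ^ a * (1 + s) ^ l * s ^ length xs
      ≡⟨ cong (_* s ^ length xs) (trans (sym (^-distribˡ-+-* (1 + s) a l)) (cong ((1 + s) ^_) a+l≡∑)) ⟩
    (1 + s) ^ ∑ xs f * s ^ length xs               ≡⟨ sym (∏⁺ s xs f f01) ⟩
    Π * s ^ ∑ xs f
      ≡⟨ cong (Π *_) (trans (cong (s ^_) (sym a+l≡∑)) (^-distribˡ-+-* s a l)) ⟩
    Π * (s ^ a * s ^ l)                            ≡⟨ lem₂ Π (s ^ a) (s ^ l) ⟩
    s ^ a * Π * s ^ l                              ∎))
    where
    open ≤-Reasoning
    Π = ∏ xs (λ x → s + f x)
    lem₁ : ∀ a b c → a * b * c ≡ a * c * b
    lem₁ = solve-∀
    lem₂ : ∀ a b c → a * (b * c) ≡ b * a * c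
    lem₂ = solve-∀

  lower-Markov : ∀ s (xs : List X) f → (∀ x → f x ≡ 0 ⊎ f x ≡ 1) → ∀ a →
    (1 + s) ^ a * ∏ xs (λ x → s + (1 ∸ f x)) < s ^ a * (1 + s) ^ length xs → a < ∑ xs f
  lower-Markov s xs f f01 a lt = ≰⇒> λ ∑≤a → let l , ∑+l≡a = m≤n⇒∃[o]m+o≡n ∑≤a in
    <⇒≱ lt (begin
    s ^ a * (1 + s) ^ length xs
      ≡⟨ cong (_* (1 + s) ^ length xs) (trans (cong (s ^_) (sym ∑+l≡a)) (^-distribˡ-+-* s (∑ xs f) l)) ⟩
    s ^ ∑ xs f * s ^ l * (1 + s) ^ length xs         ≡⟨ lem₁ (s ^ ∑ xs f) (s ^ l) ((1 + s) ^ length xs) ⟩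
    s ^ l * (s ^ ∑ xs f * (1 + s) ^ length xs)       ≤⟨ *-monoˡ-≤ _ (^-monoˡ-≤ l (n≤1+n s)) ⟩
    (1 + s) ^ l * (s ^ ∑ xs f * (1 + s) ^ length xs) ≡⟨ cong ((1 + s) ^ l *_) (sym (∏⁻ s xs f f01)) ⟩
    (1 + s) ^ l * (Π * (1 + s) ^ ∑ xs f)             ≡⟨ lem₂ ((1 + s) ^ l) Π ((1 + s) ^ ∑ xs f) ⟩
    (1 + s) ^ ∑ xs f * (1 + s) ^ l * Π
      ≡⟨ cong (_* Π) (trans (sym (^-distribˡ-+-* (1 + s) (∑ xs f) l)) (cong ((1 + s) ^_) ∑+l≡a)) ⟩
    (1 + s) ^ a * Π                                  ∎)
    where
    open ≤-Reasoning
    Π = ∏ xs (λ x → s + (1 ∸ f x))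
    lem₁ : ∀ a b c → a * b * c ≡ b * (a * c)
    lem₁ = solve-∀
    lem₂ : ∀ a b c → a * (b * c) ≡ c * a * b
    lem₂ = solve-∀

  -- The union bound: at most M terms, each below C/M. The condition 0 < C covers the empty list.
  ∑<-average : ∀ {C M} (xs : List X) f .{{_ : NonZero M}} → 0 < C → length xs ≤ M →
               All (λ x → M * f x < C) xs → ∑ xs f < C
  ∑<-average {C = suc C} {M} xs f 0<C len≤M h = s≤s (*-cancelˡ-≤ M (begin
    M * ∑ xs f       ≤⟨ go xs h ⟩
    length xs * C    ≤⟨ *-monoˡ-≤ C len≤M ⟩
    M * C            ∎))
    where
    open ≤-Reasoning
    go : ∀ xs → All (λ x → M * f x < suc C) xs → M * ∑ xs f ≤ length xs * C
    go []       []             = ≤-reflexive (*-zeroʳ M)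
    go (x ∷ xs) (s≤s hx ∷ hxs) = ≤-trans (≤-reflexive (*-distribˡ-+ M (f x) (∑ xs f))) (+-mono-≤ hx (go xs hxs))

  rainbow : ∀ {k n} → Vec ℕ n → Vec (Fin k) n → ℕ
  rainbow e χ = squarefree (recolour (replicate _ 0) χ e)

  -- The hypotheses place the rainbow probability falling k d / k^d between (1+s)/(1+t) and (1+s)/t.
  -- The potential `Φ` adds up the exponential weights of both tails over all d-sets; its average
  -- over all lists of N colourings is below thr₁ thr₂. A list with `Φ` below that value avoids both
  -- tails for every d-set, because each single term is below it too.
  concentration : ∀ {k n d M} s t κ y .{{_ : NonZero s}} .{{_ : NonZero k}} .{{_ : NonZero M}} →
    1 + s ≤ t → length (zeroOnes n d) ≤ M → 2 * M < 2 ^ y →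
    t * falling k d ≤ (1 + s) * k ^ d → (1 + s) * k ^ d < (1 + t) * falling k d →
    ∃ λ (ψ : List (Vec (Fin k) n)) → length ψ ≡ (2 + t) * (κ + y) ×
      (∀ {e} → ZeroOne d e → s * κ < ∑ ψ (rainbow e) × ∑ ψ (rainbow e) < (4 + s) * (κ + y) + (1 + s) * y)
  concentration {k} {n} {d} {M} s t κ y 1+s≤t zs≤M 2M<2^y tA≤SB SB<[1+t]A = toList ψ , length-ψ , good
    where
    instance
      t≢0 : NonZero t
      t≢0 = >-nonZero (≤-trans (s≤s z≤n) 1+s≤t)
    S = 1 + s
    xs = colourings k n
    W = length xs
    zs = zeroOnes n d
    N = (2 + t) * (κ + y)
    a₁ = (3 + S) * (κ + y) + S * y
    a₂ = s * κ
    thr₁ = (1 + S) ^ a₁ * S ^ N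
    thr₂ = s ^ a₂ * S ^ N
    cnt : Vec ℕ n → ℕ
    cnt e = ∑ xs (rainbow e)
    w⁺ w⁻ : Vec ℕ n → Vec (Fin k) n → ℕ
    w⁺ e χ = S + rainbow e χ
    w⁻ e χ = s + (1 ∸ rainbow e χ)
    instance
      W≢0 : NonZero W
      W≢0 = subst NonZero (sym (length-colourings k n)) (m^n≢0 k n)
      thr₁≢0 : NonZero thr₁
      thr₁≢0 = m*n≢0 ((1 + S) ^ a₁) (S ^ N) {{m^n≢0 (1 + S) a₁}} {{m^n≢0 S N}}
      thr₂≢0 : NonZero thr₂
      thr₂≢0 = m*n≢0 (s ^ a₂) (S ^ N) {{m^n≢0 s a₂}} {{m^n≢0 S N}}
    C = W ^ N * (thr₁ * thr₂)

    rainbow-01 : ∀ e χ → rainbow e χ ≡ 0 ⊎ rainbow e χ ≡ 1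
    rainbow-01 e χ = squarefree-01 (recolour (replicate k 0) χ e)

    module _ {e : Vec ℕ n} (b : ZeroOne d e) where
      open ≤-Reasoning

      cnt≡ : cnt e * k ^ d ≡ falling k d * W
      cnt≡ = trans (count-squarefree (ZeroOne-replicate k) b) (cong (falling k d *_) (sym (length-colourings k n)))

      cnt*t≤ : cnt e * t ≤ S * W
      cnt*t≤ = *-cancelʳ-≤ _ _ (k ^ d) {{m^n≢0 k d}} (begin
        cnt e * t * k ^ d        ≡⟨ lem₁ (cnt e) t (k ^ d) ⟩
        cnt e * k ^ d * t        ≡⟨ cong (_* t) cnt≡ ⟩
        falling k d * W * t      ≡⟨ lem₂ (falling k d) W t ⟩
        t * falling k d * W      ≤⟨ *-monoˡ-≤ W tA≤SB ⟩
        S * k ^ d * W            ≡⟨ lem₁ S (k ^ d) W ⟩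
        S * W * k ^ d            ∎)
        where
        lem₁ : ∀ a b c → a * b * c ≡ a * c * b
        lem₁ = solve-∀
        lem₂ : ∀ a b c → a * b * c ≡ c * a * b
        lem₂ = solve-∀

      S*W≤ : S * W ≤ cnt e * (1 + t)
      S*W≤ = *-cancelʳ-≤ _ _ (k ^ d) {{m^n≢0 k d}} (begin
        S * W * k ^ d                ≡⟨ lem₁ S W (k ^ d) ⟩
        S * k ^ d * W                ≤⟨ *-monoˡ-≤ W (<⇒≤ SB<[1+t]A) ⟩
        (1 + t) * falling k d * W    ≡⟨ lem₂ (1 + t) (falling k d) W ⟩
        falling k d * W * (1 + t)    ≡⟨ cong (_* (1 + t)) (sym cnt≡) ⟩
        cnt e * k ^ d * (1 + t)      ≡⟨ lem₁ (cnt e) (k ^ d) (1 + t) ⟩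
        cnt e * (1 + t) * k ^ d      ∎)
        where
        lem₁ : ∀ a b c → a * b * c ≡ a * c * b
        lem₁ = solve-∀
        lem₂ : ∀ a b c → a * b * c ≡ b * c * a
        lem₂ = solve-∀

      ∑w⁺ : ∑ xs (w⁺ e) * t ≤ S * W * (1 + t)
      ∑w⁺ = begin
        ∑ xs (w⁺ e) * t          ≡⟨ cong (_* t) (trans (∑-+ xs (λ _ → S) (rainbow e)) (cong (_+ cnt e) (∑-const xs S))) ⟩
        (W * S + cnt e) * t      ≡⟨ lem₁ W S (cnt e) t ⟩
        S * W * t + cnt e * t    ≤⟨ +-monoʳ-≤ (S * W * t) cnt*t≤ ⟩
        S * W * t + S * W        ≡⟨ lem₂ (S * W) t ⟩
        S * W * (1 + t)          ∎
        where
        lem₁ : ∀ a b c e → (a * b + c) * e ≡ b * a * e + c * e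
        lem₁ = solve-∀
        lem₂ : ∀ a b → a * b + a ≡ a * (1 + b)
        lem₂ = solve-∀

      ∑w⁻ : ∑ xs (w⁻ e) * (2 + t) ≤ S * W * (1 + t)
      ∑w⁻ = +-cancelʳ-≤ (cnt e * (1 + t)) _ _ (begin
        ∑ xs (w⁻ e) * (2 + t) + cnt e * (1 + t)      ≤⟨ +-monoʳ-≤ (∑ xs (w⁻ e) * (2 + t)) (*-monoʳ-≤ (cnt e) (n≤1+n (1 + t))) ⟩
        ∑ xs (w⁻ e) * (2 + t) + cnt e * (2 + t)      ≡⟨ sym (*-distribʳ-+ (2 + t) (∑ xs (w⁻ e)) (cnt e)) ⟩
        (∑ xs (w⁻ e) + cnt e) * (2 + t)
          ≡⟨ cong (_* (2 + t)) (trans (sym (∑-+ xs (w⁻ e) (rainbow e))) (trans (∑-cong xs pointwise) (∑-const xs S))) ⟩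
        W * S * (2 + t)                              ≡⟨ lem W S t ⟩
        S * W * (1 + t) + S * W                      ≤⟨ +-monoʳ-≤ (S * W * (1 + t)) S*W≤ ⟩
        S * W * (1 + t) + cnt e * (1 + t)            ∎)
        where
        lem : ∀ W S t → W * S * (2 + t) ≡ S * W * (1 + t) + S * W
        lem = solve-∀
        pointwise : ∀ χ → w⁻ e χ + rainbow e χ ≡ S
        pointwise χ with rainbow e χ | rainbow-01 e χ
        ... | _ | inj₁ refl = trans (+-identityʳ (s + 1)) (+-comm s 1)
        ... | _ | inj₂ refl = trans (cong (_+ 1) (+-identityʳ s)) (+-comm s 1)

      upper : 2 * M * (S ^ a₁ * ∑ xs (w⁺ e) ^ N) < thr₁ * W ^ N
      upper = <-≤-trans (upper-tail S t W (κ + y) y 1+s≤t 2M<2^y ∑w⁺)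
        (≤-reflexive (trans (cong ((1 + S) ^ a₁ *_) (^-distribʳ-* S W N)) (sym (*-assoc ((1 + S) ^ a₁) (S ^ N) (W ^ N)))))

      lower : 2 * M * (S ^ a₂ * ∑ xs (w⁻ e) ^ N) < thr₂ * W ^ N
      lower = <-≤-trans (lower-tail s t W κ y 2M<2^y ∑w⁻)
        (≤-reflexive (trans (cong (s ^ a₂ *_) (^-distribʳ-* S W N)) (sym (*-assoc (s ^ a₂) (S ^ N) (W ^ N)))))

      -- The 2 in 2 M is shared by the two tails, so that together they stay below the share 1/M of
      -- C.
      both : M * (thr₂ * (S ^ a₁ * ∑ xs (w⁺ e) ^ N) + thr₁ * (S ^ a₂ * ∑ xs (w⁻ e) ^ N)) < C
      both = *-cancelˡ-< 2 _ _ (begin-strict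
        2 * (M * (thr₂ * α + thr₁ * β))                     ≡⟨ lem₁ M thr₂ α thr₁ β ⟩
        thr₂ * (2 * M * α) + thr₁ * (2 * M * β)             <⟨ +-mono-< (*-monoʳ-< thr₂ upper) (*-monoʳ-< thr₁ lower) ⟩
        thr₂ * (thr₁ * W ^ N) + thr₁ * (thr₂ * W ^ N)       ≡⟨ lem₂ thr₂ thr₁ (W ^ N) ⟩
        2 * C                                               ∎)
        where
        α = S ^ a₁ * ∑ xs (w⁺ e) ^ N
        β = S ^ a₂ * ∑ xs (w⁻ e) ^ N
        lem₁ : ∀ M b α a β → 2 * (M * (b * α + a * β)) ≡ b * (2 * M * α) + a * (2 * M * β)
        lem₁ = solve-∀
        lem₂ : ∀ b a w → b * (a * w) + a * (b * w) ≡ 2 * (w * (a * b))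
        lem₂ = solve-∀

    -- Divided by thr₁ thr₂ this is the sum of the two products of weights, each relative to its
    -- value at its threshold; a sum below 1 excludes both tails for e.
    Φᵉ : Vec ℕ n → List (Vec (Fin k) n) → ℕ
    Φᵉ e ψ = thr₂ * (S ^ a₁ * ∏ ψ (w⁺ e)) + thr₁ * (S ^ a₂ * ∏ ψ (w⁻ e))

    Φ : Vec (Vec (Fin k) n) N → ℕ
    Φ ψ = ∑ zs (λ e → Φᵉ e (toList ψ))

    ∑Φᵉ : ∀ e → ∑ (vectors xs N) (Φᵉ e ∘ toList)
              ≡ thr₂ * (S ^ a₁ * ∑ xs (w⁺ e) ^ N) + thr₁ * (S ^ a₂ * ∑ xs (w⁻ e) ^ N)
    ∑Φᵉ e = trans (∑-+ (vectors xs N) _ _) (cong₂ _+_ (factor thr₂ (S ^ a₁) (w⁺ e)) (factor thr₁ (S ^ a₂) (w⁻ e)))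
      where
      factor : ∀ p q w → ∑ (vectors xs N) (λ ψ → p * (q * ∏ (toList ψ) w)) ≡ p * (q * ∑ xs w ^ N)
      factor p q w = trans (∑-*ˡ p (vectors xs N) _) (cong (p *_)
        (trans (∑-*ˡ q (vectors xs N) _) (cong (q *_) (∑-∏ xs w N))))

    ∑Φ< : ∑ (vectors xs N) Φ < length (vectors xs N) * (thr₁ * thr₂)
    ∑Φ< = begin-strict
      ∑ (vectors xs N) Φ        ≡⟨ ∑-swap (vectors xs N) zs (λ ψ e → Φᵉ e (toList ψ)) ⟩
      ∑ zs (λ e → ∑ (vectors xs N) (Φᵉ e ∘ toList))
        ≡⟨ ∑-cong zs ∑Φᵉ ⟩
      ∑ zs (λ e → thr₂ * (S ^ a₁ * ∑ xs (w⁺ e) ^ N) + thr₁ * (S ^ a₂ * ∑ xs (w⁻ e) ^ N))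
        <⟨ ∑<-average zs _ (>-nonZero⁻¹ C {{m*n≢0 _ _ {{m^n≢0 W N}} {{m*n≢0 thr₁ thr₂}}}}) zs≤M
             (All.map both (zeroOnes-sound n d)) ⟩
      C                         ≡⟨ cong (_* (thr₁ * thr₂)) (sym (length-vectors xs N)) ⟩
      length (vectors xs N) * (thr₁ * thr₂) ∎
      where open ≤-Reasoning

    found = ∑<⇒∃< (vectors xs N) Φ (thr₁ * thr₂) ∑Φ<
    ψ = proj₁ found

    length-ψ : length (toList ψ) ≡ N
    length-ψ = Vec.length-toList ψ

    good : ∀ {e} → ZeroOne d e →
      s * κ < ∑ (toList ψ) (rainbow e) × ∑ (toList ψ) (rainbow e) < (4 + s) * (κ + y) + (1 + s) * y
    good {e} b =
        lower-Markov s (toList ψ) (rainbow e) (rainbow-01 e) a₂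
          (*-cancelˡ-< thr₁ _ _ (<-≤-trans (≤-<-trans (m≤n+m _ _) Φᵉ<)
            (≤-reflexive (cong (thr₁ *_) (cong (λ l → s ^ a₂ * S ^ l) (sym length-ψ))))))
      , upper-Markov S (toList ψ) (rainbow e) (rainbow-01 e) a₁
          (*-cancelˡ-< thr₂ _ _ (<-≤-trans (≤-<-trans (m≤m+n _ _) Φᵉ<)
            (≤-reflexive (trans (*-comm thr₁ thr₂) (cong (thr₂ *_) (cong (λ l → (1 + S) ^ a₁ * S ^ l) (sym length-ψ)))))))
      where
      Φᵉ< : Φᵉ e (toList ψ) < thr₁ * thr₂
      Φᵉ< = ≤-<-trans (∈⇒≤∑ (λ e → Φᵉ e (toList ψ)) (zeroOnes-complete b)) (proj₂ found)

-- Choice of the parameters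

module BalancedColourings where

  open Estimates
  open Colourings
  open import Data.Fin.Base using (Fin)
  open import Data.List.Base using (List; length)
  open import Data.Nat.Base
  open import Data.Nat.DivMod using (_/_; m/n*n≤m; m%n<n; m≡m%n+[m/n]*n; m*n/n≡m; /-monoˡ-≤)
  open import Data.Nat.Properties
  open import Data.Nat.Tactic.RingSolver using (solve-∀)
  open import Data.Product.Base using (∃; _×_; _,_; proj₁; proj₂)
  open import Data.Vec.Base using (Vec)
  open import Relation.Binary.PropositionalEquality

  m<[1+m/n]*n : ∀ m n .{{_ : NonZero n}} → m < (1 + m / n) * n
  m<[1+m/n]*n m n = subst (_< (1 + m / n) * n) (sym (m≡m%n+[m/n]*n m n)) (+-monoˡ-< (m / n * n) (m%n<n m n))

  -- With s = 6 q and K = 2 q y the number of rainbow colourings of every d-set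
  -- is within a factor 1 ± 1/q of s K; below q = 1 + q′.
  balanced-colourings : ∀ n d q′ L .{{_ : NonZero n}} .{{_ : NonZero d}} .{{_ : NonZero L}} → n ≤ 2 ^ L →
    ∃ λ k → ∃ λ (ψ : List (Vec (Fin k) n)) → ∃ λ D → NonZero D ×
      (∀ {e} → ZeroOne d e → q′ * D ≤ (1 + q′) * ∑ ψ (rainbow e) × (1 + q′) * ∑ ψ (rainbow e) ≤ (2 + q′) * D) ×
      length ψ * (2 * binomials≤ k (d / 2)) * 1000 ^ d ≤ 32 * (1 + q′) * (1 + q′) * L * (G * 31) * 4075 ^ d
  balanced-colourings n d q′ L n≤2^L = k , ψ , D , D≢0 , (λ b → lower b , upper b) ,
    size-bound d v (d / 2) (length ψ * (2 * binomials≤ k (d / 2))) (32 * q * q * L)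
      k20≤31d 11d≤ 20m≤10d size
    where
    open ≤-Reasoning
    q = 1 + q′
    v = 11 * d / 20
    k = d + v
    A = falling k d
    B = k ^ d
    -- The offsets come from `concentration`, which works with 1 + s = 6 q and κ + y = 2 q y; D is
    -- the product of these two.
    s = 5 + 6 * q′
    -- Large enough for 2 n^d < 2^y: two tails for at most n^d sets, with n ≤ 2^L.
    y = d * L + 2
    κ = (1 + 2 * q′) * y
    D = 12 * (q * q * y)
    instance
      A≢0 : NonZero A
      A≢0 = >-nonZero (1≤falling v d)
      k≢0 : NonZero k
      k≢0 = >-nonZero (≤-trans (>-nonZero⁻¹ d) (m≤m+n d v))
      y≢0 : NonZero y
      y≢0 = >-nonZero (≤-trans (s≤s z≤n) (m≤n+m 2 (d * L)))
      D≢0 : NonZero D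
      D≢0 = m*n≢0 12 (q * q * y) {{>-nonZero (s≤s z≤n)}} {{m*n≢0 (q * q) y}}
    -- The integer part of (1 + s)/p for p = A/B. The list then has about D/p colourings, so a d-set
    -- is rainbow about D times on average.
    t = (1 + s) * B / A
    tA≤SB : t * A ≤ (1 + s) * B
    tA≤SB = m/n*n≤m ((1 + s) * B) A
    1+s≤t : 1 + s ≤ t
    1+s≤t = subst (_≤ t) (m*n/n≡m (1 + s) A) (/-monoˡ-≤ A (*-monoʳ-≤ (1 + s) (falling≤^ k d)))
    2M<2^y : 2 * n ^ d < 2 ^ y
    2M<2^y = begin-strict
      2 * n ^ d          ≤⟨ *-monoʳ-≤ 2 (^-monoˡ-≤ d n≤2^L) ⟩
      2 * (2 ^ L) ^ d    ≡⟨ cong (2 *_) (trans (^-*-assoc 2 L d) (cong (2 ^_) (*-comm L d))) ⟩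
      2 ^ (1 + d * L)    <⟨ ^-monoʳ-< 2 (s≤s (s≤s z≤n)) (≤-reflexive (+-comm 2 (d * L))) ⟩
      2 ^ y              ∎
    k20≤31d : k * 20 ≤ 31 * d
    k20≤31d = begin
      (d + v) * 20       ≡⟨ *-distribʳ-+ 20 d v ⟩
      d * 20 + v * 20    ≤⟨ +-monoʳ-≤ (d * 20) (m/n*n≤m (11 * d) 20) ⟩
      d * 20 + 11 * d    ≡⟨ lem d ⟩
      31 * d             ∎
      where
      lem : ∀ d → d * 20 + 11 * d ≡ 31 * d
      lem = solve-∀
    11d≤ : 11 * d ≤ v * 20 + 20
    11d≤ = ≤-trans (<⇒≤ (m<[1+m/n]*n (11 * d) 20)) (≤-reflexive (+-comm 20 (v * 20)))
    20m≤10d : d / 2 * 20 ≤ 10 * d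
    20m≤10d = begin
      d / 2 * 20         ≡⟨ lem (d / 2) ⟩
      10 * (d / 2 * 2)   ≤⟨ *-monoʳ-≤ 10 (m/n*n≤m d 2) ⟩
      10 * d             ∎
      where
      lem : ∀ m → m * 20 ≡ 10 * (m * 2)
      lem = solve-∀
    found = concentration {k} {n} {d} {n ^ d} s t κ y {{>-nonZero (s≤s z≤n)}} {{k≢0}} {{m^n≢0 n d}}
      1+s≤t (length-zeroOnes n d) 2M<2^y tA≤SB (m<[1+m/n]*n ((1 + s) * B) A)
    ψ = proj₁ found
    lower : ∀ {e} → ZeroOne d e → q′ * D ≤ q * ∑ ψ (rainbow e)
    lower {e} b = begin
      q′ * D                            ≤⟨ m≤m+n (q′ * D) (q * (5 + 4 * q′) * y) ⟩
      q′ * D + q * (5 + 4 * q′) * y     ≡⟨ lem q′ y ⟩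
      q * (s * κ)                       ≤⟨ *-monoʳ-≤ q (<⇒≤ (proj₁ (proj₂ (proj₂ found) b))) ⟩
      q * ∑ ψ (rainbow e)               ∎
      where
      lem : ∀ q′ y → q′ * (12 * ((1 + q′) * (1 + q′) * y)) + (1 + q′) * (5 + 4 * q′) * y
            ≡ (1 + q′) * ((5 + 6 * q′) * ((1 + 2 * q′) * y))
      lem = solve-∀
    -- The bound exceeds D by 3 (κ + y) + (1 + s) y = 6 q y + 6 q y, which is exactly D/q.
    upper : ∀ {e} → ZeroOne d e → q * ∑ ψ (rainbow e) ≤ (2 + q′) * D
    upper {e} b = begin
      q * ∑ ψ (rainbow e)                                ≤⟨ *-monoʳ-≤ q (<⇒≤ (proj₂ (proj₂ (proj₂ found) b))) ⟩
      q * ((4 + s) * (κ + y) + (1 + s) * y)              ≡⟨ lem q′ y ⟩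
      (2 + q′) * D                                       ∎
      where
      lem : ∀ q′ y → (1 + q′) * ((4 + (5 + 6 * q′)) * ((1 + 2 * q′) * y + y) + (1 + (5 + 6 * q′)) * y)
            ≡ (2 + q′) * (12 * ((1 + q′) * (1 + q′) * y))
      lem = solve-∀
    size : length ψ * (2 * binomials≤ k (d / 2)) * A ≤ 32 * q * q * L * (2 + d) * binomials≤ k (d / 2) * B
    size = begin
      length ψ * (2 * Bn) * A                  ≡⟨ cong (λ l → l * (2 * Bn) * A) (proj₁ (proj₂ found)) ⟩
      (2 + t) * (κ + y) * (2 * Bn) * A         ≡⟨ lem₁ t (κ + y) Bn A ⟩
      (t * A + 2 * A) * (2 * (κ + y) * Bn)     ≤⟨ *-monoˡ-≤ _ (+-mono-≤ tA≤SB (*-monoʳ-≤ 2 (falling≤^ k d))) ⟩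
      ((1 + s) * B + 2 * B) * (2 * (κ + y) * Bn)
        -- The added 2 q′ B rounds 6 q + 2 up to 8 q; times 2 · 2 q y this gives 32 q² y.
        ≤⟨ *-monoˡ-≤ _ (m≤m+n ((1 + s) * B + 2 * B) (2 * q′ * B)) ⟩
      ((1 + s) * B + 2 * B + 2 * q′ * B) * (2 * (κ + y) * Bn) ≡⟨ lem₂ q′ y Bn B ⟩
      32 * q * q * y * (Bn * B)                ≤⟨ *-monoˡ-≤ (Bn * B) (*-monoʳ-≤ (32 * q * q) y≤) ⟩
      32 * q * q * (L * (2 + d)) * (Bn * B)    ≡⟨ lem₃ (32 * q * q) L (2 + d) Bn B ⟩
      32 * q * q * L * (2 + d) * Bn * B        ∎
      where
      Bn = binomials≤ k (d / 2)
      lem₁ : ∀ t K b a → (2 + t) * K * (2 * b) * a ≡ (t * a + 2 * a) * (2 * K * b)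
      lem₁ = solve-∀
      lem₂ : ∀ q′ y b B → ((1 + (5 + 6 * q′)) * B + 2 * B + 2 * q′ * B) * (2 * ((1 + 2 * q′) * y + y) * b)
             ≡ 32 * (1 + q′) * (1 + q′) * y * (b * B)
      lem₂ = solve-∀
      lem₃ : ∀ a L e b B → a * (L * e) * (b * B) ≡ a * L * e * b * B
      lem₃ = solve-∀
      y≤ : y ≤ L * (2 + d)
      y≤ = begin
        d * L + 2        ≤⟨ +-monoʳ-≤ (d * L) (m≤n*m 2 L) ⟩
        d * L + L * 2    ≡⟨ lem d L ⟩
        L * (2 + d)      ∎
        where
        lem : ∀ d L → d * L + L * 2 ≡ L * (2 + d)
        lem = solve-∀

-- Multilinear monomials and multinomial coefficients

module Polynomials where

  open import Defs using (module Polynomial; var; _·_; deg; 𝟏; IsMultilinear)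
  open Colourings using (recolour; ZeroOne; []; 0∷_; 1∷_; zeroOnes)
  open import Algebra.Bundles using (CommutativeSemiring)
  open import Algebra.Bundles.Raw using (RawSemiring)
  import Algebra.Definitions.RawSemiring as RawSemiringDefs
  import Algebra.Properties.CommutativeSemiring.Exp as CExp
  import Algebra.Properties.Semiring.Mult as Mult
  import Algebra.Properties.Semiring.Sum as Sum
  open import Data.Bool.Base using (if_then_else_; true; false)
  open import Data.Fin.Base as Fin using (Fin; zero; suc)
  import Data.Fin.Properties as Fin
  open import Data.List.Base as List using (List; []; _∷_; _++_)
  open import Data.List.Membership.Propositional using (_∈_; _∉_)
  open import Data.List.Membership.Propositional.Properties using (∈-map⁻)
  open import Data.List.Relation.Unary.Any using (here; there)
  open import Data.List.Relation.Unary.All as All using ([]; _∷_)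
  open import Data.List.Relation.Unary.AllPairs using ([]; _∷_)
  open import Data.List.Relation.Unary.Unique.Propositional using (Unique)
  import Data.List.Relation.Unary.Unique.Propositional.Properties as Unique
  open import Data.Nat.Base as ℕ using (ℕ; zero; suc; pred; _!)
  import Data.Nat.Properties as ℕ
  open import Data.Product.Base using (_×_; _,_)
  open import Data.Vec.Base as Vec using (Vec; []; _∷_; lookup; updateAt; tabulate; zipWith)
  import Data.Vec.Properties as Vec
  open import Data.Vec.Functional as Vector using (Vector)
  open import Function.Base using (_∘_; id)
  open import Function.Bundles using (_⇔_; mk⇔)
  open import Relation.Binary.PropositionalEquality as ≡ using (_≡_; _≢_; refl; cong; cong₂; subst)
  open import Relation.Nullary using (¬_; does; yes; no; contradiction)
  open import Relation.Nullary.Decidable using (does-⇔; dec-true; dec-false)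

  private
    variable
      n d m : ℕ

  zipWith-zeros : ∀ {f : Fin n → ℕ} → (∀ i → f i ≡ 0) → ∀ e → zipWith ℕ._+_ (tabulate f) e ≡ e
  zipWith-zeros f≡0 []      = refl
  zipWith-zeros f≡0 (x ∷ e) = cong₂ _∷_ (cong (ℕ._+ x) (f≡0 zero)) (zipWith-zeros (f≡0 ∘ suc) e)

  var-· : ∀ (i : Fin n) e → var i · e ≡ updateAt e i suc
  var-· zero    (x ∷ e) = cong (suc x ∷_) (zipWith-zeros (λ _ → refl) e)
  var-· (suc i) (x ∷ e) = cong (x ∷_) (var-· i e)

  updateAt-suc⇔pred : ∀ {x} (e e′ : Vec ℕ n) i → lookup e i ≡ suc x → updateAt e′ i suc ≡ e ⇔ e′ ≡ updateAt e i pred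
  updateAt-suc⇔pred e e′ i eq = mk⇔ (to e e′ i) (from e e′ i eq)
    where
    to : ∀ {n} (e e′ : Vec ℕ n) i → updateAt e′ i suc ≡ e → e′ ≡ updateAt e i pred
    to _ (x ∷ e′) zero    refl = refl
    to (y ∷ e) (x ∷ e′) (suc i) eq = cong₂ _∷_ (Vec.∷-injectiveˡ eq) (to e e′ i (Vec.∷-injectiveʳ eq))
    from : ∀ {n x} (e e′ : Vec ℕ n) i → lookup e i ≡ suc x → e′ ≡ updateAt e i pred → updateAt e′ i suc ≡ e
    from (suc x ∷ e) _ zero    eq refl = refl
    from (y ∷ e)     (_ ∷ e′) (suc i) eq eq′ = cong₂ _∷_ (Vec.∷-injectiveˡ eq′) (from e e′ i eq (Vec.∷-injectiveʳ eq′))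

  updateAt-suc≢ : ∀ (e e′ : Vec ℕ n) i → lookup e i ≡ 0 → updateAt e′ i suc ≢ e
  updateAt-suc≢ (_ ∷ e) (x ∷ e′) zero    refl ()
  updateAt-suc≢ (_ ∷ e) (x ∷ e′) (suc i) eq   eq′ = updateAt-suc≢ e e′ i eq (Vec.∷-injectiveʳ eq′)

  deg-pred : ∀ {x} (e : Vec ℕ n) i → lookup e i ≡ suc x → suc (deg (updateAt e i pred)) ≡ deg e
  deg-pred (suc x ∷ e) zero    eq = refl
  deg-pred (x ∷ e)     (suc i) eq = ≡.trans (≡.sym (ℕ.+-suc x _)) (cong (x ℕ.+_) (deg-pred e i eq))

  -- Division by x_i, where the result is `z` if x_i does not divide e.
  divideBy : ∀ {a} {A : Set a} → A → (Vec ℕ n → A) → Vec ℕ n → Fin n → A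
  divideBy z f e i with lookup e i
  ... | zero  = z
  ... | suc _ = f (updateAt e i pred)

  -- The number d!/(e₁! ⋯ eₙ!) if e has degree d, and 0 otherwise, through the Pascal recursion that
  -- expanding ℓ · ℓ^d produces; no division is involved.
  multinomial : ℕ → Vec ℕ n → ℕ
  multinomial zero    e = if does (Vec.≡-dec ℕ._≟_ 𝟏 e) then 1 else 0
  multinomial (suc d) e = Vector.foldr ℕ._+_ 0 (divideBy 0 (multinomial d) e)

  ∑≡0 : ∀ {f : Fin n → ℕ} → (∀ i → f i ≡ 0) → Vector.foldr ℕ._+_ 0 f ≡ 0
  ∑≡0 {zero}  eq = refl
  ∑≡0 {suc n} eq = cong₂ ℕ._+_ (eq zero) (∑≡0 (eq ∘ suc))

  deg-𝟏 : ∀ n → deg (𝟏 {n}) ≡ 0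
  deg-𝟏 zero    = refl
  deg-𝟏 (suc n) = deg-𝟏 n

  multinomial≡0 : ∀ d (e : Vec ℕ n) → deg e ≢ d → multinomial d e ≡ 0
  multinomial≡0 {n} zero    e deg≢ with Vec.≡-dec ℕ._≟_ 𝟏 e
  ... | yes refl = contradiction (deg-𝟏 n) deg≢
  ... | no  _    = refl
  multinomial≡0 (suc d) e deg≢ = ∑≡0 go
    where
    go : ∀ i → divideBy 0 (multinomial d) e i ≡ 0
    go i with lookup e i in eq
    ... | zero  = refl
    ... | suc x = multinomial≡0 d (updateAt e i pred) λ deg≡ →
      deg≢ (≡.trans (≡.sym (deg-pred e i eq)) (cong suc deg≡))

  ∑-cong : ∀ {f g : Fin n → ℕ} → (∀ i → f i ≡ g i) → Vector.foldr ℕ._+_ 0 f ≡ Vector.foldr ℕ._+_ 0 g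
  ∑-cong {zero}  eq = refl
  ∑-cong {suc n} eq = cong₂ ℕ._+_ (eq zero) (∑-cong (eq ∘ suc))

  divideBy-suc : ∀ {a} {A : Set a} {z : A} F x (e : Vec ℕ n) i →
                 divideBy z F (x ∷ e) (suc i) ≡ divideBy z (F ∘ (x ∷_)) e i
  divideBy-suc F x e i with lookup e i
  ... | zero  = refl
  ... | suc _ = refl

  -- Only the m entries equal to 1 can be lowered, and each of them leaves a vector with m - 1 ones.
  ∑-divideBy : ∀ {e : Vec ℕ n} (F : Vec ℕ n → ℕ) s → (∀ {m′ e′} → suc m′ ≡ m → ZeroOne m′ e′ → F e′ ≡ s) →
               ZeroOne m e → Vector.foldr ℕ._+_ 0 (divideBy 0 F e) ≡ m ℕ.* s
  ∑-divideBy F s eq []             = refl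
  ∑-divideBy F s eq (0∷_ {e = e} b) =
    ≡.trans (∑-cong (divideBy-suc F 0 e)) (∑-divideBy (F ∘ (0 ∷_)) s (λ m≡ b′ → eq m≡ (0∷ b′)) b)
  ∑-divideBy F s eq (1∷_ {e = e} b) = cong₂ ℕ._+_ (eq refl (0∷ b))
    (≡.trans (∑-cong (divideBy-suc F 1 e)) (∑-divideBy (F ∘ (1 ∷_)) s (λ m≡ b′ → eq (cong suc m≡) (1∷ b′)) b))

  ZeroOne₀⇒𝟏 : ∀ {e : Vec ℕ n} → ZeroOne 0 e → 𝟏 ≡ e
  ZeroOne₀⇒𝟏 []     = refl
  ZeroOne₀⇒𝟏 (0∷ b) = cong (0 ∷_) (ZeroOne₀⇒𝟏 b)

  multinomial≡! : ∀ {e : Vec ℕ n} → ZeroOne d e → multinomial d e ≡ d !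
  multinomial≡! {d = zero} {e} b =
    cong (if_then 1 else 0) (dec-true (Vec.≡-dec ℕ._≟_ 𝟏 e) (ZeroOne₀⇒𝟏 b))
  multinomial≡! {d = suc d} b = ∑-divideBy (multinomial d) (d !) (λ where refl b′ → multinomial≡! {d = d} b′) b

  ZeroOne⇒deg : ∀ {e : Vec ℕ n} → ZeroOne d e → deg e ≡ d
  ZeroOne⇒deg []     = refl
  ZeroOne⇒deg (0∷ b) = ZeroOne⇒deg b
  ZeroOne⇒deg (1∷ b) = cong suc (ZeroOne⇒deg b)

  ZeroOne-updateAt : ∀ {e : Vec ℕ n} i → ZeroOne m e → lookup e i ≡ 0 → ZeroOne (suc m) (updateAt e i suc)
  ZeroOne-updateAt zero    (0∷ b) eq = 1∷ b
  ZeroOne-updateAt (suc i) (0∷ b) eq = 0∷ ZeroOne-updateAt i b eq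
  ZeroOne-updateAt (suc i) (1∷ b) eq = 1∷ ZeroOne-updateAt i b eq

  ZeroOne-𝟏 : ∀ n → ZeroOne 0 (𝟏 {n})
  ZeroOne-𝟏 zero    = []
  ZeroOne-𝟏 (suc n) = 0∷ ZeroOne-𝟏 n

  lookup-∏var : ∀ d (i : Fin d → Fin n) c → (∀ j → c ≢ i j) → lookup (Vector.foldr _·_ 𝟏 (var ∘ i)) c ≡ 0
  lookup-∏var zero    i c c≢ = Vec.lookup-replicate c 0
  lookup-∏var (suc d) i c c≢ =
    ≡.trans (cong (λ e → lookup e c) (var-· (i zero) (Vector.foldr _·_ 𝟏 (var ∘ i ∘ suc))))
      (≡.trans (Vec.lookup∘updateAt′ c (i zero) (c≢ zero) (Vector.foldr _·_ 𝟏 (var ∘ i ∘ suc))) (lookup-∏var d (i ∘ suc) c (c≢ ∘ suc)))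

  -- As the indices increase, the first one is absent from the product of the others, so its entry
  -- is still 0 when it is raised.
  ZeroOne-∏var : ∀ d (i : Fin d → Fin n) → (∀ {j k} → j Fin.< k → i j Fin.< i k) → ZeroOne d (Vector.foldr _·_ 𝟏 (var ∘ i))
  ZeroOne-∏var zero    i inc = ZeroOne-𝟏 _
  ZeroOne-∏var (suc d) i inc = subst (ZeroOne (suc d)) (≡.sym (var-· (i zero) (Vector.foldr _·_ 𝟏 (var ∘ i ∘ suc))))
    (ZeroOne-updateAt (i zero) (ZeroOne-∏var d (i ∘ suc) (inc ∘ ℕ.s≤s))
      (lookup-∏var d (i ∘ suc) (i zero) λ j → Fin.<⇒≢ (inc {zero} {suc j} (ℕ.s≤s ℕ.z≤n))))

  ∏var-suc : ∀ d (i : Fin d → Fin n) → Vector.foldr _·_ 𝟏 (var ∘ suc ∘ i) ≡ 0 ∷ Vector.foldr _·_ 𝟏 (var ∘ i)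
  ∏var-suc zero    i = refl
  ∏var-suc (suc d) i = cong (var (suc (i zero)) ·_) (∏var-suc d (i ∘ suc))

  ZeroOne⇒IsMultilinear : ∀ {e : Vec ℕ n} → ZeroOne d e → IsMultilinear d e
  ZeroOne⇒IsMultilinear []     = (λ ()) , (λ {}) , refl
  ZeroOne⇒IsMultilinear (0∷ b) with ZeroOne⇒IsMultilinear b
  ... | i , inc , refl = suc ∘ i , ℕ.s≤s ∘ inc , ≡.sym (∏var-suc _ i)
  ZeroOne⇒IsMultilinear (1∷ b) with ZeroOne⇒IsMultilinear b
  ... | i , inc , refl = i⁺ , inc⁺ , ≡.sym (≡.trans (cong (var zero ·_) (∏var-suc _ i)) (var-· zero (0 ∷ _)))
    where
    i⁺ : Fin (suc _) → Fin (suc _)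
    i⁺ zero    = zero
    i⁺ (suc j) = suc (i j)
    inc⁺ : ∀ {j k} → j Fin.< k → i⁺ j Fin.< i⁺ k
    inc⁺ {zero}  {suc k} _           = ℕ.s≤s ℕ.z≤n
    inc⁺ {suc j} {suc k} (ℕ.s≤s j<k) = ℕ.s≤s (inc j<k)

  IsMultilinear⇔ZeroOne : ∀ {e : Vec ℕ n} → IsMultilinear d e ⇔ ZeroOne d e
  IsMultilinear⇔ZeroOne = mk⇔ (λ where (i , inc , refl) → ZeroOne-∏var _ i inc) ZeroOne⇒IsMultilinear

  -- `coeff` adds up repeated occurrences of a monomial, so prescribing coefficients along a list of
  -- monomials requires that none occurs twice.
  zeroOnes-unique : ∀ n (d : ℕ) → Unique (zeroOnes n d)
  zeroOnes-unique zero    zero    = [] ∷ []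
  zeroOnes-unique zero    (suc d) = []
  zeroOnes-unique (suc n) zero    = Unique.map⁺ Vec.∷-injectiveʳ (zeroOnes-unique n zero)
  zeroOnes-unique (suc n) (suc d) = Unique.++⁺ (Unique.map⁺ Vec.∷-injectiveʳ (zeroOnes-unique n (suc d)))
    (Unique.map⁺ Vec.∷-injectiveʳ (zeroOnes-unique n d)) disjoint
    where
    disjoint : ∀ {e} → ¬ (e ∈ List.map (0 ∷_) (zeroOnes n (suc d)) × e ∈ List.map (1 ∷_) (zeroOnes n d))
    disjoint (p , q) with ∈-map⁻ (0 ∷_) p | ∈-map⁻ (1 ∷_) q
    ... | _ , _ , refl | _ , _ , ()

  -- Coefficients of powers of linear forms

  module Coefficients {c ℓ} (R : CommutativeSemiring c ℓ) where

    open CommutativeSemiring R hiding (zero) renaming (refl to ≈-refl)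
    open Polynomial rawSemiring using (Poly; coeff; LinearForm; toPoly) renaming (rawSemiring to polySemiring)
    open RawSemiringDefs rawSemiring using (_^_)
    open Mult semiring using (×-congʳ; ×-cong; ×-comm-*; ×-homo-+) renaming (_×_ to _×ᴿ_)
    open CExp R using (^-homo-*; ^-distrib-*)
    open import Algebra.Properties.CommutativeSemigroup *-commutativeSemigroup using (interchange)
    open Sum semiring using (sum; sum-cong-≋)
    open import Relation.Binary.Reasoning.Setoid setoid

    coeff-++ : ∀ (p q : Poly n) e → coeff (p ++ q) e ≈ coeff p e + coeff q e
    coeff-++ []            q e = sym (+-identityˡ _)
    coeff-++ ((a , m) ∷ p) q e with does (Vec.≡-dec ℕ._≟_ m e)
    ... | true  = trans (+-congˡ (coeff-++ p q e)) (sym (+-assoc a _ _))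
    ... | false = coeff-++ p q e

    coeff-terms-∉ : ∀ (a : Vec ℕ n → Carrier) es e → e ∉ es → coeff (List.map (λ e → a e , e) es) e ≈ 0#
    coeff-terms-∉ a []        e e∉ = ≈-refl
    coeff-terms-∉ a (e′ ∷ es) e e∉ with Vec.≡-dec ℕ._≟_ e′ e
    ... | yes e′≡e = contradiction (here (≡.sym e′≡e)) e∉
    ... | no  _    = coeff-terms-∉ a es e (e∉ ∘ there)

    coeff-terms-∈ : ∀ (a : Vec ℕ n → Carrier) {es e} → Unique es → e ∈ es → coeff (List.map (λ e → a e , e) es) e ≈ a e
    coeff-terms-∈ a {e′ ∷ es} {e} (e′∉ ∷ u) e∈ with Vec.≡-dec ℕ._≟_ e′ e
    ... | yes refl = trans (+-congˡ (coeff-terms-∉ a es e λ e∈es → All.lookup e′∉ e∈es refl)) (+-identityʳ _)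
    coeff-terms-∈ a (_ ∷ u) (here e≡)  | no e′≢e = contradiction (≡.sym e≡) e′≢e
    coeff-terms-∈ a (_ ∷ u) (there e∈) | no _    = coeff-terms-∈ a u e∈

    eval : Vector Carrier n → Vec ℕ n → Carrier
    eval ℓ []      = 1#
    eval ℓ (x ∷ e) = ℓ zero ^ x * eval (ℓ ∘ suc) e

    eval-divideBy : ∀ (ℓ : Vector Carrier n) {x} e i → lookup e i ≡ suc x → ℓ i * eval ℓ (updateAt e i pred) ≈ eval ℓ e
    eval-divideBy ℓ (suc x ∷ e) zero    _  = sym (*-assoc (ℓ zero) _ _)
    eval-divideBy ℓ (y ∷ e)     (suc i) eq = begin
      ℓ (suc i) * (ℓ zero ^ y * eval (ℓ ∘ suc) (updateAt e i pred))   ≈⟨ sym (*-assoc _ _ _) ⟩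
      ℓ (suc i) * ℓ zero ^ y * eval (ℓ ∘ suc) (updateAt e i pred)     ≈⟨ *-congʳ (*-comm _ _) ⟩
      ℓ zero ^ y * ℓ (suc i) * eval (ℓ ∘ suc) (updateAt e i pred)     ≈⟨ *-assoc _ _ _ ⟩
      ℓ zero ^ y * (ℓ (suc i) * eval (ℓ ∘ suc) (updateAt e i pred))   ≈⟨ *-congˡ (eval-divideBy (ℓ ∘ suc) e i eq) ⟩
      ℓ zero ^ y * eval (ℓ ∘ suc) e                                   ∎

    eval-𝟏 : ∀ (ℓ : Vector Carrier n) → eval ℓ 𝟏 ≈ 1#
    eval-𝟏 {zero}  ℓ = ≈-refl
    eval-𝟏 {suc n} ℓ = trans (*-identityˡ _) (eval-𝟏 (ℓ ∘ suc))

    eval-scale : ∀ ρ (ℓ : Vector Carrier n) e → eval (λ i → ρ * ℓ i) e ≈ ρ ^ deg e * eval ℓ e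
    eval-scale ρ ℓ []      = sym (*-identityˡ 1#)
    eval-scale ρ ℓ (x ∷ e) = begin
      (ρ * ℓ zero) ^ x * eval (λ i → ρ * ℓ (suc i)) e             ≈⟨ *-cong (^-distrib-* ρ (ℓ zero) x) (eval-scale ρ (ℓ ∘ suc) e) ⟩
      (ρ ^ x * ℓ zero ^ x) * (ρ ^ deg e * eval (ℓ ∘ suc) e)       ≈⟨ interchange _ _ _ _ ⟩
      (ρ ^ x * ρ ^ deg e) * (ℓ zero ^ x * eval (ℓ ∘ suc) e)       ≈⟨ *-congʳ (sym (^-homo-* ρ x (deg e))) ⟩
      ρ ^ (x ℕ.+ deg e) * (ℓ zero ^ x * eval (ℓ ∘ suc) e)         ∎

    eval-updateAt : ∀ (ℓ : Vector Carrier n) u c x → eval ℓ (updateAt u c (x ℕ.+_)) ≈ ℓ c ^ x * eval ℓ u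
    eval-updateAt ℓ (y ∷ u) zero    x = trans (*-congʳ (^-homo-* (ℓ zero) x y)) (*-assoc _ _ _)
    eval-updateAt ℓ (y ∷ u) (suc c) x = begin
      ℓ zero ^ y * eval (ℓ ∘ suc) (updateAt u c (x ℕ.+_))        ≈⟨ *-congˡ (eval-updateAt (ℓ ∘ suc) u c x) ⟩
      ℓ zero ^ y * (ℓ (suc c) ^ x * eval (ℓ ∘ suc) u)            ≈⟨ sym (*-assoc _ _ _) ⟩
      (ℓ zero ^ y * ℓ (suc c) ^ x) * eval (ℓ ∘ suc) u            ≈⟨ *-congʳ (*-comm _ _) ⟩
      (ℓ (suc c) ^ x * ℓ zero ^ y) * eval (ℓ ∘ suc) u            ≈⟨ *-assoc _ _ _ ⟩
      ℓ (suc c) ^ x * (ℓ zero ^ y * eval (ℓ ∘ suc) u)            ∎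

    -- Substituting colours for variables is dual to composing the form with χ. This carries sign
    -- identities in k colours over to forms in n variables.
    eval-recolour : ∀ {k} (ℓ : Vector Carrier k) u (χ : Vec (Fin k) n) e →
                    eval ℓ (recolour u χ e) ≈ eval (ℓ ∘ lookup χ) e * eval ℓ u
    eval-recolour ℓ u []      []      = sym (*-identityˡ _)
    eval-recolour ℓ u (c ∷ χ) (x ∷ e) = begin
      eval ℓ (recolour (updateAt u c (x ℕ.+_)) χ e)                  ≈⟨ eval-recolour ℓ _ χ e ⟩
      eval (ℓ ∘ lookup χ) e * eval ℓ (updateAt u c (x ℕ.+_))         ≈⟨ *-congˡ (eval-updateAt ℓ u c x) ⟩
      eval (ℓ ∘ lookup χ) e * (ℓ c ^ x * eval ℓ u)                   ≈⟨ sym (*-assoc _ _ _) ⟩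
      (eval (ℓ ∘ lookup χ) e * ℓ c ^ x) * eval ℓ u                   ≈⟨ *-congʳ (*-comm _ _) ⟩
      (ℓ c ^ x * eval (ℓ ∘ lookup χ) e) * eval ℓ u                   ∎

    -- f is the multiplication by a single term a x_i. It is described by an equation because the
    -- product of polynomials is built from an anonymous pattern lambda.
    coeff-var-* : ∀ (f : Carrier × Vec ℕ n → Carrier × Vec ℕ n) {a i} → (∀ b m → f (b , m) ≡ (a * b , var i · m)) →
      ∀ q e → coeff (List.map f q) e ≈ divideBy 0# (λ e′ → a * coeff q e′) e i
    coeff-var-* f {a} {i} f≡ q e with lookup e i in eq
    ... | zero  = go q
      where
      go : ∀ q → coeff (List.map f q) e ≈ 0#
      go []            = ≈-refl
      go ((b , m) ∷ q) rewrite f≡ b m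
        | dec-false (Vec.≡-dec ℕ._≟_ (var i · m) e) (λ eq′ → updateAt-suc≢ e m i eq (≡.trans (≡.sym (var-· i m)) eq′)) = go q
    ... | suc x = go q
      where
      go : ∀ q → coeff (List.map f q) e ≈ a * coeff q (updateAt e i pred)
      go []            = sym (zeroʳ a)
      go ((b , m) ∷ q) rewrite f≡ b m | var-· i m
        | does-⇔ (updateAt-suc⇔pred e m i eq) (Vec.≡-dec ℕ._≟_ (updateAt m i suc) e) (Vec.≡-dec ℕ._≟_ m (updateAt e i pred))
        with does (Vec.≡-dec ℕ._≟_ m (updateAt e i pred))
      ... | true  = trans (+-congˡ (go q)) (sym (distribˡ a b _))
      ... | false = go q

    infixl 7 _*ᴾ_
    _*ᴾ_ : Poly n → Poly n → Poly n
    _*ᴾ_ {n} = RawSemiring._*_ (polySemiring n)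

    coeff-linear-* : ∀ (a : Fin m → Carrier) (g : Fin m → Fin n) q e →
      coeff (List.tabulate (λ i → a i , var (g i)) *ᴾ q) e ≈ sum (λ i → divideBy 0# (λ e′ → a i * coeff q e′) e (g i))
    coeff-linear-* {zero}  a g q e = ≈-refl
    coeff-linear-* {suc m} a g q e = trans
      (coeff-++ (List.map _ q) (List.tabulate (λ i → a (suc i) , var (g (suc i))) *ᴾ q) e)
      (+-cong (coeff-var-* _ (λ _ _ → refl) q e) (coeff-linear-* (a ∘ suc) (g ∘ suc) q e))

    ∑-× : ∀ (f : Fin m → ℕ) x → sum (λ i → f i ×ᴿ x) ≈ Vector.foldr ℕ._+_ 0 f ×ᴿ x
    ∑-× {zero}  f x = ≈-refl
    ∑-× {suc m} f x = trans (+-congˡ (∑-× (f ∘ suc) x)) (sym (×-homo-+ x (f zero) _))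

    open module PolyPower {n} = RawSemiringDefs (polySemiring n) using () renaming (_^_ to _^ᴾ_) public

    -- The multinomial theorem, by induction on d: the first factor contributes some x_i that
    -- divides e, and the remaining factors contribute e/x_i.
    coeff-^ : ∀ (ℓ : LinearForm n) d e → coeff (toPoly ℓ ^ᴾ d) e ≈ multinomial d e ×ᴿ eval ℓ e
    coeff-^ {n} ℓ zero e with Vec.≡-dec ℕ._≟_ 𝟏 e
    ... | yes refl = +-congʳ (sym (eval-𝟏 ℓ))
    ... | no  _    = ≈-refl
    coeff-^ {n} ℓ (suc d) e = begin
      coeff (toPoly ℓ *ᴾ (toPoly ℓ ^ᴾ d)) e
        ≈⟨ coeff-linear-* ℓ id (toPoly ℓ ^ᴾ d) e ⟩
      sum (λ i → divideBy 0# (λ e′ → ℓ i * coeff (toPoly ℓ ^ᴾ d) e′) e i)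
        ≈⟨ sum-cong-≋ term ⟩
      sum (λ i → divideBy 0 (multinomial d) e i ×ᴿ eval ℓ e)
        ≈⟨ ∑-× (divideBy 0 (multinomial d) e) (eval ℓ e) ⟩
      multinomial (suc d) e ×ᴿ eval ℓ e ∎
      where
      term : ∀ i → divideBy 0# (λ e′ → ℓ i * coeff (toPoly ℓ ^ᴾ d) e′) e i ≈ divideBy 0 (multinomial d) e i ×ᴿ eval ℓ e
      term i with lookup e i in eq
      ... | zero  = ≈-refl
      ... | suc _ = begin
        ℓ i * coeff (toPoly ℓ ^ᴾ d) e′             ≈⟨ *-congˡ (coeff-^ ℓ d e′) ⟩
        ℓ i * (multinomial d e′ ×ᴿ eval ℓ e′)      ≈⟨ ×-comm-* (multinomial d e′) (ℓ i) (eval ℓ e′) ⟩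
        multinomial d e′ ×ᴿ (ℓ i * eval ℓ e′)      ≈⟨ ×-congʳ (multinomial d e′) (eval-divideBy ℓ e i eq) ⟩
        multinomial d e′ ×ᴿ eval ℓ e               ∎
        where e′ = updateAt e i pred

  module Powers {c ℓ} (R : CommutativeSemiring c ℓ) where
    open CommutativeSemiring R hiding (zero; refl)
    open CExp R using (_^_; ^-distrib-*)

    power-suc : ∀ {r x y} d → y ≈ r * x → x ≈ r ^ d → y ≈ r ^ suc d
    power-suc d y≈ x≈ = trans y≈ (*-congˡ x≈)

    -- The identity (r z)^d + (r z̄)^d = r^d (z^d + z̄^d). For conjugate z and z̄ the bracket is 2
    -- Re(z^d), which can be negative for even d as well. The trailing 0# closes a list sum.
    two-powers : ∀ {r z z̄ zᵈ z̄ᵈ t s w} d → t ≈ r ^ d → zᵈ ≈ z ^ d → z̄ᵈ ≈ z̄ ^ d → zᵈ + z̄ᵈ ≈ s → w ≈ t * s →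
      (r * z) ^ d + ((r * z̄) ^ d + 0#) ≈ w
    two-powers {r} {z} {z̄} {zᵈ} {z̄ᵈ} {t} {s} {w} d r^d z^d z̄^d sum≈ w≈ = begin
      (r * z) ^ d + ((r * z̄) ^ d + 0#)    ≈⟨ +-congˡ (+-identityʳ _) ⟩
      (r * z) ^ d + (r * z̄) ^ d           ≈⟨ +-cong (^-distrib-* r z d) (^-distrib-* r z̄ d) ⟩
      r ^ d * z ^ d + r ^ d * z̄ ^ d       ≈⟨ sym (distribˡ _ _ _) ⟩
      r ^ d * (z ^ d + z̄ ^ d)             ≈⟨ *-cong (sym r^d) (trans (+-cong (sym z^d) (sym z̄^d)) sum≈) ⟩
      t * s                               ≈⟨ sym w≈ ⟩
      w                                   ∎
      where open import Relation.Binary.Reasoning.Setoid setoid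

    one-power : ∀ {r t} d → t ≈ r ^ d → r ^ d + 0# ≈ t
    one-power d r^d = trans (+-identityʳ _) (sym r^d)

-- Naturals and integers inside the rationals

module Rationals where

  open import Data.Integer.Base as ℤ using (ℤ; +_)
  import Data.Integer.Properties as ℤ
  open import Data.Nat.Base as ℕ using (ℕ; zero; suc)
  import Data.Nat.Properties as ℕ
  open import Data.Product.Base using (∃; _×_; _,_)
  open import Data.Rational.Base as ℚ using (ℚ; 0ℚ; 1ℚ)
  import Data.Rational.Properties as ℚ
  import Data.Rational.Unnormalised.Base as ℚᵘ
  import Data.Rational.Unnormalised.Properties as ℚᵘ
  open import Relation.Binary.PropositionalEquality
  open import Relation.Nullary using (¬_; yes; no; contradiction)
  open import Relation.Unary using (Decidable)

  ⟦_⟧ᶻ : ℤ → ℚ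
  ⟦ i ⟧ᶻ = i ℚ./ 1

  ⟦_⟧ : ℕ → ℚ
  ⟦ n ⟧ = ⟦ + n ⟧ᶻ

  private
    toℚᵘ-⟦⟧ᶻ : ∀ i → ℚ.toℚᵘ ⟦ i ⟧ᶻ ℚᵘ.≃ ℚᵘ.mkℚᵘ i 0
    toℚᵘ-⟦⟧ᶻ i = ℚ.toℚᵘ-fromℚᵘ (ℚᵘ.mkℚᵘ i 0)

  ⟦⟧ᶻ-+ : ∀ i j → ⟦ i ℤ.+ j ⟧ᶻ ≡ ⟦ i ⟧ᶻ ℚ.+ ⟦ j ⟧ᶻ
  ⟦⟧ᶻ-+ i j = ℚ.toℚᵘ-injective (begin
    ℚ.toℚᵘ ⟦ i ℤ.+ j ⟧ᶻ                       ≈⟨ toℚᵘ-⟦⟧ᶻ (i ℤ.+ j) ⟩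
    ℚᵘ.mkℚᵘ (i ℤ.+ j) 0
      ≈⟨ ℚᵘ.*≡* (cong (ℤ._* + 1) (cong₂ ℤ._+_ (sym (ℤ.*-identityʳ i)) (sym (ℤ.*-identityʳ j)))) ⟩
    ℚᵘ.mkℚᵘ i 0 ℚᵘ.+ ℚᵘ.mkℚᵘ j 0              ≈⟨ ℚᵘ.≃-sym (ℚᵘ.+-cong (toℚᵘ-⟦⟧ᶻ i) (toℚᵘ-⟦⟧ᶻ j)) ⟩
    ℚ.toℚᵘ ⟦ i ⟧ᶻ ℚᵘ.+ ℚ.toℚᵘ ⟦ j ⟧ᶻ          ≈⟨ ℚᵘ.≃-sym (ℚ.toℚᵘ-homo-+ ⟦ i ⟧ᶻ ⟦ j ⟧ᶻ) ⟩
    ℚ.toℚᵘ (⟦ i ⟧ᶻ ℚ.+ ⟦ j ⟧ᶻ)                ∎)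
    where open ℚᵘ.≃-Reasoning

  ⟦⟧ᶻ-* : ∀ i j → ⟦ i ℤ.* j ⟧ᶻ ≡ ⟦ i ⟧ᶻ ℚ.* ⟦ j ⟧ᶻ
  ⟦⟧ᶻ-* i j = ℚ.toℚᵘ-injective (begin
    ℚ.toℚᵘ ⟦ i ℤ.* j ⟧ᶻ                       ≈⟨ toℚᵘ-⟦⟧ᶻ (i ℤ.* j) ⟩
    ℚᵘ.mkℚᵘ i 0 ℚᵘ.* ℚᵘ.mkℚᵘ j 0              ≈⟨ ℚᵘ.≃-sym (ℚᵘ.*-cong (toℚᵘ-⟦⟧ᶻ i) (toℚᵘ-⟦⟧ᶻ j)) ⟩
    ℚ.toℚᵘ ⟦ i ⟧ᶻ ℚᵘ.* ℚ.toℚᵘ ⟦ j ⟧ᶻ          ≈⟨ ℚᵘ.≃-sym (ℚ.toℚᵘ-homo-* ⟦ i ⟧ᶻ ⟦ j ⟧ᶻ) ⟩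
    ℚ.toℚᵘ (⟦ i ⟧ᶻ ℚ.* ⟦ j ⟧ᶻ)                ∎)
    where open ℚᵘ.≃-Reasoning

  ⟦⟧ᶻ-neg : ∀ i → ⟦ ℤ.- i ⟧ᶻ ≡ ℚ.- ⟦ i ⟧ᶻ
  ⟦⟧ᶻ-neg i = ℚ.toℚᵘ-injective (begin
    ℚ.toℚᵘ ⟦ ℤ.- i ⟧ᶻ        ≈⟨ toℚᵘ-⟦⟧ᶻ (ℤ.- i) ⟩
    ℚᵘ.- (ℚᵘ.mkℚᵘ i 0)       ≈⟨ ℚᵘ.≃-sym (ℚᵘ.-‿cong (toℚᵘ-⟦⟧ᶻ i)) ⟩
    ℚᵘ.- (ℚ.toℚᵘ ⟦ i ⟧ᶻ)     ≈⟨ ℚᵘ.≃-sym (ℚ.toℚᵘ-homo‿- ⟦ i ⟧ᶻ) ⟩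
    ℚ.toℚᵘ (ℚ.- ⟦ i ⟧ᶻ)      ∎)
    where open ℚᵘ.≃-Reasoning

  ⟦⟧ᶻ-mono-< : ∀ {i j} → i ℤ.< j → ⟦ i ⟧ᶻ ℚ.< ⟦ j ⟧ᶻ
  ⟦⟧ᶻ-mono-< {i} {j} i<j = ℚ.toℚᵘ-cancel-< (ℚᵘ.<-respʳ-≃ (ℚᵘ.≃-sym (toℚᵘ-⟦⟧ᶻ j)) (ℚᵘ.<-respˡ-≃ (ℚᵘ.≃-sym (toℚᵘ-⟦⟧ᶻ i))
    (ℚᵘ.*<* (ℤ.*-monoʳ-<-pos (+ 1) i<j))))

  ⟦⟧-+ : ∀ m n → ⟦ m ℕ.+ n ⟧ ≡ ⟦ m ⟧ ℚ.+ ⟦ n ⟧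
  ⟦⟧-+ m n = ⟦⟧ᶻ-+ (+ m) (+ n)

  ⟦⟧-* : ∀ m n → ⟦ m ℕ.* n ⟧ ≡ ⟦ m ⟧ ℚ.* ⟦ n ⟧
  ⟦⟧-* m n = trans (cong ⟦_⟧ᶻ (ℤ.pos-* m n)) (⟦⟧ᶻ-* (+ m) (+ n))

  ⟦⟧-mono-≤ : ∀ {m n} → m ℕ.≤ n → ⟦ m ⟧ ℚ.≤ ⟦ n ⟧
  ⟦⟧-mono-≤ {m} {n} m≤n = ℚ.toℚᵘ-cancel-≤ (ℚᵘ.≤-respʳ-≃ (ℚᵘ.≃-sym (toℚᵘ-⟦⟧ᶻ (+ n))) (ℚᵘ.≤-respˡ-≃ (ℚᵘ.≃-sym (toℚᵘ-⟦⟧ᶻ (+ m)))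
    (ℚᵘ.*≤* (ℤ.*-monoʳ-≤-nonNeg (+ 1) (ℤ.+≤+ m≤n)))))

  ⟦⟧-mono-< : ∀ {m n} → m ℕ.< n → ⟦ m ⟧ ℚ.< ⟦ n ⟧
  ⟦⟧-mono-< m<n = ⟦⟧ᶻ-mono-< (ℤ.+<+ m<n)

  0≤⟦⟧ : ∀ n → 0ℚ ℚ.≤ ⟦ n ⟧
  0≤⟦⟧ n = ⟦⟧-mono-≤ {0} {n} ℕ.z≤n

  0<⟦suc⟧ : ∀ n → 0ℚ ℚ.< ⟦ suc n ⟧
  0<⟦suc⟧ n = ⟦⟧-mono-< {0} {suc n} (ℕ.s≤s ℕ.z≤n)

  pos-* : ∀ {p q} → 0ℚ ℚ.< p → 0ℚ ℚ.< q → 0ℚ ℚ.< p ℚ.* q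
  pos-* {p} {q} 0<p 0<q = ℚ.positive⁻¹ (p ℚ.* q) {{ℚ.pos*pos⇒pos p {{ℚ.positive 0<p}} q {{ℚ.positive 0<q}}}}

  nonNeg-* : ∀ {p q} → 0ℚ ℚ.≤ p → 0ℚ ℚ.≤ q → 0ℚ ℚ.≤ p ℚ.* q
  nonNeg-* {p} {q} 0≤p 0≤q = ℚ.nonNegative⁻¹ (p ℚ.* q) {{ℚ.nonNeg*nonNeg⇒nonNeg p {{ℚ.nonNegative 0≤p}} q {{ℚ.nonNegative 0≤q}}}}

  inv : ∀ p → 0ℚ ℚ.< p → ℚ
  inv p 0<p = ℚ.1/_ p {{ℚ.>-nonZero 0<p}}

  inv-pos : ∀ p (0<p : 0ℚ ℚ.< p) → 0ℚ ℚ.< inv p 0<p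
  inv-pos p 0<p = ℚ.positive⁻¹ (inv p 0<p) {{ℚ.1/pos⇒pos p {{ℚ.positive 0<p}}}}

  *-inv : ∀ p (0<p : 0ℚ ℚ.< p) → p ℚ.* inv p 0<p ≡ 1ℚ
  *-inv p 0<p = ℚ.*-inverseʳ p {{ℚ.>-nonZero 0<p}}

  *-mono-≤ : ∀ {p q r s} → 0ℚ ℚ.≤ p → 0ℚ ℚ.≤ r → p ℚ.≤ q → r ℚ.≤ s → p ℚ.* r ℚ.≤ q ℚ.* s
  *-mono-≤ {p} {q} {r} {s} 0≤p 0≤r p≤q r≤s = ℚ.≤-trans
    (ℚ.*-monoʳ-≤-nonNeg r {{ℚ.nonNegative 0≤r}} p≤q)
    (ℚ.*-monoˡ-≤-nonNeg q {{ℚ.nonNegative (ℚ.≤-trans 0≤p p≤q)}} r≤s)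

  upperBound : ∀ p → ∃ λ n → p ℚ.< ⟦ n ⟧
  upperBound p@(ℚ.mkℚ i d _) = suc ℤ.∣ i ∣ , ℚ.toℚᵘ-cancel-< (ℚᵘ.<-respʳ-≃ (ℚᵘ.≃-sym (toℚᵘ-⟦⟧ᶻ (+ suc ℤ.∣ i ∣)))
    (ℚᵘ.*<* (ℤ.≤-<-trans (ℤ.≤-reflexive (ℤ.*-identityʳ i)) (bound i))))
    where
    bound : ∀ i → i ℤ.< + suc ℤ.∣ i ∣ ℤ.* + suc d
    bound (+ n)       = subst (+ n ℤ.<_) (ℤ.pos-* (suc n) (suc d)) (ℤ.+<+ (ℕ.≤-trans (ℕ.n<1+n n) (ℕ.m≤m*n (suc n) (suc d))))
    bound (ℤ.-[1+ n ]) = subst (ℤ.-[1+ n ] ℤ.<_) (ℤ.pos-* (suc (suc n)) (suc d)) ℤ.-<+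

  -- An integer floor: descending from a B at which P fails, the search stops at the first a where P
  -- holds. It supplies the integer parts needed for roots, 1/ε and log₂ n.
  search : ∀ {ℓ} {P : ℕ → Set ℓ} → Decidable P → P 0 → ∀ B → ¬ P B → ∃ λ a → P a × ¬ P (suc a)
  search P? P0 zero    ¬PB = contradiction P0 ¬PB
  search P? P0 (suc B) ¬PB with P? B
  ... | yes PB  = B , PB , ¬PB
  ... | no  ¬PB′ = search P? P0 B ¬PB′

  1/suc : ℕ → ℚ
  1/suc m = inv ⟦ suc m ⟧ (0<⟦suc⟧ m)

  0<1/suc : ∀ m → 0ℚ ℚ.< 1/suc m
  0<1/suc m = inv-pos ⟦ suc m ⟧ (0<⟦suc⟧ m)

  1/suc-small : ∀ δ → 0ℚ ℚ.< δ → ∃ λ N → ∀ m → N ℕ.≤ m → 1/suc m ℚ.< δ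
  1/suc-small δ 0<δ with upperBound (inv δ 0<δ)
  ... | N , δ⁻¹<N = N , λ m N≤m → ℚ.*-cancelʳ-<-nonNeg ⟦ suc m ⟧ {{ℚ.nonNegative (0≤⟦⟧ (suc m))}} (begin-strict
    1/suc m ℚ.* ⟦ suc m ⟧       ≡⟨ trans (ℚ.*-comm (1/suc m) ⟦ suc m ⟧) (*-inv ⟦ suc m ⟧ (0<⟦suc⟧ m)) ⟩
    1ℚ                      ≡⟨ sym (*-inv δ 0<δ) ⟩
    δ ℚ.* inv δ 0<δ         <⟨ ℚ.*-monoʳ-<-pos δ {{ℚ.positive 0<δ}} δ⁻¹<N ⟩
    δ ℚ.* ⟦ N ⟧             ≤⟨ ℚ.*-monoˡ-≤-nonNeg δ {{ℚ.nonNegative (ℚ.<⇒≤ 0<δ)}} (⟦⟧-mono-≤ (ℕ.m≤n⇒m≤1+n N≤m)) ⟩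
    δ ℚ.* ⟦ suc m ⟧         ∎)
    where open ℚ.≤-Reasoning

  ⟦⟧≤/ : ∀ l a j → l ℕ.* suc j ℕ.≤ a → ⟦ l ⟧ ℚ.≤ (+ a) ℚ./ suc j
  ⟦⟧≤/ l a j le = ℚ.toℚᵘ-cancel-≤ (ℚᵘ.≤-respʳ-≃ (ℚᵘ.≃-sym (ℚ.toℚᵘ-fromℚᵘ (ℚᵘ.mkℚᵘ (+ a) j)))
    (ℚᵘ.≤-respˡ-≃ (ℚᵘ.≃-sym (toℚᵘ-⟦⟧ᶻ (+ l)))
      (ℚᵘ.*≤* (subst₂ ℤ._≤_ (ℤ.pos-* l (suc j)) (sym (ℤ.*-identityʳ (+ a))) (ℤ.+≤+ le)))))

-- Sign characters and the elementary symmetric polynomial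

module Characters where

  open Estimates using (binomials≤)
  open Colourings using (squarefree; squarefree-01)
  open Rationals
  open Polynomials using (module Coefficients)
  import Algebra.Definitions.RawSemiring as RawSemiringDefs
  open import Algebra.Bundles using (CommutativeRing; CommutativeSemiring)
  open import Data.Bool.Base using (Bool; true; false; not)
  open import Data.Bool.Properties using (not-involutive)
  open import Data.Fin.Base using (Fin; zero; suc)
  open import Data.List.Base as List using (List; []; _∷_; _++_; map; length)
  import Data.List.Properties as List
  open import Data.Nat.Base as ℕ using (ℕ; zero; suc; s≤s; z≤n)
  import Data.Nat.Properties as ℕ
  open import Data.Nat.DivMod using (_/_; m*n/n≡m; /-monoˡ-≤)
  open import Data.Nat.Tactic.RingSolver using (solve-∀)
  open import Data.Rational.Base hiding (_/_; NonZero)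
  open import Data.Rational.Properties
  open import Data.Rational.Solver using (module +-*-Solver)
  open import Data.Sum.Base using (_⊎_; inj₁; inj₂)
  open import Data.Vec.Base as Vec using (Vec; []; _∷_; lookup; updateAt)
  open import Function.Base using (_∘_)
  open import Relation.Binary.PropositionalEquality
  open import Relation.Nullary using (yes; no)

  ℚ-commutativeSemiring : CommutativeSemiring _ _
  ℚ-commutativeSemiring = CommutativeRing.commutativeSemiring +-*-commutativeRing

  open Coefficients ℚ-commutativeSemiring using (eval)
  open RawSemiringDefs (CommutativeSemiring.rawSemiring ℚ-commutativeSemiring) using (_^_)

  ∑ᴮ : ∀ k → (Vec Bool k → ℚ) → ℚ
  ∑ᴮ zero    f = f []
  ∑ᴮ (suc k) f = ∑ᴮ k (f ∘ (false ∷_)) + ∑ᴮ k (f ∘ (true ∷_))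

  ∑ᶠ : ∀ k → (Fin k → ℚ) → ℚ
  ∑ᶠ zero    f = 0ℚ
  ∑ᶠ (suc k) f = f zero + ∑ᶠ k (f ∘ suc)

  sumℚ : ∀ {ℓ} {A : Set ℓ} → List A → (A → ℚ) → ℚ
  sumℚ []       f = 0ℚ
  sumℚ (x ∷ xs) f = f x + sumℚ xs f

  sumℚ-++ : ∀ {ℓ} {A : Set ℓ} (xs ys : List A) f → sumℚ (xs ++ ys) f ≡ sumℚ xs f + sumℚ ys f
  sumℚ-++ []       ys f = sym (+-identityˡ _)
  sumℚ-++ (x ∷ xs) ys f = trans (cong (f x +_) (sumℚ-++ xs ys f)) (sym (+-assoc (f x) _ _))

  sumℚ-map : ∀ {ℓ ℓ′} {A : Set ℓ} {B : Set ℓ′} (g : A → B) xs f → sumℚ (map g xs) f ≡ sumℚ xs (f ∘ g)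
  sumℚ-map g []       f = refl
  sumℚ-map g (x ∷ xs) f = cong (f (g x) +_) (sumℚ-map g xs f)

  open +-*-Solver using (solve; _:=_; _:+_; _:*_; _:-_; :-_; con)

  ∑ᴮ-cong : ∀ k {f g} → (∀ I → f I ≡ g I) → ∑ᴮ k f ≡ ∑ᴮ k g
  ∑ᴮ-cong zero    eq = eq []
  ∑ᴮ-cong (suc k) eq = cong₂ _+_ (∑ᴮ-cong k (eq ∘ (false ∷_))) (∑ᴮ-cong k (eq ∘ (true ∷_)))

  ∑ᴮ-linear : ∀ k a b f g → ∑ᴮ k (λ I → a * f I + b * g I) ≡ a * ∑ᴮ k f + b * ∑ᴮ k g
  ∑ᴮ-linear zero    a b f g = refl
  ∑ᴮ-linear (suc k) a b f g = trans
    (cong₂ _+_ (∑ᴮ-linear k a b (f ∘ (false ∷_)) (g ∘ (false ∷_))) (∑ᴮ-linear k a b (f ∘ (true ∷_)) (g ∘ (true ∷_))))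
    (solve 6 (λ a b p q r s → (a :* p :+ b :* q) :+ (a :* r :+ b :* s) := a :* (p :+ r) :+ b :* (q :+ s)) refl
      a b (∑ᴮ k (f ∘ (false ∷_))) (∑ᴮ k (g ∘ (false ∷_))) (∑ᴮ k (f ∘ (true ∷_))) (∑ᴮ k (g ∘ (true ∷_))))

  ∑ᴮ-*ˡ : ∀ k a f → ∑ᴮ k (λ I → a * f I) ≡ a * ∑ᴮ k f
  ∑ᴮ-*ˡ zero    a f = refl
  ∑ᴮ-*ˡ (suc k) a f = trans (cong₂ _+_ (∑ᴮ-*ˡ k a (f ∘ (false ∷_))) (∑ᴮ-*ˡ k a (f ∘ (true ∷_))))
    (sym (*-distribˡ-+ a _ _))

  ∑ᴮ-0 : ∀ k {f} → (∀ I → f I ≡ 0ℚ) → ∑ᴮ k f ≡ 0ℚ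
  ∑ᴮ-0 zero    eq = eq []
  ∑ᴮ-0 (suc k) eq = cong₂ _+_ (∑ᴮ-0 k (eq ∘ (false ∷_))) (∑ᴮ-0 k (eq ∘ (true ∷_)))

  ∑ᴮ-∑ᶠ : ∀ k j (f : Fin j → Vec Bool k → ℚ) → ∑ᴮ k (λ I → ∑ᶠ j (λ c → f c I)) ≡ ∑ᶠ j (λ c → ∑ᴮ k (f c))
  ∑ᴮ-∑ᶠ k zero    f = ∑ᴮ-0 k λ _ → refl
  ∑ᴮ-∑ᶠ k (suc j) f = begin
    ∑ᴮ k (λ I → f zero I + ∑ᶠ j (λ c → f (suc c) I))
      ≡⟨ ∑ᴮ-cong k (λ I → sym (cong₂ _+_ (*-identityˡ (f zero I)) (*-identityˡ (∑ᶠ j (λ c → f (suc c) I))))) ⟩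
    ∑ᴮ k (λ I → 1ℚ * f zero I + 1ℚ * ∑ᶠ j (λ c → f (suc c) I))
      ≡⟨ ∑ᴮ-linear k 1ℚ 1ℚ (f zero) (λ I → ∑ᶠ j (λ c → f (suc c) I)) ⟩
    1ℚ * ∑ᴮ k (f zero) + 1ℚ * ∑ᴮ k (λ I → ∑ᶠ j (λ c → f (suc c) I))
      ≡⟨ cong₂ _+_ (*-identityˡ (∑ᴮ k (f zero)))
           (trans (*-identityˡ (∑ᴮ k (λ I → ∑ᶠ j (λ c → f (suc c) I)))) (∑ᴮ-∑ᶠ k j (f ∘ suc))) ⟩
    ∑ᴮ k (f zero) + ∑ᶠ j (λ c → ∑ᴮ k (f (suc c))) ∎
    where open ≡-Reasoning

  ∑ᴮ-flip : ∀ k c f → ∑ᴮ k (λ I → f (updateAt I c not)) ≡ ∑ᴮ k f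
  ∑ᴮ-flip (suc k) zero    f = +-comm (∑ᴮ k (f ∘ (true ∷_))) _
  ∑ᴮ-flip (suc k) (suc c) f = cong₂ _+_ (∑ᴮ-flip k c (f ∘ (false ∷_))) (∑ᴮ-flip k c (f ∘ (true ∷_)))

  ∑ᶠ-cong : ∀ k {f g} → (∀ c → f c ≡ g c) → ∑ᶠ k f ≡ ∑ᶠ k g
  ∑ᶠ-cong zero    eq = refl
  ∑ᶠ-cong (suc k) eq = cong₂ _+_ (eq zero) (∑ᶠ-cong k (eq ∘ suc))

  ∑ᶠ-*ʳ : ∀ k a f → ∑ᶠ k (λ c → f c * a) ≡ ∑ᶠ k f * a
  ∑ᶠ-*ʳ zero    a f = sym (*-zeroˡ a)
  ∑ᶠ-*ʳ (suc k) a f = trans (cong (f zero * a +_) (∑ᶠ-*ʳ k a (f ∘ suc))) (sym (*-distribʳ-+ a (f zero) _))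

  sign : Bool → ℚ
  sign false = 1ℚ
  sign true  = - 1ℚ

  -- With `true` marking a minus sign, this is -1 to the sum of the exponents in I: the sign that
  -- monomial u receives in a power of the sum of ± colours.
  character : ∀ {k} → Vec Bool k → Vec ℕ k → ℚ
  character I = eval (sign ∘ lookup I)

  parity : ℕ → ℕ
  parity 0             = 0
  parity 1             = 1
  parity (suc (suc n)) = parity n

  -- The degree is odds + 2 halves, and halves is 0 exactly for squarefree monomials. In a fixed
  -- degree the number of odd exponents thus decides squarefreeness.
  odds halves : ∀ {k} → Vec ℕ k → ℕ
  odds []        = 0
  odds (x ∷ u)   = parity x ℕ.+ odds u
  halves []      = 0
  halves (x ∷ u) = ℕ.⌊ x /2⌋ ℕ.+ halves u

  -1^≡1-2parity : ∀ x → (- 1ℚ) ^ x ≡ 1ℚ - ⟦ 2 ⟧ * ⟦ parity x ⟧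
  -1^≡1-2parity 0             = refl
  -1^≡1-2parity 1             = refl
  -1^≡1-2parity (suc (suc x)) = trans
    (solve 1 (λ p → :- con 1ℚ :* (:- con 1ℚ :* p) := p) refl ((- 1ℚ) ^ x)) (-1^≡1-2parity x)

  ^-not : ∀ b x → sign (not b) ^ x ≡ (- 1ℚ) ^ x * sign b ^ x
  ^-not b zero    = refl
  ^-not b (suc x) = trans (cong₂ _*_ (sign-not b) (^-not b x))
    (solve 3 (λ s p q → :- s :* (p :* q) := (:- con 1ℚ :* p) :* (s :* q)) refl (sign b) ((- 1ℚ) ^ x) (sign b ^ x))
    where
    sign-not : ∀ b → sign (not b) ≡ - sign b
    sign-not false = refl
    sign-not true  = refl

  -- Multiplying a character by (-1)^(u_c) is the same as toggling c in its index set.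
  character-flip : ∀ {k} (I : Vec Bool k) c u → character (updateAt I c not) u ≡ (- 1ℚ) ^ lookup u c * character I u
  character-flip (b ∷ I) zero    (x ∷ u) = trans (cong (_* character I u) (^-not b x)) (*-assoc ((- 1ℚ) ^ x) (sign b ^ x) (character I u))
  character-flip (b ∷ I) (suc c) (x ∷ u) = trans (cong (sign b ^ x *_) (character-flip I c u))
    (solve 3 (λ p q r → p :* (q :* r) := q :* (p :* r)) refl (sign b ^ x) ((- 1ℚ) ^ lookup u c) (character I u))

  -- The sum of the characters of one-element sets. It equals k - 2 odds, so any affine function of
  -- the number of odd exponents costs one sign.
  signSum : ∀ {k} → Vec ℕ k → ℚ
  signSum {k} u = ∑ᶠ k (λ c → (- 1ℚ) ^ lookup u c)

  signSum≡ : ∀ {k} (u : Vec ℕ k) → signSum u ≡ ⟦ k ⟧ - ⟦ 2 ⟧ * ⟦ odds u ⟧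
  signSum≡ []                = refl
  signSum≡ {suc k} (x ∷ u) = begin
    (- 1ℚ) ^ x + signSum u
      ≡⟨ cong₂ _+_ (-1^≡1-2parity x) (signSum≡ u) ⟩
    1ℚ - ⟦ 2 ⟧ * ⟦ parity x ⟧ + (⟦ k ⟧ - ⟦ 2 ⟧ * ⟦ odds u ⟧)
      ≡⟨ solve 4 (λ t p k o → con 1ℚ :- t :* p :+ (k :- t :* o) := (con 1ℚ :+ k) :- t :* (p :+ o)) refl
           ⟦ 2 ⟧ ⟦ parity x ⟧ ⟦ k ⟧ ⟦ odds u ⟧ ⟩
    (1ℚ + ⟦ k ⟧) - ⟦ 2 ⟧ * (⟦ parity x ⟧ + ⟦ odds u ⟧)
      ≡⟨ sym (cong₂ (λ a b → a - ⟦ 2 ⟧ * b) (⟦⟧-+ 1 k) (⟦⟧-+ (parity x) (odds u))) ⟩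
    ⟦ suc k ⟧ - ⟦ 2 ⟧ * ⟦ parity x ℕ.+ odds u ⟧ ∎
    where open ≡-Reasoning

  -- The coefficients of the constant function 1, which is the character of the empty set.
  δ∅ : ∀ {k} → Vec Bool k → ℚ
  δ∅ []          = 1ℚ
  δ∅ (false ∷ I) = δ∅ I
  δ∅ (true ∷ I)  = 0ℚ

  ∑-δ∅ : ∀ {k} (u : Vec ℕ k) → ∑ᴮ k (λ I → δ∅ I * character I u) ≡ 1ℚ
  ∑-δ∅ []              = refl
  ∑-δ∅ {suc k} (x ∷ u) = begin
    ∑ᴮ k (λ I → δ∅ I * (1ℚ ^ x * character I u)) + ∑ᴮ k (λ I → 0ℚ * ((- 1ℚ) ^ x * character I u))
      ≡⟨ cong₂ _+_ (∑ᴮ-cong k λ I → cong (δ∅ I *_) (trans (cong (_* character I u) (1^ x)) (*-identityˡ _)))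
           (∑ᴮ-0 k λ I → *-zeroˡ ((- 1ℚ) ^ x * character I u)) ⟩
    ∑ᴮ k (λ I → δ∅ I * character I u) + 0ℚ    ≡⟨ +-identityʳ _ ⟩
    ∑ᴮ k (λ I → δ∅ I * character I u)         ≡⟨ ∑-δ∅ u ⟩
    1ℚ                                        ∎
    where
    open ≡-Reasoning
    1^ : ∀ x → 1ℚ ^ x ≡ 1ℚ
    1^ zero    = refl
    1^ (suc x) = trans (*-identityˡ _) (1^ x)

  flip-involutive : ∀ {k} (I : Vec Bool k) c → updateAt (updateAt I c not) c not ≡ I
  flip-involutive (b ∷ I) zero    = cong (_∷ I) (not-involutive b)
  flip-involutive (b ∷ I) (suc c) = cong (b ∷_) (flip-involutive I c)

  cardinality : ∀ {k} → Vec Bool k → ℕ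
  cardinality []          = 0
  cardinality (false ∷ I) = cardinality I
  cardinality (true ∷ I)  = suc (cardinality I)

  cardinality-flip : ∀ {k} (I : Vec Bool k) c → cardinality I ℕ.≤ suc (cardinality (updateAt I c not))
  cardinality-flip (false ∷ I) zero    = ℕ.m≤n⇒m≤1+n (ℕ.n≤1+n _)
  cardinality-flip (true ∷ I)  zero    = ℕ.≤-refl
  cardinality-flip (false ∷ I) (suc c) = cardinality-flip I c
  cardinality-flip (true ∷ I)  (suc c) = s≤s (cardinality-flip I c)

  -- Multiplying a combination of characters by a - signSum convolves its
  -- coefficients; each such factor raises the size of the support by at most 1.
  module _ {k : ℕ} (a : ℕ → ℚ) where

    product : ℕ → Vec ℕ k → ℚ
    product zero    u = 1ℚ
    product (suc j) u = (a j - signSum u) * product j u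

    weight : ℕ → Vec Bool k → ℚ
    weight zero    I = δ∅ I
    weight (suc j) I = a j * weight j I - ∑ᶠ k (λ c → weight j (updateAt I c not))

    weight-support : ∀ j I → j ℕ.< cardinality I → weight j I ≡ 0ℚ
    weight-support zero    I lt = go I lt
      where
      go : ∀ {k} (I : Vec Bool k) → 0 ℕ.< cardinality I → δ∅ I ≡ 0ℚ
      go (false ∷ I) lt = go I lt
      go (true ∷ I)  lt = refl
    weight-support (suc j) I lt = begin
      a j * weight j I - ∑ᶠ k (λ c → weight j (updateAt I c not))
        ≡⟨ cong₂ (λ x y → a j * x - y) (weight-support j I (ℕ.<-trans (ℕ.n<1+n j) lt))
             (∑ᶠ-cong k λ c → weight-support j (updateAt I c not) (ℕ.s≤s⁻¹ (ℕ.≤-trans lt (cardinality-flip I c)))) ⟩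
      a j * 0ℚ - ∑ᶠ k (λ _ → 0ℚ)    ≡⟨ cong₂ _-_ (*-zeroʳ (a j)) (∑ᶠ-0 k) ⟩
      0ℚ                            ∎
      where
      open ≡-Reasoning
      ∑ᶠ-0 : ∀ k → ∑ᶠ k (λ _ → 0ℚ) ≡ 0ℚ
      ∑ᶠ-0 zero    = refl
      ∑ᶠ-0 (suc k) = trans (+-identityˡ _) (∑ᶠ-0 k)

    ∑-weight : ∀ j u → ∑ᴮ k (λ I → weight j I * character I u) ≡ product j u
    ∑-weight zero    u = ∑-δ∅ u
    ∑-weight (suc j) u = begin
      ∑ᴮ k (λ I → (a j * w I - ∑ᶠ k (λ c → w (flip c I))) * χ I)
        ≡⟨ ∑ᴮ-cong k (λ I → trans
             (solve 4 (λ a w s x → (a :* w :- s) :* x := a :* (w :* x) :+ (:- con 1ℚ) :* (s :* x)) refl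
               (a j) (w I) (∑ᶠ k (λ c → w (flip c I))) (χ I))
             (cong (λ s → a j * (w I * χ I) + (- 1ℚ) * s) (sym (∑ᶠ-*ʳ k (χ I) (λ c → w (flip c I)))))) ⟩
      ∑ᴮ k (λ I → a j * (w I * χ I) + (- 1ℚ) * ∑ᶠ k (λ c → w (flip c I) * χ I))
        ≡⟨ ∑ᴮ-linear k (a j) (- 1ℚ) (λ I → w I * χ I) (λ I → ∑ᶠ k (λ c → w (flip c I) * χ I)) ⟩
      a j * P + (- 1ℚ) * ∑ᴮ k (λ I → ∑ᶠ k (λ c → w (flip c I) * χ I))
        ≡⟨ cong (λ s → a j * P + (- 1ℚ) * s) (trans (∑ᴮ-∑ᶠ k k (λ c I → w (flip c I) * χ I))
             (trans (∑ᶠ-cong k shifted) (∑ᶠ-*ʳ k P (λ c → (- 1ℚ) ^ lookup u c)))) ⟩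
      a j * P + (- 1ℚ) * (signSum u * P)
        ≡⟨ solve 3 (λ a p s → a :* p :+ (:- con 1ℚ) :* (s :* p) := (a :- s) :* p) refl (a j) P (signSum u) ⟩
      (a j - signSum u) * P
        ≡⟨ cong ((a j - signSum u) *_) (∑-weight j u) ⟩
      (a j - signSum u) * product j u ∎
      where
      open ≡-Reasoning
      w = weight j
      χ = λ I → character I u
      flip : Fin k → Vec Bool k → Vec Bool k
      flip c I = updateAt I c not
      P = ∑ᴮ k (λ I → w I * χ I)
      -- Toggling c is an involution on the index sets, so the sum may be reindexed by it; the
      -- toggle then acts on the character instead of the weight.
      shifted : ∀ c → ∑ᴮ k (λ I → w (flip c I) * χ I) ≡ (- 1ℚ) ^ lookup u c * P
      shifted c = begin
        ∑ᴮ k (λ I → w (flip c I) * χ I)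
          ≡⟨ ∑ᴮ-cong k (λ I → cong (λ J → w (flip c I) * χ J) (sym (flip-involutive I c))) ⟩
        ∑ᴮ k (λ I → w (flip c I) * χ (flip c (flip c I)))
          ≡⟨ ∑ᴮ-flip k c (λ I → w I * χ (flip c I)) ⟩
        ∑ᴮ k (λ I → w I * χ (flip c I))
          ≡⟨ ∑ᴮ-cong k (λ I → trans (cong (w I *_) (character-flip I c u))
               (solve 3 (λ p q r → p :* (q :* r) := q :* (p :* r)) refl (w I) ((- 1ℚ) ^ lookup u c) (χ I))) ⟩
        ∑ᴮ k (λ I → (- 1ℚ) ^ lookup u c * (w I * χ I))
          ≡⟨ ∑ᴮ-*ˡ k ((- 1ℚ) ^ lookup u c) (λ I → w I * χ I) ⟩
        (- 1ℚ) ^ lookup u c * P ∎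

  smallSets : ∀ k → ℕ → List (Vec Bool k)
  smallSets zero    m       = [] ∷ []
  smallSets (suc k) zero    = map (false ∷_) (smallSets k zero)
  smallSets (suc k) (suc m) = map (false ∷_) (smallSets k (suc m)) ++ map (true ∷_) (smallSets k m)

  length-smallSets : ∀ k m → length (smallSets k m) ≡ binomials≤ k m
  length-smallSets zero          m       = refl
  length-smallSets (suc zero)    zero    = refl
  length-smallSets (suc (suc k)) zero    = trans (List.length-map _ (smallSets (suc k) zero)) (length-smallSets (suc k) zero)
  length-smallSets (suc k)       (suc m) = trans (List.length-++ (map (false ∷_) (smallSets k (suc m))))
    (cong₂ ℕ._+_ (trans (List.length-map _ (smallSets k (suc m))) (length-smallSets k (suc m)))
                 (trans (List.length-map _ (smallSets k m)) (length-smallSets k m)))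

  ∑-smallSets : ∀ k m f → (∀ I → m ℕ.< cardinality I → f I ≡ 0ℚ) → sumℚ (smallSets k m) f ≡ ∑ᴮ k f
  ∑-smallSets zero    m       f f≡0 = +-identityʳ (f [])
  ∑-smallSets (suc k) zero    f f≡0 = begin
    sumℚ (map (false ∷_) (smallSets k zero)) f     ≡⟨ sumℚ-map (false ∷_) (smallSets k zero) f ⟩
    sumℚ (smallSets k zero) (f ∘ (false ∷_))       ≡⟨ ∑-smallSets k zero (f ∘ (false ∷_)) (f≡0 ∘ (false ∷_)) ⟩
    ∑ᴮ k (f ∘ (false ∷_))                          ≡⟨ sym (+-identityʳ _) ⟩
    ∑ᴮ k (f ∘ (false ∷_)) + 0ℚ
      ≡⟨ cong (∑ᴮ k (f ∘ (false ∷_)) +_) (sym (∑ᴮ-0 k λ I → f≡0 (true ∷ I) (s≤s z≤n))) ⟩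
    ∑ᴮ k (f ∘ (false ∷_)) + ∑ᴮ k (f ∘ (true ∷_))   ∎
    where open ≡-Reasoning
  ∑-smallSets (suc k) (suc m) f f≡0 = begin
    sumℚ (map (false ∷_) (smallSets k (suc m)) ++ map (true ∷_) (smallSets k m)) f
      ≡⟨ trans (sumℚ-++ (map (false ∷_) (smallSets k (suc m))) _ f)
           (cong₂ _+_ (sumℚ-map (false ∷_) (smallSets k (suc m)) f) (sumℚ-map (true ∷_) (smallSets k m) f)) ⟩
    sumℚ (smallSets k (suc m)) (f ∘ (false ∷_)) + sumℚ (smallSets k m) (f ∘ (true ∷_))
      ≡⟨ cong₂ _+_ (∑-smallSets k (suc m) (f ∘ (false ∷_)) (f≡0 ∘ (false ∷_)))
           (∑-smallSets k m (f ∘ (true ∷_)) (λ I lt → f≡0 (true ∷ I) (s≤s lt))) ⟩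
    ∑ᴮ k (f ∘ (false ∷_)) + ∑ᴮ k (f ∘ (true ∷_))   ∎
    where open ≡-Reasoning

  odds+halves : ∀ {k} (u : Vec ℕ k) → odds u ℕ.+ 2 ℕ.* halves u ≡ Vec.sum u
  odds+halves []      = refl
  odds+halves (x ∷ u) = trans (lem (parity x) (odds u) ℕ.⌊ x /2⌋ (halves u)) (cong₂ ℕ._+_ (parity+half x) (odds+halves u))
    where
    lem : ∀ p o h l → p ℕ.+ o ℕ.+ 2 ℕ.* (h ℕ.+ l) ≡ (p ℕ.+ 2 ℕ.* h) ℕ.+ (o ℕ.+ 2 ℕ.* l)
    lem = solve-∀
    parity+half : ∀ x → parity x ℕ.+ 2 ℕ.* ℕ.⌊ x /2⌋ ≡ x
    parity+half 0             = refl
    parity+half 1             = refl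
    parity+half (suc (suc x)) = trans (lem′ (parity x) ℕ.⌊ x /2⌋) (cong (2 ℕ.+_) (parity+half x))
      where
      lem′ : ∀ p h → p ℕ.+ 2 ℕ.* (1 ℕ.+ h) ≡ 2 ℕ.+ (p ℕ.+ 2 ℕ.* h)
      lem′ = solve-∀

  squarefree⇒halves : ∀ {k} (u : Vec ℕ k) → squarefree u ≡ 1 → halves u ≡ 0
  squarefree⇒halves []      eq = refl
  squarefree⇒halves (0 ∷ u) eq = squarefree⇒halves u eq
  squarefree⇒halves (1 ∷ u) eq = squarefree⇒halves u eq

  ¬squarefree⇒halves : ∀ {k} (u : Vec ℕ k) → squarefree u ≡ 0 → 0 ℕ.< halves u
  ¬squarefree⇒halves (0 ∷ u)           eq = ¬squarefree⇒halves u eq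
  ¬squarefree⇒halves (1 ∷ u)           eq = ¬squarefree⇒halves u eq
  ¬squarefree⇒halves (suc (suc _) ∷ u) eq = s≤s z≤n

  -- In degree d the polynomial ∏_{i=1}^{⌊d/2⌋} (2 odds - 2 (d - 2 i)) vanishes
  -- unless all exponents are ≤ 1, because d - odds is even and nonnegative.
  module _ {k : ℕ} (d : ℕ) where

    -- Chosen so that `shift i` minus `signSum u` is 2 odds - 2 (d - 2 (i+1)), since `signSum u` is
    -- k - 2 odds. The indices start at 0.
    shift : ℕ → ℚ
    shift i = ⟦ k ⟧ + ⟦ 4 ℕ.* suc i ⟧ - ⟦ 2 ℕ.* d ⟧

    -- This is 4^j j!, the value of the product on squarefree monomials.
    scale : ℕ → ℚ
    scale zero    = 1ℚ
    scale (suc j) = ⟦ 4 ℕ.* suc j ⟧ * scale j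

    scale>0 : ∀ j → 0ℚ < scale j
    scale>0 zero    = positive⁻¹ 1ℚ
    scale>0 (suc j) = subst (_< ⟦ 4 ℕ.* suc j ⟧ * scale j) (*-zeroʳ ⟦ 4 ℕ.* suc j ⟧)
      (*-monoʳ-<-pos ⟦ 4 ℕ.* suc j ⟧ {{positive (⟦⟧-mono-< {0} {4 ℕ.* suc j} (s≤s z≤n))}} (scale>0 j))

    -- Writing d as odds + 2 halves cancels the odd exponents. The factor is 4 (i+1) - 4 halves and
    -- vanishes exactly when halves is i + 1.
    factor : ∀ (u : Vec ℕ k) i → Vec.sum u ≡ d → shift i - signSum u ≡ ⟦ 4 ℕ.* suc i ⟧ - ⟦ 4 ℕ.* halves u ⟧
    factor u i refl = begin
      ⟦ k ⟧ + F - ⟦ 2 ℕ.* Vec.sum u ⟧ - signSum u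
        ≡⟨ cong₂ (λ x y → ⟦ k ⟧ + F - x - y) sum≡ (signSum≡ u) ⟩
      ⟦ k ⟧ + F - (⟦ 2 ⟧ * ⟦ odds u ⟧ + ⟦ 4 ℕ.* halves u ⟧) - (⟦ k ⟧ - ⟦ 2 ⟧ * ⟦ odds u ⟧)
        ≡⟨ solve 4 (λ k F o h → k :+ F :- (o :+ h) :- (k :- o) := F :- h) refl
             ⟦ k ⟧ F (⟦ 2 ⟧ * ⟦ odds u ⟧) ⟦ 4 ℕ.* halves u ⟧ ⟩
      F - ⟦ 4 ℕ.* halves u ⟧ ∎
      where
      open ≡-Reasoning
      F = ⟦ 4 ℕ.* suc i ⟧
      lem : ∀ o h → 2 ℕ.* (o ℕ.+ 2 ℕ.* h) ≡ 2 ℕ.* o ℕ.+ 4 ℕ.* h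
      lem = solve-∀
      sum≡ : ⟦ 2 ℕ.* Vec.sum u ⟧ ≡ ⟦ 2 ⟧ * ⟦ odds u ⟧ + ⟦ 4 ℕ.* halves u ⟧
      sum≡ = begin
        ⟦ 2 ℕ.* Vec.sum u ⟧                          ≡⟨ cong (λ x → ⟦ 2 ℕ.* x ⟧) (sym (odds+halves u)) ⟩
        ⟦ 2 ℕ.* (odds u ℕ.+ 2 ℕ.* halves u) ⟧        ≡⟨ cong ⟦_⟧ (lem (odds u) (halves u)) ⟩
        ⟦ 2 ℕ.* odds u ℕ.+ 4 ℕ.* halves u ⟧          ≡⟨ ⟦⟧-+ (2 ℕ.* odds u) (4 ℕ.* halves u) ⟩
        ⟦ 2 ℕ.* odds u ⟧ + ⟦ 4 ℕ.* halves u ⟧        ≡⟨ cong (_+ ⟦ 4 ℕ.* halves u ⟧) (⟦⟧-* 2 (odds u)) ⟩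
        ⟦ 2 ⟧ * ⟦ odds u ⟧ + ⟦ 4 ℕ.* halves u ⟧      ∎

    product-squarefree : ∀ (u : Vec ℕ k) → Vec.sum u ≡ d → squarefree u ≡ 1 → ∀ j → product shift j u ≡ scale j
    product-squarefree u sum≡d sf zero    = refl
    product-squarefree u sum≡d sf (suc j) = cong₂ _*_
      (trans (factor u j sum≡d) (trans (cong (λ h → ⟦ 4 ℕ.* suc j ⟧ - ⟦ 4 ℕ.* h ⟧) (squarefree⇒halves u sf))
        (+-identityʳ ⟦ 4 ℕ.* suc j ⟧)))
      (product-squarefree u sum≡d sf j)

    product-vanishes : ∀ (u : Vec ℕ k) i → halves u ≡ suc i → Vec.sum u ≡ d → ∀ j → i ℕ.< j → product shift j u ≡ 0ℚ
    product-vanishes u i h≡ sum≡d (suc j) i<1+j with j ℕ.≟ i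
    ... | yes refl = trans (cong (_* product shift j u) (trans (factor u j sum≡d)
        (trans (cong (λ h → ⟦ 4 ℕ.* suc j ⟧ - ⟦ 4 ℕ.* h ⟧) h≡) (+-inverseʳ ⟦ 4 ℕ.* suc j ⟧)))) (*-zeroˡ (product shift j u))
    ... | no  j≢i  = trans (cong ((shift j - signSum u) *_)
        (product-vanishes u i h≡ sum≡d j (ℕ.≤∧≢⇒< (ℕ.s≤s⁻¹ i<1+j) (j≢i ∘ sym)))) (*-zeroʳ (shift j - signSum u))

    signWeight : Vec Bool k → ℚ
    signWeight = weight shift (d / 2)

    -- A monomial of degree d that is not squarefree has halves between 1 and d/2, so one of the d/2
    -- factors vanishes on it. `weight-support` permits restricting the sum to sets of size at most
    -- d/2.
    ∑-signWeight : ∀ u → Vec.sum u ≡ d →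
      sumℚ (smallSets k (d / 2)) (λ I → signWeight I * character I u) ≡ scale (d / 2) * ⟦ squarefree u ⟧
    ∑-signWeight u sum≡d = trans
      (trans (∑-smallSets k (d / 2) _ λ I lt → trans (cong (_* character I u) (weight-support shift (d / 2) I lt)) (*-zeroˡ (character I u)))
             (∑-weight shift (d / 2) u))
      (cases (squarefree u) (squarefree-01 u) refl)
      where
      cases : ∀ x → x ≡ 0 ⊎ x ≡ 1 → squarefree u ≡ x → product shift (d / 2) u ≡ scale (d / 2) * ⟦ x ⟧
      cases _ (inj₂ refl) sf  = trans (product-squarefree u sum≡d sf (d / 2)) (sym (*-identityʳ _))
      cases _ (inj₁ refl) ¬sf = trans (vanish (halves u) refl (¬squarefree⇒halves u ¬sf)) (sym (*-zeroʳ (scale (d / 2))))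
        where
        vanish : ∀ h → halves u ≡ h → 0 ℕ.< h → product shift (d / 2) u ≡ 0ℚ
        vanish (suc i) h≡ _ = product-vanishes u i h≡ sum≡d (d / 2) (subst (ℕ._≤ d / 2) (m*n/n≡m (suc i) 2)
          (/-monoˡ-≤ 2 (subst₂ ℕ._≤_ (trans (cong (2 ℕ.*_) h≡) (ℕ.*-comm 2 (suc i))) (trans (odds+halves u) sum≡d)
            (ℕ.m≤n+m (2 ℕ.* halves u) (odds u)))))

-- The power sum attached to a list of colourings

module PowerSums where

  open import Defs using (module Polynomial; 𝟏)
  open Estimates using (binomials≤)

  open Colourings
  open Rationals
  open Polynomials hiding (∑-cong)
  open Characters
  open import Algebra.Bundles using (CommutativeSemiring)
  import Algebra.Definitions.RawSemiring as RawSemiringDefs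
  import Algebra.Properties.Semiring.Mult as Mult
  open import Data.Bool.Base using (Bool)
  open import Data.Fin.Base using (Fin; zero; suc)
  open import Data.List.Base as List using (List; []; _∷_; _++_; length; concatMap; map)
  import Data.List.Properties as List
  open import Data.Nat.Base as ℕ using (ℕ; zero; suc)
  import Data.Nat.Properties as ℕ
  open import Data.Nat.DivMod using (_/_)
  open import Data.Rational.Base as ℚ using (ℚ; 0ℚ; 1ℚ)
  import Data.Rational.Properties as ℚ
  open import Data.Sum.Base using (inj₁; inj₂)
  open import Data.Vec.Base as Vec using (Vec; []; _∷_; lookup; updateAt; replicate)
  import Data.Vec.Properties as Vec
  open import Data.Vec.Functional as Vector using (Vector)
  open import Function.Base using (_∘_)
  open import Relation.Binary.PropositionalEquality as ≡ using (_≡_; refl; cong; cong₂; subst)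
  open import Relation.Nullary using (¬_; Dec; yes; no; contradiction)

  squarefree-updateAt-2+ : ∀ {k} (u : Vec ℕ k) c x → squarefree (updateAt u c (suc (suc x) ℕ.+_)) ≡ 0
  squarefree-updateAt-2+ (y ∷ u)           zero    x = refl
  squarefree-updateAt-2+ (0 ∷ u)           (suc c) x = squarefree-updateAt-2+ u c x
  squarefree-updateAt-2+ (1 ∷ u)           (suc c) x = squarefree-updateAt-2+ u c x
  squarefree-updateAt-2+ (suc (suc y) ∷ u) (suc c) x = refl

  -- A variable with exponent at least 2 already gives its colour such an exponent.
  ¬squarefree⇒recolour : ∀ {k n} u (χ : Vec (Fin k) n) e → squarefree e ≡ 0 → squarefree (recolour u χ e) ≡ 0
  ¬squarefree⇒recolour u (c ∷ χ) (0 ∷ e)           eq = ¬squarefree⇒recolour _ χ e eq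
  ¬squarefree⇒recolour u (c ∷ χ) (1 ∷ e)           eq = ¬squarefree⇒recolour _ χ e eq
  ¬squarefree⇒recolour u (c ∷ χ) (suc (suc x) ∷ e) eq = squarefree-recolour _ χ e (squarefree-updateAt-2+ u c x)

  squarefree⇒ZeroOne : ∀ {n} (e : Vec ℕ n) → squarefree e ≡ 1 → ZeroOne (Vec.sum e) e
  squarefree⇒ZeroOne []      eq = []
  squarefree⇒ZeroOne (0 ∷ e) eq = 0∷ squarefree⇒ZeroOne e eq
  squarefree⇒ZeroOne (1 ∷ e) eq = 1∷ squarefree⇒ZeroOne e eq

  zeroOne? : ∀ {n} d (e : Vec ℕ n) → Dec (ZeroOne d e)
  zeroOne? d e with squarefree e in eq | squarefree-01 e | Vec.sum e ℕ.≟ d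
  ... | _ | _         | no  sum≢d = no (sum≢d ∘ ZeroOne⇒deg)
  ... | _ | inj₁ refl | yes _     = no λ b → contradiction (≡.trans (≡.sym eq) (ZeroOne⇒squarefree b)) λ ()
  ... | _ | inj₂ refl | yes refl  = yes (squarefree⇒ZeroOne e eq)

  sum-updateAt : ∀ {k} (u : Vec ℕ k) c x → Vec.sum (updateAt u c (x ℕ.+_)) ≡ Vec.sum u ℕ.+ x
  sum-updateAt (y ∷ u) zero    x = ≡.trans (cong (ℕ._+ Vec.sum u) (ℕ.+-comm x y))
    (≡.trans (ℕ.+-assoc y x _) (≡.trans (cong (y ℕ.+_) (ℕ.+-comm x _)) (≡.sym (ℕ.+-assoc y _ x))))
  sum-updateAt (y ∷ u) (suc c) x = ≡.trans (cong (y ℕ.+_) (sum-updateAt u c x)) (≡.sym (ℕ.+-assoc y _ x))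

  sum-recolour : ∀ {k n} u (χ : Vec (Fin k) n) e → Vec.sum (recolour u χ e) ≡ Vec.sum u ℕ.+ Vec.sum e
  sum-recolour u []      []      = ≡.sym (ℕ.+-identityʳ _)
  sum-recolour u (c ∷ χ) (x ∷ e) = ≡.trans (sum-recolour _ χ e)
    (≡.trans (cong (ℕ._+ Vec.sum e) (sum-updateAt u c x)) (ℕ.+-assoc (Vec.sum u) x _))

  sumℚ-cong : ∀ {a} {A : Set a} (xs : List A) {f g} → (∀ x → f x ≡ g x) → sumℚ xs f ≡ sumℚ xs g
  sumℚ-cong []       eq = refl
  sumℚ-cong (x ∷ xs) eq = cong₂ ℚ._+_ (eq x) (sumℚ-cong xs eq)

  sumℚ-*ˡ : ∀ {a} {A : Set a} c (xs : List A) f → sumℚ xs (λ x → c ℚ.* f x) ≡ c ℚ.* sumℚ xs f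
  sumℚ-*ˡ c []       f = ≡.sym (ℚ.*-zeroʳ c)
  sumℚ-*ˡ c (x ∷ xs) f = ≡.trans (cong (c ℚ.* f x ℚ.+_) (sumℚ-*ˡ c xs f)) (≡.sym (ℚ.*-distribˡ-+ c (f x) _))

  sumℚ-⟦⟧ : ∀ {a} {A : Set a} (xs : List A) f → sumℚ xs (λ x → ⟦ f x ⟧) ≡ ⟦ ∑ xs f ⟧
  sumℚ-⟦⟧ []       f = refl
  sumℚ-⟦⟧ (x ∷ xs) f = ≡.trans (cong (⟦ f x ⟧ ℚ.+_) (sumℚ-⟦⟧ xs f)) (≡.sym (⟦⟧-+ (f x) (∑ xs f)))

  open Coefficients ℚ-commutativeSemiring using () renaming (eval to evalℚ; eval-recolour to evalℚ-recolour; eval-𝟏 to evalℚ-𝟏)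
  open RawSemiringDefs (CommutativeSemiring.rawSemiring ℚ-commutativeSemiring) using () renaming (_^_ to _^ℚ_)

  character-recolour : ∀ {k n} I (χ : Vec (Fin k) n) e →
    evalℚ (sign ∘ lookup I ∘ lookup χ) e ≡ character I (recolour (replicate k 0) χ e)
  character-recolour {k} I χ e = ≡.sym (≡.trans (evalℚ-recolour (sign ∘ lookup I) (replicate k 0) χ e)
    (≡.trans (cong (evalℚ (sign ∘ lookup I ∘ lookup χ) e ℚ.*_) (evalℚ-𝟏 (sign ∘ lookup I)))
      (ℚ.*-identityʳ (evalℚ (sign ∘ lookup I ∘ lookup χ) e))))

  sum-replicate-0 : ∀ k → Vec.sum (replicate k 0) ≡ 0
  sum-replicate-0 zero    = refl
  sum-replicate-0 (suc k) = sum-replicate-0 k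

  module SumOfPowers {c ℓ} (R : CommutativeSemiring c ℓ) where

    open CommutativeSemiring R hiding (zero; refl)
    open Polynomial rawSemiring using (Poly; coeff; LinearForm; toPoly) renaming (rawSemiring to polySemiring)
    open Coefficients R using (eval; eval-scale; coeff-^; coeff-++; _^ᴾ_)
    open RawSemiringDefs rawSemiring using (_^_)
    open Mult semiring using (×-congʳ) renaming (_×_ to _×ᴿ_)
    open import Relation.Binary.Reasoning.Setoid setoid

    private
      ≈-refl : ∀ {x} → x ≈ x
      ≈-refl = CommutativeSemiring.refl R

    sumᴿ : ∀ {a} {A : Set a} → List A → (A → Carrier) → Carrier
    sumᴿ []       f = 0#
    sumᴿ (x ∷ xs) f = f x + sumᴿ xs f

    sumᴿ-cong : ∀ {a} {A : Set a} (xs : List A) {f g} → (∀ x → f x ≈ g x) → sumᴿ xs f ≈ sumᴿ xs g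
    sumᴿ-cong []       eq = ≈-refl
    sumᴿ-cong (x ∷ xs) eq = +-cong (eq x) (sumᴿ-cong xs eq)

    sumᴿ-++ : ∀ {a} {A : Set a} (xs ys : List A) f → sumᴿ (xs ++ ys) f ≈ sumᴿ xs f + sumᴿ ys f
    sumᴿ-++ []       ys f = sym (+-identityˡ _)
    sumᴿ-++ (x ∷ xs) ys f = trans (+-congˡ (sumᴿ-++ xs ys f)) (sym (+-assoc _ _ _))

    sumᴿ-concatMap : ∀ {a b} {A : Set a} {B : Set b} (g : A → List B) xs f →
                     sumᴿ (concatMap g xs) f ≈ sumᴿ xs (λ x → sumᴿ (g x) f)
    sumᴿ-concatMap g []       f = ≈-refl
    sumᴿ-concatMap g (x ∷ xs) f = trans (sumᴿ-++ (g x) _ f) (+-congˡ (sumᴿ-concatMap g xs f))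

    sumᴿ-map : ∀ {a b} {A : Set a} {B : Set b} (g : A → B) xs f → sumᴿ (map g xs) f ≈ sumᴿ xs (f ∘ g)
    sumᴿ-map g []       f = ≈-refl
    sumᴿ-map g (x ∷ xs) f = +-congˡ (sumᴿ-map g xs f)

    sumᴿ-*ʳ : ∀ {a} {A : Set a} (xs : List A) f y → sumᴿ xs (λ x → f x * y) ≈ sumᴿ xs f * y
    sumᴿ-*ʳ []       f y = sym (zeroˡ y)
    sumᴿ-*ʳ (x ∷ xs) f y = trans (+-congˡ (sumᴿ-*ʳ xs f y)) (sym (distribʳ y _ _))

    powerSum : ∀ {n} d → List (LinearForm n) → Poly n
    powerSum {n} d ℓs = RawSemiringDefs.sum (polySemiring n) (λ k → toPoly (List.lookup ℓs k) ^ᴾ d)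

    coeff-powerSum : ∀ {n} d (ℓs : List (LinearForm n)) e →
      coeff (powerSum d ℓs) e ≈ sumᴿ ℓs (λ f → multinomial d e ×ᴿ eval f e)
    coeff-powerSum d []       e = ≈-refl
    coeff-powerSum d (f ∷ ℓs) e = trans (coeff-++ (toPoly f ^ᴾ d) (powerSum d ℓs) e)
      (+-cong (coeff-^ f d e) (coeff-powerSum d ℓs e))

    -- d and ℓs are kept variable, since the concrete sum unfolds in every instance.
    coeff-power₀-ZeroOne : ∀ {n d f} {ℓs : List (LinearForm n)} → d ≡ 0 → ℓs ≡ f ∷ [] →
      ∀ {e} → ZeroOne d e → coeff (powerSum d ℓs) e ≈ 1#
    coeff-power₀-ZeroOne refl refl {e} b with Vec.≡-dec ℕ._≟_ 𝟏 e
    ... | yes _    = +-identityʳ 1#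
    ... | no  𝟏≢e = contradiction (ZeroOne₀⇒𝟏 b) 𝟏≢e

    coeff-power₀-¬ZeroOne : ∀ {n d f} {ℓs : List (LinearForm n)} → d ≡ 0 → ℓs ≡ f ∷ [] →
      ∀ e → ¬ ZeroOne d e → coeff (powerSum d ℓs) e ≈ 0#
    coeff-power₀-¬ZeroOne {n} refl refl e ¬b with Vec.≡-dec ℕ._≟_ 𝟏 e
    ... | yes refl = contradiction (ZeroOne-𝟏 n) ¬b
    ... | no  _    = ≈-refl

    sumᴿ-× : ∀ {a} {A : Set a} m (xs : List A) f → sumᴿ xs (λ x → m ×ᴿ f x) ≈ m ×ᴿ sumᴿ xs f
    sumᴿ-× zero    []       f = ≈-refl
    sumᴿ-× (suc m) []       f = trans (sumᴿ-× m [] f) (sym (+-identityˡ _))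
    sumᴿ-× m       (x ∷ xs) f = trans (+-congˡ (sumᴿ-× m xs f)) (sym (×-distrib m (f x) (sumᴿ xs f)))
      where open import Algebra.Properties.CommutativeMonoid.Mult +-commutativeMonoid using ()
                 renaming (×-distrib-+ to ×-distrib′)
            ×-distrib : ∀ m x y → m ×ᴿ (x + y) ≈ m ×ᴿ x + m ×ᴿ y
            ×-distrib m x y = ×-distrib′ x y m

    -- The sign weights are computed in ℚ while the forms have coefficients in R; of the embedding
    -- only the homomorphism laws are used.
    module WithRationals (ι : ℚ → Carrier) (ι-0 : ι 0ℚ ≈ 0#) (ι-1 : ι 1ℚ ≈ 1#)
      (ι-+ : ∀ p q → ι (p ℚ.+ q) ≈ ι p + ι q) (ι-* : ∀ p q → ι (p ℚ.* q) ≈ ι p * ι q) where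

      ι-cong : ∀ {p q} → p ≡ q → ι p ≈ ι q
      ι-cong eq = reflexive (cong ι eq)

      ι-^ : ∀ p x → ι (p ^ℚ x) ≈ ι p ^ x
      ι-^ p zero    = ι-1
      ι-^ p (suc x) = trans (ι-* p _) (*-congˡ (ι-^ p x))

      ι-eval : ∀ {n} (σ : Vector ℚ n) e → ι (evalℚ σ e) ≈ eval (ι ∘ σ) e
      ι-eval σ []      = ι-1
      ι-eval σ (x ∷ e) = trans (ι-* _ _) (*-cong (ι-^ (σ zero) x) (ι-eval (σ ∘ suc) e))

      ι-sum : ∀ {a} {A : Set a} (xs : List A) f → sumᴿ xs (ι ∘ f) ≈ ι (sumℚ xs f)
      ι-sum []       f = sym ι-0
      ι-sum (x ∷ xs) f = trans (+-congˡ (ι-sum xs f)) (sym (ι-+ _ _))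

      ι-× : ∀ m q → m ×ᴿ ι q ≈ ι (⟦ m ⟧ ℚ.* q)
      ι-× zero    q = trans (sym ι-0) (ι-cong (≡.sym (ℚ.*-zeroˡ q)))
      ι-× (suc m) q = trans (+-congˡ (ι-× m q)) (trans (sym (ι-+ _ _)) (ι-cong (≡.sym
        (≡.trans (cong (ℚ._* q) (⟦⟧-+ 1 m)) (≡.trans (ℚ.*-distribʳ-+ q 1ℚ ⟦ m ⟧) (cong (ℚ._+ ⟦ m ⟧ ℚ.* q) (ℚ.*-identityˡ q)))))))

      -- A coefficient is moved inside the powers by scalars `ρs I` whose d-th powers add up to it.
      -- A list is required because one scalar obtained from a real root cannot serve a negative
      -- coefficient when d is even.
      module _ {k n : ℕ} (d : ℕ) (κ : ℚ) (ψ : List (Vec (Fin k) n)) (ρs : Vec Bool k → List Carrier)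
        (∑ρ^d : ∀ I → sumᴿ (ρs I) (_^ d) ≈ ι (κ ℚ.* signWeight d I)) where

        form : Vec (Fin k) n → Vec Bool k → Carrier → LinearForm n
        form χ I ρ v = ρ * ι (sign (lookup I (lookup χ v)))

        formsOf : Vec (Fin k) n → Vec Bool k → List (LinearForm n)
        formsOf χ I = map (form χ I) (ρs I)

        forms : List (LinearForm n)
        forms = concatMap (λ χ → concatMap (formsOf χ) (smallSets k (d / 2))) ψ

        length-forms : (∀ I → length (ρs I) ℕ.≤ 2) → length forms ℕ.≤ length ψ ℕ.* (2 ℕ.* binomials≤ k (d / 2))
        length-forms ρs≤2 = length-concatMap _ ψ λ χ → subst (length (concatMap (formsOf χ) (smallSets k (d / 2))) ℕ.≤_)
          (≡.trans (cong (ℕ._* 2) (length-smallSets k (d / 2))) (ℕ.*-comm (binomials≤ k (d / 2)) 2))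
          (length-concatMap (formsOf χ) (smallSets k (d / 2)) λ I →
            subst (ℕ._≤ 2) (≡.sym (List.length-map (form χ I) (ρs I))) (ρs≤2 I))
          where
          length-concatMap : ∀ {a b} {A : Set a} {B : Set b} (g : A → List B) xs {m} → (∀ x → length (g x) ℕ.≤ m) →
                             length (concatMap g xs) ℕ.≤ length xs ℕ.* m
          length-concatMap g []       g≤ = ℕ.z≤n
          length-concatMap g (x ∷ xs) g≤ = subst (ℕ._≤ _) (≡.sym (List.length-++ (g x)))
            (ℕ.+-mono-≤ (g≤ x) (length-concatMap g xs g≤))

        coeff-forms : ∀ e → coeff (powerSum d forms) e ≈ multinomial d e ×ᴿ sumᴿ forms (λ f → eval f e)
        coeff-forms e = trans (coeff-powerSum d forms e) (sumᴿ-× (multinomial d e) forms (λ f → eval f e))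

        -- For a fixed colouring the weighted sum over the signs is a multiple of the squarefree
        -- indicator of the recoloured monomial, so the total counts the colourings under which e is
        -- rainbow.
        sum-eval : ∀ e → Vec.sum e ≡ d → sumᴿ forms (λ f → eval f e) ≈ ι (κ ℚ.* scale {k} d (d / 2) ℚ.* ⟦ ∑ ψ (rainbow e) ⟧)
        sum-eval e refl = begin
          sumᴿ forms (λ f → eval f e)
            ≈⟨ trans (sumᴿ-concatMap _ ψ _) (sumᴿ-cong ψ λ χ → sumᴿ-concatMap _ (smallSets k (d / 2)) _) ⟩
          sumᴿ ψ (λ χ → sumᴿ (smallSets k (d / 2)) (λ I → sumᴿ (formsOf χ I) (λ f → eval f e)))
            ≈⟨ sumᴿ-cong ψ (λ χ → trans (sumᴿ-cong (smallSets k (d / 2)) (perSet χ)) (ι-sum (smallSets k (d / 2)) _)) ⟩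
          sumᴿ ψ (λ χ → ι (sumℚ (smallSets k (d / 2)) (λ I → κ ℚ.* (signWeight d I ℚ.* character I (E χ)))))
            ≈⟨ sumᴿ-cong ψ (λ χ → ι-cong (perColouring χ)) ⟩
          sumᴿ ψ (λ χ → ι (κ ℚ.* scale {k} d (d / 2) ℚ.* ⟦ rainbow e χ ⟧))
            ≈⟨ ι-sum ψ _ ⟩
          ι (sumℚ ψ (λ χ → κ ℚ.* scale {k} d (d / 2) ℚ.* ⟦ rainbow e χ ⟧))
            ≈⟨ ι-cong (≡.trans (sumℚ-*ˡ (κ ℚ.* scale {k} d (d / 2)) ψ (λ χ → ⟦ rainbow e χ ⟧))
                 (cong (κ ℚ.* scale {k} d (d / 2) ℚ.*_) (sumℚ-⟦⟧ ψ (rainbow e)))) ⟩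
          ι (κ ℚ.* scale {k} d (d / 2) ℚ.* ⟦ ∑ ψ (rainbow e) ⟧) ∎
          where
          E : Vec (Fin k) n → Vec ℕ k
          E χ = recolour (replicate k 0) χ e
          sum-E : ∀ χ → Vec.sum (E χ) ≡ d
          sum-E χ = ≡.trans (sum-recolour (replicate k 0) χ e) (cong (ℕ._+ Vec.sum e) (sum-replicate-0 k))
          perSet : ∀ χ I → sumᴿ (formsOf χ I) (λ f → eval f e) ≈ ι (κ ℚ.* (signWeight d I ℚ.* character I (E χ)))
          perSet χ I = begin
            sumᴿ (map (form χ I) (ρs I)) (λ f → eval f e)
              ≈⟨ sumᴿ-map (form χ I) (ρs I) _ ⟩
            sumᴿ (ρs I) (λ ρ → eval (form χ I ρ) e)
              ≈⟨ sumᴿ-cong (ρs I) (λ ρ → eval-scale ρ (λ v → ι (sign (lookup I (lookup χ v)))) e) ⟩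
            sumᴿ (ρs I) (λ ρ → ρ ^ d * eval (λ v → ι (sign (lookup I (lookup χ v)))) e)
              ≈⟨ sumᴿ-*ʳ (ρs I) (_^ d) _ ⟩
            sumᴿ (ρs I) (_^ d) * eval (λ v → ι (sign (lookup I (lookup χ v)))) e
              ≈⟨ *-cong (∑ρ^d I) (trans (sym (ι-eval (λ v → sign (lookup I (lookup χ v))) e))
                   (ι-cong (character-recolour I χ e))) ⟩
            ι (κ ℚ.* signWeight d I) * ι (character I (E χ))
              ≈⟨ sym (ι-* _ _) ⟩
            ι (κ ℚ.* signWeight d I ℚ.* character I (E χ))
              ≈⟨ ι-cong (ℚ.*-assoc κ (signWeight d I) (character I (E χ))) ⟩
            ι (κ ℚ.* (signWeight d I ℚ.* character I (E χ))) ∎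
          perColouring : ∀ χ → sumℚ (smallSets k (d / 2)) (λ I → κ ℚ.* (signWeight d I ℚ.* character I (E χ)))
                             ≡ κ ℚ.* scale {k} d (d / 2) ℚ.* ⟦ rainbow e χ ⟧
          perColouring χ = ≡.trans (sumℚ-*ˡ κ (smallSets k (d / 2)) _)
            (≡.trans (cong (κ ℚ.*_) (∑-signWeight d (E χ) (sum-E χ)))
              (≡.sym (ℚ.*-assoc κ (scale {k} d (d / 2)) ⟦ rainbow e χ ⟧)))

        coeff-ZeroOne : ∀ {e} → ZeroOne d e → coeff (powerSum d forms) e ≈ ι (⟦ d ℕ.! ⟧ ℚ.* (κ ℚ.* scale {k} d (d / 2) ℚ.* ⟦ ∑ ψ (rainbow e) ⟧))
        coeff-ZeroOne {e} b = trans (coeff-forms e) (trans (×-congʳ (multinomial d e) (sum-eval e (ZeroOne⇒deg b)))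
          (trans (ι-× (multinomial d e) _) (ι-cong (cong (λ m → ⟦ m ⟧ ℚ.* (κ ℚ.* scale {k} d (d / 2) ℚ.* ⟦ ∑ ψ (rainbow e) ⟧)) (multinomial≡! b)))))

        -- In a degree other than d the multinomial coefficient is 0. In degree d some exponent is
        -- at least 2, and then no colouring makes the monomial squarefree.
        coeff-¬ZeroOne : ∀ e → ¬ ZeroOne d e → coeff (powerSum d forms) e ≈ 0#
        coeff-¬ZeroOne e ¬b with Vec.sum e ℕ.≟ d
        ... | no  sum≢d = trans (coeff-forms e) (reflexive (cong (_×ᴿ sumᴿ forms (λ f → eval f e)) (multinomial≡0 d e sum≢d)))
        ... | yes sum≡d = trans (coeff-forms e) (trans (×-congʳ (multinomial d e) (trans (sum-eval e sum≡d)
            (ι-cong (≡.trans (cong (λ x → κ ℚ.* scale {k} d (d / 2) ℚ.* ⟦ x ⟧) ∑≡0′) (ℚ.*-zeroʳ (κ ℚ.* scale {k} d (d / 2)))))))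
          (trans (ι-× (multinomial d e) 0ℚ) (trans (ι-cong (ℚ.*-zeroʳ ⟦ multinomial d e ⟧)) ι-0)))
          where
          sf≡0 : squarefree e ≡ 0
          sf≡0 with squarefree-01 e
          ... | inj₁ eq = eq
          ... | inj₂ eq = contradiction (subst (λ m → ZeroOne m e) sum≡d (squarefree⇒ZeroOne e eq)) ¬b
          ∑≡0′ : ∑ ψ (rainbow e) ≡ 0
          ∑≡0′ = ≡.trans (Colourings.∑-cong ψ λ χ → ¬squarefree⇒recolour (replicate k 0) χ e sf≡0)
            (≡.trans (∑-const ψ 0) (ℕ.*-zeroʳ (length ψ)))

-- The commutative rings of real and complex numbers

module ComplexNumbers where

  open import Defs
  open Rationals
  open import Algebra.Bundles using (CommutativeRing; CommutativeSemiring)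
  open import Algebra.Structures using (IsCommutativeRing)
  open import Data.Nat.Base as ℕ using (ℕ)
  import Data.Nat.Properties as ℕ
  open import Data.Product.Base using (∃; _×_; _,_)
  open import Data.Rational.Base as ℚ using (ℚ; 0ℚ; 1ℚ; ½; ∣_∣)
  import Data.Rational.Properties as ℚ
  open import Data.Rational.Solver using (module +-*-Solver)
  open import Level using (0ℓ)
  open import Relation.Binary.PropositionalEquality
  open import Relation.Binary.Structures using (IsEquivalence)
  open +-*-Solver using (solve; _:=_; _:+_; _:*_; _:-_; :-_; con)

  Eventually-map₂ : ∀ {P Q R : ℕ → Set} → (∀ {m} → P m → Q m → R m) → Eventually P → Eventually Q → Eventually R
  Eventually-map₂ f (M , p) (N , q) = M ℕ.⊔ N , λ m le →
    f (p m (ℕ.m⊔n≤o⇒m≤o M N le)) (q m (ℕ.m⊔n≤o⇒n≤o M N le))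

  -- `x ≃ y` unfolds to `Null` of the termwise difference, so congruence of the operations reduces
  -- to closure properties of null sequences.
  Null : (ℕ → ℚ) → Set
  Null s = ∀ δ → 0ℚ ℚ.< δ → Eventually λ m → ∣ s m ∣ ℚ.< δ

  Null-cong : ∀ {s t} → (∀ m → s m ≡ t m) → Null s → Null t
  Null-cong eq null δ 0<δ with null δ 0<δ
  ... | N , h = N , λ m N≤m → subst (λ x → ∣ x ∣ ℚ.< δ) (eq m) (h m N≤m)

  Null-0 : ∀ {s} → (∀ m → s m ≡ 0ℚ) → Null s
  Null-0 eq δ 0<δ = 0 , λ m _ → subst (λ x → ∣ x ∣ ℚ.< δ) (sym (eq m)) 0<δ

  Null-+ : ∀ {s t} → Null s → Null t → Null (λ m → s m ℚ.+ t m)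
  Null-+ {s} {t} ns nt δ 0<δ = Eventually-map₂ add (ns (½ ℚ.* δ) 0<½δ) (nt (½ ℚ.* δ) 0<½δ)
    where
    0<½δ : 0ℚ ℚ.< ½ ℚ.* δ
    0<½δ = pos-* (ℚ.positive⁻¹ ½) 0<δ
    add : ∀ {m} → ∣ s m ∣ ℚ.< ½ ℚ.* δ → ∣ t m ∣ ℚ.< ½ ℚ.* δ → ∣ s m ℚ.+ t m ∣ ℚ.< δ
    add {m} hs ht = ℚ.≤-<-trans (ℚ.∣p+q∣≤∣p∣+∣q∣ (s m) (t m))
      (subst (∣ s m ∣ ℚ.+ ∣ t m ∣ ℚ.<_) (solve 1 (λ δ → con ½ :* δ :+ con ½ :* δ := δ) refl δ) (ℚ.+-mono-< hs ht))

  Null-neg : ∀ {s} → Null s → Null (λ m → ℚ.- s m)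
  Null-neg {s} ns δ 0<δ with ns δ 0<δ
  ... | N , h = N , λ m N≤m → subst (ℚ._< δ) (sym (ℚ.∣-p∣≡∣p∣ (s m))) (h m N≤m)

  Bounded : (ℕ → ℚ) → Set
  Bounded s = ∃ λ K → 0ℚ ℚ.< K × Eventually λ m → ∣ s m ∣ ℚ.≤ K

  bounded : ∀ x → Bounded (seq x)
  bounded x with cauchy x 1ℚ (ℚ.positive⁻¹ 1ℚ)
  ... | N , h = ∣ seq x N ∣ ℚ.+ 1ℚ
              , ℚ.+-mono-≤-< (ℚ.0≤∣p∣ (seq x N)) (ℚ.positive⁻¹ 1ℚ)
              , N , λ m N≤m → ℚ.≤-trans
                  (ℚ.≤-reflexive (cong ∣_∣ (solve 2 (λ a b → a := b :+ (a :- b)) refl (seq x m) (seq x N))))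
                  (ℚ.≤-trans (ℚ.∣p+q∣≤∣p∣+∣q∣ (seq x N) _)
                    (ℚ.+-monoʳ-≤ ∣ seq x N ∣ (ℚ.<⇒≤ (h m N N≤m ℕ.≤-refl))))

  Null-* : ∀ {s t} → Bounded s → Null t → Null (λ m → s m ℚ.* t m)
  Null-* {s} {t} (K , 0<K , bs) nt δ 0<δ = Eventually-map₂ mul bs (nt (δ ℚ.* K⁻¹) (pos-* 0<δ 0<K⁻¹))
    where
    K⁻¹ = inv K 0<K
    0<K⁻¹ = inv-pos K 0<K
    mul : ∀ {m} → ∣ s m ∣ ℚ.≤ K → ∣ t m ∣ ℚ.< δ ℚ.* K⁻¹ → ∣ s m ℚ.* t m ∣ ℚ.< δ
    mul {m} hs ht = begin-strict
      ∣ s m ℚ.* t m ∣           ≡⟨ ℚ.∣p*q∣≡∣p∣*∣q∣ (s m) (t m) ⟩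
      ∣ s m ∣ ℚ.* ∣ t m ∣       ≤⟨ ℚ.*-monoʳ-≤-nonNeg ∣ t m ∣ {{ℚ.∣-∣-nonNeg (t m)}} hs ⟩
      K ℚ.* ∣ t m ∣             <⟨ ℚ.*-monoʳ-<-pos K {{ℚ.positive 0<K}} ht ⟩
      K ℚ.* (δ ℚ.* K⁻¹)         ≡⟨ solve 3 (λ K δ i → K :* (δ :* i) := δ :* (K :* i)) refl K δ K⁻¹ ⟩
      δ ℚ.* (K ℚ.* K⁻¹)         ≡⟨ cong (δ ℚ.*_) (*-inv K 0<K) ⟩
      δ ℚ.* 1ℚ                  ≡⟨ ℚ.*-identityʳ δ ⟩
      δ                         ∎
      where open ℚ.≤-Reasoning

  ≡⇒≃ : ∀ {x y} → (∀ m → seq x m ≡ seq y m) → x ≃ y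
  ≡⇒≃ {x} {y} eq = Null-0 λ m → trans (cong (ℚ._- seq y m) (eq m)) (ℚ.+-inverseʳ (seq y m))

  ≃-refl : ∀ {x} → x ≃ x
  ≃-refl {x} = ≡⇒≃ {x} {x} λ _ → refl

  ≃-sym : ∀ {x y} → x ≃ y → y ≃ x
  ≃-sym {x} {y} x≃y = Null-cong (λ m → solve 2 (λ a b → :- (a :- b) := b :- a) refl (seq x m) (seq y m)) (Null-neg x≃y)

  ≃-trans : ∀ {x y z} → x ≃ y → y ≃ z → x ≃ z
  ≃-trans {x} {y} {z} x≃y y≃z = Null-cong
    (λ m → solve 3 (λ a b c → (a :- b) :+ (b :- c) := a :- c) refl (seq x m) (seq y m) (seq z m)) (Null-+ x≃y y≃z)

  +-cong : ∀ {x x′ y y′} → x ≃ x′ → y ≃ y′ → x + y ≃ x′ + y′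
  +-cong {x} {x′} {y} {y′} p q = Null-cong
    (λ m → solve 4 (λ a b c d → (a :- b) :+ (c :- d) := (a :+ c) :- (b :+ d)) refl (seq x m) (seq x′ m) (seq y m) (seq y′ m))
    (Null-+ p q)

  neg-cong : ∀ {x x′} → x ≃ x′ → - x ≃ - x′
  neg-cong {x} {x′} p = Null-cong
    (λ m → solve 2 (λ a b → :- (a :- b) := (:- a) :- (:- b)) refl (seq x m) (seq x′ m)) (Null-neg p)

  *-cong : ∀ {x x′ y y′} → x ≃ x′ → y ≃ y′ → x * y ≃ x′ * y′
  *-cong {x} {x′} {y} {y′} p q = Null-cong
    (λ m → solve 4 (λ a b c d → a :* (c :- d) :+ d :* (a :- b) := a :* c :- b :* d) refl (seq x m) (seq x′ m) (seq y m) (seq y′ m))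
    (Null-+ (Null-* (bounded x) q) (Null-* (bounded y′) p))

  ≃-isEquivalence : IsEquivalence _≃_
  ≃-isEquivalence = record
    { refl  = λ {x} → ≃-refl {x}
    ; sym   = λ {x} {y} → ≃-sym {x} {y}
    ; trans = λ {x} {y} {z} → ≃-trans {x} {y} {z}
    }

  ℝ-isCommutativeRing : IsCommutativeRing _≃_ _+_ _*_ -_ 0ℝ 1ℝ
  ℝ-isCommutativeRing = record
    { isRing = record
      { +-isAbelianGroup = record
        { isGroup = record
          { isMonoid = record
            { isSemigroup = record
              { isMagma = record
                { isEquivalence = ≃-isEquivalence
                ; ∙-cong = λ {x} {x′} {y} {y′} → +-cong {x} {x′} {y} {y′} }
              ; assoc = λ x y z → ≡⇒≃ {x + y + z} {x + (y + z)} λ m → ℚ.+-assoc (seq x m) (seq y m) (seq z m) }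
            ; identity = (λ x → ≡⇒≃ {0ℝ + x} {x} λ m → ℚ.+-identityˡ (seq x m))
                       , (λ x → ≡⇒≃ {x + 0ℝ} {x} λ m → ℚ.+-identityʳ (seq x m)) }
          ; inverse = (λ x → ≡⇒≃ {(- x) + x} {0ℝ} λ m → ℚ.+-inverseˡ (seq x m))
                    , (λ x → ≡⇒≃ {x + (- x)} {0ℝ} λ m → ℚ.+-inverseʳ (seq x m))
          ; ⁻¹-cong = λ {x} {x′} → neg-cong {x} {x′} }
        ; comm = λ x y → ≡⇒≃ {x + y} {y + x} λ m → ℚ.+-comm (seq x m) (seq y m) }
      ; *-cong = λ {x} {x′} {y} {y′} → *-cong {x} {x′} {y} {y′}
      ; *-assoc = λ x y z → ≡⇒≃ {x * y * z} {x * (y * z)} λ m → ℚ.*-assoc (seq x m) (seq y m) (seq z m)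
      ; *-identity = (λ x → ≡⇒≃ {1ℝ * x} {x} λ m → ℚ.*-identityˡ (seq x m))
                   , (λ x → ≡⇒≃ {x * 1ℝ} {x} λ m → ℚ.*-identityʳ (seq x m))
      ; distrib = (λ x y z → ≡⇒≃ {x * (y + z)} {x * y + x * z} λ m → ℚ.*-distribˡ-+ (seq x m) (seq y m) (seq z m))
                , (λ x y z → ≡⇒≃ {(y + z) * x} {y * x + z * x} λ m → ℚ.*-distribʳ-+ (seq x m) (seq y m) (seq z m))
      }
    ; *-comm = λ x y → ≡⇒≃ {x * y} {y * x} λ m → ℚ.*-comm (seq x m) (seq y m)
    }

  ℝ-commutativeRing : CommutativeRing 0ℓ 0ℓ
  ℝ-commutativeRing = record { isCommutativeRing = ℝ-isCommutativeRing }

  open import Algebra.Bundles.Raw using (RawRing)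
  open RawRing ℂ-rawRing using () renaming
    (_≈_ to _≈ᶜ_; _+_ to _+ᶜ_; _*_ to _*ᶜ_; -_ to -ᶜ_; 0# to 0ᶜ; 1# to 1ᶜ) public

  ≡⇒≈ᶜ : ∀ {z w} → (∀ m → seq (re z) m ≡ seq (re w) m) → (∀ m → seq (im z) m ≡ seq (im w) m) → z ≈ᶜ w
  ≡⇒≈ᶜ {z} {w} p q = ≡⇒≃ {re z} {re w} p , ≡⇒≃ {im z} {im w} q

  ≈ᶜ-isEquivalence : IsEquivalence _≈ᶜ_
  ≈ᶜ-isEquivalence = record
    { refl  = λ {z} → ≃-refl {re z} , ≃-refl {im z}
    ; sym   = λ {z} {w} (p , q) → ≃-sym {re z} {re w} p , ≃-sym {im z} {im w} q
    ; trans = λ {z} {w} {v} (p , q) (p′ , q′) → ≃-trans {re z} {re w} {re v} p p′ , ≃-trans {im z} {im w} {im v} q q′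
    }

  *ᶜ-cong : ∀ {z z′ w w′} → z ≈ᶜ z′ → w ≈ᶜ w′ → z *ᶜ w ≈ᶜ z′ *ᶜ w′
  *ᶜ-cong {z} {z′} {w} {w′} (p , q) (p′ , q′) =
      +-cong {re z * re w} {re z′ * re w′} { - (im z * im w)} { - (im z′ * im w′)}
        (*-cong {re z} {re z′} {re w} {re w′} p p′)
        (neg-cong {im z * im w} {im z′ * im w′} (*-cong {im z} {im z′} {im w} {im w′} q q′))
    , +-cong {re z * im w} {re z′ * im w′} {im z * re w} {im z′ * re w′}
        (*-cong {re z} {re z′} {im w} {im w′} p q′) (*-cong {im z} {im z′} {re w} {re w′} q p′)

  ℂ-isCommutativeRing : IsCommutativeRing _≈ᶜ_ _+ᶜ_ _*ᶜ_ -ᶜ_ 0ᶜ 1ᶜ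
  ℂ-isCommutativeRing = record
    { isRing = record
      { +-isAbelianGroup = record
        { isGroup = record
          { isMonoid = record
            { isSemigroup = record
              { isMagma = record
                { isEquivalence = ≈ᶜ-isEquivalence
                ; ∙-cong = λ {z} {z′} {w} {w′} (p , q) (p′ , q′) →
                    +-cong {re z} {re z′} {re w} {re w′} p p′ , +-cong {im z} {im z′} {im w} {im w′} q q′ }
              ; assoc = λ z w v → ≡⇒≈ᶜ {z +ᶜ w +ᶜ v} {z +ᶜ (w +ᶜ v)}
                  (λ m → ℚ.+-assoc (seq (re z) m) (seq (re w) m) (seq (re v) m))
                  (λ m → ℚ.+-assoc (seq (im z) m) (seq (im w) m) (seq (im v) m)) }
            ; identity = (λ z → ≡⇒≈ᶜ {0ᶜ +ᶜ z} {z} (λ m → ℚ.+-identityˡ (seq (re z) m)) (λ m → ℚ.+-identityˡ (seq (im z) m)))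
                       , (λ z → ≡⇒≈ᶜ {z +ᶜ 0ᶜ} {z} (λ m → ℚ.+-identityʳ (seq (re z) m)) (λ m → ℚ.+-identityʳ (seq (im z) m))) }
          ; inverse = (λ z → ≡⇒≈ᶜ {(-ᶜ z) +ᶜ z} {0ᶜ} (λ m → ℚ.+-inverseˡ (seq (re z) m)) (λ m → ℚ.+-inverseˡ (seq (im z) m)))
                    , (λ z → ≡⇒≈ᶜ {z +ᶜ (-ᶜ z)} {0ᶜ} (λ m → ℚ.+-inverseʳ (seq (re z) m)) (λ m → ℚ.+-inverseʳ (seq (im z) m)))
          ; ⁻¹-cong = λ {z} {w} (p , q) → neg-cong {re z} {re w} p , neg-cong {im z} {im w} q }
        ; comm = λ z w → ≡⇒≈ᶜ {z +ᶜ w} {w +ᶜ z} (λ m → ℚ.+-comm (seq (re z) m) (seq (re w) m)) (λ m → ℚ.+-comm (seq (im z) m) (seq (im w) m)) }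
      ; *-cong = λ {z} {z′} {w} {w′} → *ᶜ-cong {z} {z′} {w} {w′}
      ; *-assoc = λ z w v → ≡⇒≈ᶜ {z *ᶜ w *ᶜ v} {z *ᶜ (w *ᶜ v)}
          (λ m → solve 6 (λ a b c d e f → (a :* c :- b :* d) :* e :- (a :* d :+ b :* c) :* f
                                        := a :* (c :* e :- d :* f) :- b :* (c :* f :+ d :* e)) refl
            (seq (re z) m) (seq (im z) m) (seq (re w) m) (seq (im w) m) (seq (re v) m) (seq (im v) m))
          (λ m → solve 6 (λ a b c d e f → (a :* c :- b :* d) :* f :+ (a :* d :+ b :* c) :* e
                                        := a :* (c :* f :+ d :* e) :+ b :* (c :* e :- d :* f)) refl
            (seq (re z) m) (seq (im z) m) (seq (re w) m) (seq (im w) m) (seq (re v) m) (seq (im v) m))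
      ; *-identity =
          (λ z → ≡⇒≈ᶜ {1ᶜ *ᶜ z} {z}
            (λ m → solve 2 (λ a b → con 1ℚ :* a :- con 0ℚ :* b := a) refl (seq (re z) m) (seq (im z) m))
            (λ m → solve 2 (λ a b → con 1ℚ :* b :+ con 0ℚ :* a := b) refl (seq (re z) m) (seq (im z) m)))
        , (λ z → ≡⇒≈ᶜ {z *ᶜ 1ᶜ} {z}
            (λ m → solve 2 (λ a b → a :* con 1ℚ :- b :* con 0ℚ := a) refl (seq (re z) m) (seq (im z) m))
            (λ m → solve 2 (λ a b → a :* con 0ℚ :+ b :* con 1ℚ := b) refl (seq (re z) m) (seq (im z) m)))
      ; distrib =
          (λ z w v → ≡⇒≈ᶜ {z *ᶜ (w +ᶜ v)} {z *ᶜ w +ᶜ z *ᶜ v}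
            (λ m → solve 6 (λ a b c d e f → a :* (c :+ e) :- b :* (d :+ f) := (a :* c :- b :* d) :+ (a :* e :- b :* f)) refl
              (seq (re z) m) (seq (im z) m) (seq (re w) m) (seq (im w) m) (seq (re v) m) (seq (im v) m))
            (λ m → solve 6 (λ a b c d e f → a :* (d :+ f) :+ b :* (c :+ e) := (a :* d :+ b :* c) :+ (a :* f :+ b :* e)) refl
              (seq (re z) m) (seq (im z) m) (seq (re w) m) (seq (im w) m) (seq (re v) m) (seq (im v) m)))
        , (λ z w v → ≡⇒≈ᶜ {(w +ᶜ v) *ᶜ z} {w *ᶜ z +ᶜ v *ᶜ z}
            (λ m → solve 6 (λ a b c d e f → (c :+ e) :* a :- (d :+ f) :* b := (c :* a :- d :* b) :+ (e :* a :- f :* b)) refl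
              (seq (re z) m) (seq (im z) m) (seq (re w) m) (seq (im w) m) (seq (re v) m) (seq (im v) m))
            (λ m → solve 6 (λ a b c d e f → (c :+ e) :* b :+ (d :+ f) :* a := (c :* b :+ d :* a) :+ (e :* b :+ f :* a)) refl
              (seq (re z) m) (seq (im z) m) (seq (re w) m) (seq (im w) m) (seq (re v) m) (seq (im v) m)))
      }
    ; *-comm = λ z w → ≡⇒≈ᶜ {z *ᶜ w} {w *ᶜ z}
        (λ m → solve 4 (λ a b c d → a :* c :- b :* d := c :* a :- d :* b) refl
          (seq (re z) m) (seq (im z) m) (seq (re w) m) (seq (im w) m))
        (λ m → solve 4 (λ a b c d → a :* d :+ b :* c := c :* b :+ d :* a) refl
          (seq (re z) m) (seq (im z) m) (seq (re w) m) (seq (im w) m))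
    }

  ℂ-commutativeRing : CommutativeRing 0ℓ 0ℓ
  ℂ-commutativeRing = record { isCommutativeRing = ℂ-isCommutativeRing }

  ℂ-commutativeSemiring : CommutativeSemiring 0ℓ 0ℓ
  ℂ-commutativeSemiring = CommutativeRing.commutativeSemiring ℂ-commutativeRing

  ℝ-commutativeSemiring : CommutativeSemiring 0ℓ 0ℓ
  ℝ-commutativeSemiring = CommutativeRing.commutativeSemiring ℝ-commutativeRing

-- Rational numbers as sums of two d-th powers

module Roots where

  open import Defs
  open Rationals
  open ComplexNumbers
  import Algebra.Definitions.RawSemiring as RawSemiringDefs
  import Algebra.Properties.Semiring.Exp as SExp
  open import Algebra.Bundles using (CommutativeRing; CommutativeSemiring)
  open Characters using (ℚ-commutativeSemiring)
  open Polynomials using (module Powers)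
  open PowerSums using (module SumOfPowers)
  open SumOfPowers ℂ-commutativeSemiring using () renaming (sumᴿ to sumᶜ)
  open import Data.Integer.Base as ℤ using (ℤ; +_; -[1+_])
  import Data.Integer.Properties as ℤ
  import Data.Integer.Tactic.RingSolver as ℤ
  open import Data.List.Base using ([]; _∷_; length)
  open import Data.Nat.Base as ℕ using (ℕ; zero; suc)
  import Data.Nat.Properties as ℕ
  import Data.Nat.Tactic.RingSolver as ℕ
  open import Data.Product.Base using (∃; _×_; _,_; proj₁; proj₂)
  open import Data.Rational.Base as ℚ using (ℚ; 0ℚ; 1ℚ; ∣_∣)
  import Data.Rational.Properties as ℚ
  open import Data.Rational.Solver using (module +-*-Solver)
  open import Data.Sum.Base using (inj₁; inj₂)
  open import Relation.Binary.PropositionalEquality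
  open import Relation.Nullary using (¬_; Dec; yes; no; contradiction)
  open +-*-Solver using (solve; _:=_; _:+_; _:*_; _:-_; :-_; con)
  open RawSemiringDefs (CommutativeSemiring.rawSemiring ℚ-commutativeSemiring) using () renaming (_^_ to _^ℚ_)
  open RawSemiringDefs ℂ-rawSemiring using () renaming (_^_ to _^ᶜ_)

  seq-^ : ∀ x d m → seq (x ^ d) m ≡ seq x m ^ℚ d
  seq-^ x zero    m = refl
  seq-^ x (suc d) m = cong (seq x m ℚ.*_) (seq-^ x d m)

  0≤1 : 0ℚ ℚ.≤ 1ℚ
  0≤1 = 0≤⟦⟧ 1

  ^-nonNeg : ∀ {p} d → 0ℚ ℚ.≤ p → 0ℚ ℚ.≤ p ^ℚ d
  ^-nonNeg zero    0≤p = 0≤1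
  ^-nonNeg (suc d) 0≤p = nonNeg-* 0≤p (^-nonNeg d 0≤p)

  ^-mono-≤ : ∀ {p q} d → 0ℚ ℚ.≤ p → p ℚ.≤ q → p ^ℚ d ℚ.≤ q ^ℚ d
  ^-mono-≤ zero    0≤p p≤q = ℚ.≤-refl
  ^-mono-≤ (suc d) 0≤p p≤q = *-mono-≤ 0≤p (^-nonNeg d 0≤p) p≤q (^-mono-≤ d 0≤p p≤q)

  1≤^ : ∀ {p} d → 1ℚ ℚ.≤ p → 1ℚ ℚ.≤ p ^ℚ d
  1≤^ zero    1≤p = ℚ.≤-refl
  1≤^ {p} (suc d) 1≤p = ℚ.≤-trans (ℚ.≤-reflexive (sym (ℚ.*-identityˡ 1ℚ))) (*-mono-≤ 0≤1 0≤1 1≤p (1≤^ d 1≤p))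

  ∣-∣-< : ∀ {p q δ} → p ℚ.< q ℚ.+ δ → q ℚ.< p ℚ.+ δ → ∣ p ℚ.- q ∣ ℚ.< δ
  ∣-∣-< {p} {q} {δ} p<q+δ q<p+δ with ℚ.∣p∣≡p∨∣p∣≡-p (p ℚ.- q)
  ... | inj₁ eq = subst₂ ℚ._<_ (sym eq)
    (solve 2 (λ q δ → (q :+ δ) :- q := δ) refl q δ) (ℚ.+-monoˡ-< (ℚ.- q) p<q+δ)
  ... | inj₂ eq = subst₂ ℚ._<_
    (trans (solve 2 (λ p q → q :- p := :- (p :- q)) refl p q) (sym eq))
    (solve 2 (λ p δ → (p :+ δ) :- p := δ) refl p δ) (ℚ.+-monoˡ-< (ℚ.- p) q<p+δ)

  p≤∣p∣ : ∀ p → p ℚ.≤ ∣ p ∣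
  p≤∣p∣ p with ℚ.≤-total 0ℚ p
  ... | inj₁ 0≤p = ℚ.≤-reflexive (sym (ℚ.0≤p⇒∣p∣≡p 0≤p))
  ... | inj₂ p≤0 = ℚ.≤-trans p≤0 (ℚ.0≤∣p∣ p)

  squeeze : ∀ {a b q δ} → 0ℚ ℚ.< δ → a ℚ.≤ q → q ℚ.< b → ∣ b ℚ.- a ∣ ℚ.< δ → ∣ a ℚ.- q ∣ ℚ.< δ
  squeeze {a} {b} {q} {δ} 0<δ a≤q q<b b-a<δ = ∣-∣-<
    (ℚ.≤-<-trans a≤q (subst (ℚ._< q ℚ.+ δ) (ℚ.+-identityʳ q) (ℚ.+-monoʳ-< q 0<δ)))
    (ℚ.<-trans q<b (subst₂ ℚ._<_ (solve 2 (λ a b → (b :- a) :+ a := b) refl a b) (ℚ.+-comm δ a)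
      (ℚ.+-monoˡ-< a (ℚ.≤-<-trans (p≤∣p∣ (b ℚ.- a)) b-a<δ))))

  -- The m-th approximation is the d-th root of q rounded down to a multiple of 1/(m+1). Comparing
  -- rational powers is decidable, so the numerator can be searched for.
  module Root (d : ℕ) .{{d≢0 : ℕ.NonZero d}} (q : ℚ) (0≤q : 0ℚ ℚ.≤ q) where

    private
      frac : ℕ → ℕ → ℚ
      frac m a = ⟦ a ⟧ ℚ.* 1/suc m

      frac-suc : ∀ m a → frac m (suc a) ≡ frac m a ℚ.+ 1/suc m
      frac-suc m a = trans (cong (ℚ._* 1/suc m) (⟦⟧-+ 1 a))
        (solve 2 (λ a x → (con 1ℚ :+ a) :* x := a :* x :+ x) refl ⟦ a ⟧ (1/suc m))

      0≤frac : ∀ m a → 0ℚ ℚ.≤ frac m a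
      0≤frac m a = nonNeg-* (0≤⟦⟧ a) (ℚ.<⇒≤ (0<1/suc m))

      floor : ∀ m → ∃ λ a → frac m a ^ℚ d ℚ.≤ q × ¬ (frac m (suc a) ^ℚ d ℚ.≤ q)
      -- With numerator (c+1)(m+1) the fraction is c + 1, and (c+1)^d ≥ c + 1 > q because d is
      -- nonzero; this bounds the search.
      floor m = search (λ a → frac m a ^ℚ d ℚ.≤? q) P0 (suc c ℕ.* suc m) ¬PB
        where
        c = proj₁ (upperBound q)
        P0 : frac m 0 ^ℚ d ℚ.≤ q
        P0 = subst (λ x → x ^ℚ d ℚ.≤ q) (sym (ℚ.*-zeroˡ (1/suc m))) (go d)
          where
          go : ∀ d .{{_ : ℕ.NonZero d}} → 0ℚ ^ℚ d ℚ.≤ q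
          go (suc d) = subst (ℚ._≤ q) (sym (ℚ.*-zeroˡ (0ℚ ^ℚ d))) 0≤q
        fracB : frac m (suc c ℕ.* suc m) ≡ ⟦ suc c ⟧
        fracB = begin
          ⟦ suc c ℕ.* suc m ⟧ ℚ.* 1/suc m          ≡⟨ cong (ℚ._* 1/suc m) (⟦⟧-* (suc c) (suc m)) ⟩
          ⟦ suc c ⟧ ℚ.* ⟦ suc m ⟧ ℚ.* 1/suc m      ≡⟨ ℚ.*-assoc ⟦ suc c ⟧ ⟦ suc m ⟧ (1/suc m) ⟩
          ⟦ suc c ⟧ ℚ.* (⟦ suc m ⟧ ℚ.* 1/suc m)    ≡⟨ cong (⟦ suc c ⟧ ℚ.*_) (*-inv ⟦ suc m ⟧ (0<⟦suc⟧ m)) ⟩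
          ⟦ suc c ⟧ ℚ.* 1ℚ                     ≡⟨ ℚ.*-identityʳ ⟦ suc c ⟧ ⟩
          ⟦ suc c ⟧                            ∎
          where open ≡-Reasoning
        large : ∀ d .{{_ : ℕ.NonZero d}} → q ℚ.< ⟦ suc c ⟧ ^ℚ d
        large (suc d) = begin-strict
          q                            <⟨ proj₂ (upperBound q) ⟩
          ⟦ c ⟧                        ≤⟨ ⟦⟧-mono-≤ (ℕ.n≤1+n c) ⟩
          ⟦ suc c ⟧                    ≡⟨ sym (ℚ.*-identityʳ ⟦ suc c ⟧) ⟩
          ⟦ suc c ⟧ ℚ.* 1ℚ
            ≤⟨ *-mono-≤ (0≤⟦⟧ (suc c)) 0≤1 ℚ.≤-refl (1≤^ d (⟦⟧-mono-≤ {1} {suc c} (ℕ.s≤s ℕ.z≤n))) ⟩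
          ⟦ suc c ⟧ ℚ.* ⟦ suc c ⟧ ^ℚ d ∎
          where open ℚ.≤-Reasoning
        ¬PB : ¬ (frac m (suc c ℕ.* suc m) ^ℚ d ℚ.≤ q)
        ¬PB le = ℚ.<-irrefl refl (ℚ.<-≤-trans (large d) (subst (λ x → x ^ℚ d ℚ.≤ q) fracB le))

      approx : ℕ → ℚ
      approx m = frac m (proj₁ (floor m))

      approx-^-≤ : ∀ m → approx m ^ℚ d ℚ.≤ q
      approx-^-≤ m = proj₁ (proj₂ (floor m))

      <-approx-^ : ∀ m → q ℚ.< (approx m ℚ.+ 1/suc m) ^ℚ d
      <-approx-^ m = ℚ.≰⇒> (subst (λ x → ¬ (x ^ℚ d ℚ.≤ q)) (frac-suc m (proj₁ (floor m))) (proj₂ (proj₂ (floor m))))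

      -- Otherwise approx j ≥ approx k + 1/(k+1), and by monotonicity its d-th power would exceed q.
      -- The Cauchy property thus follows without a modulus of continuity for the root.
      approx-< : ∀ j k {δ} → 1/suc k ℚ.< δ → approx j ℚ.< approx k ℚ.+ δ
      approx-< j k small = ℚ.<-trans (ℚ.≰⇒> λ ≤approx → ℚ.<-irrefl refl (ℚ.<-≤-trans (<-approx-^ k)
          (ℚ.≤-trans (^-mono-≤ d (ℚ.+-mono-≤ (0≤frac k (proj₁ (floor k))) (ℚ.<⇒≤ (0<1/suc k))) ≤approx) (approx-^-≤ j))))
        (ℚ.+-monoʳ-< (approx k) small)

    root : ℝ
    root = mkℝ approx λ δ 0<δ → proj₁ (1/suc-small δ 0<δ) , λ j k ≤j ≤k →
      ∣-∣-< (approx-< j k (proj₂ (1/suc-small δ 0<δ) k ≤k)) (approx-< k j (proj₂ (1/suc-small δ 0<δ) j ≤j))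

    private
      1/suc-< : ∀ j k {δ} → 1/suc j ℚ.< δ → 1/suc j ℚ.< 1/suc k ℚ.+ δ
      1/suc-< j k {δ} small = ℚ.<-trans small (subst (ℚ._< 1/suc k ℚ.+ δ) (ℚ.+-identityˡ δ) (ℚ.+-monoˡ-< δ (0<1/suc k)))

      ulp : ℝ
      ulp = mkℝ 1/suc λ δ 0<δ → proj₁ (1/suc-small δ 0<δ) , λ j k ≤j ≤k →
        ∣-∣-< (1/suc-< j k (proj₂ (1/suc-small δ 0<δ) j ≤j)) (1/suc-< k j (proj₂ (1/suc-small δ 0<δ) k ≤k))

      ulp≃0 : root + ulp ≃ root
      ulp≃0 δ 0<δ = proj₁ (1/suc-small δ 0<δ) , λ m ≤m → close (approx m) (1/suc m) (0<1/suc m) (proj₂ (1/suc-small δ 0<δ) m ≤m)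
        where
        close : ∀ a b → 0ℚ ℚ.< b → b ℚ.< δ → ∣ (a ℚ.+ b) ℚ.- a ∣ ℚ.< δ
        close a b 0<b b<δ = subst (ℚ._< δ) (sym (trans
          (cong ∣_∣ (solve 2 (λ a b → (a :+ b) :- a := b) refl a b)) (ℚ.0≤p⇒∣p∣≡p (ℚ.<⇒≤ 0<b)))) b<δ

      pinch : (root + ulp) ^ d ≃ root ^ d
      pinch = SExp.^-congˡ (CommutativeRing.semiring ℝ-commutativeRing) d {root + ulp} {root} ulp≃0

    -- root^d ≤ q < (root + ulp)^d termwise, and both ends are equal reals.
    root-^ : root ^ d ≃ fromℚ q
    root-^ δ 0<δ = proj₁ (pinch δ 0<δ) , λ m N≤m → squeeze 0<δ
      (subst (ℚ._≤ q) (sym (seq-^ root d m)) (approx-^-≤ m))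
      (subst (q ℚ.<_) (sym (seq-^ (root + ulp) d m)) (<-approx-^ m))
      (proj₂ (pinch δ 0<δ) m N≤m)

  abstract
    real-root : ∀ d .{{_ : ℕ.NonZero d}} q → 0ℚ ℚ.≤ q → ∃ λ r → r ^ d ≃ fromℚ q
    real-root d q 0≤q = Root.root d q 0≤q , Root.root-^ d q 0≤q

  -- Gaussian integers

  ℤ[i] : Set
  ℤ[i] = ℤ × ℤ

  infixl 7 _∙_
  _∙_ : ℤ[i] → ℤ[i] → ℤ[i]
  (a , b) ∙ (c , e) = (a ℤ.* c ℤ.- b ℤ.* e) , (a ℤ.* e ℤ.+ b ℤ.* c)

  conj : ℤ[i] → ℤ[i]
  conj (a , b) = a , ℤ.- b

  pow : ℤ[i] → ℕ → ℤ[i]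
  pow z zero    = + 1 , + 0
  pow z (suc d) = z ∙ pow z d

  pow-∙ : ∀ z w d → pow (z ∙ w) d ≡ pow z d ∙ pow w d
  pow-∙ z w zero    = refl
  pow-∙ z@(a , b) w@(c , e) (suc d) = trans (cong ((z ∙ w) ∙_) (pow-∙ z w d))
    (cong₂ _,_ (lem₁ a b c e (proj₁ (pow z d)) (proj₂ (pow z d)) (proj₁ (pow w d)) (proj₂ (pow w d)))
               (lem₂ a b c e (proj₁ (pow z d)) (proj₂ (pow z d)) (proj₁ (pow w d)) (proj₂ (pow w d))))
    where
    lem₁ : ∀ a b c e x y p q →
      (a ℤ.* c ℤ.- b ℤ.* e) ℤ.* (x ℤ.* p ℤ.- y ℤ.* q) ℤ.- (a ℤ.* e ℤ.+ b ℤ.* c) ℤ.* (x ℤ.* q ℤ.+ y ℤ.* p)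
      ≡ (a ℤ.* x ℤ.- b ℤ.* y) ℤ.* (c ℤ.* p ℤ.- e ℤ.* q) ℤ.- (a ℤ.* y ℤ.+ b ℤ.* x) ℤ.* (c ℤ.* q ℤ.+ e ℤ.* p)
    lem₁ = ℤ.solve-∀
    lem₂ : ∀ a b c e x y p q →
      (a ℤ.* c ℤ.- b ℤ.* e) ℤ.* (x ℤ.* q ℤ.+ y ℤ.* p) ℤ.+ (a ℤ.* e ℤ.+ b ℤ.* c) ℤ.* (x ℤ.* p ℤ.- y ℤ.* q)
      ≡ (a ℤ.* x ℤ.- b ℤ.* y) ℤ.* (c ℤ.* q ℤ.+ e ℤ.* p) ℤ.+ (a ℤ.* y ℤ.+ b ℤ.* x) ℤ.* (c ℤ.* p ℤ.- e ℤ.* q)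
    lem₂ = ℤ.solve-∀

  pow-conj : ∀ z d → pow (conj z) d ≡ conj (pow z d)
  pow-conj z zero    = refl
  pow-conj z@(a , b) (suc d) = trans (cong (conj z ∙_) (pow-conj z d))
    (cong₂ _,_ (lem₁ a b (proj₁ (pow z d)) (proj₂ (pow z d))) (lem₂ a b (proj₁ (pow z d)) (proj₂ (pow z d))))
    where
    lem₁ : ∀ a b x y → a ℤ.* x ℤ.- (ℤ.- b) ℤ.* (ℤ.- y) ≡ a ℤ.* x ℤ.- b ℤ.* y
    lem₁ = ℤ.solve-∀
    lem₂ : ∀ a b x y → a ℤ.* (ℤ.- y) ℤ.+ (ℤ.- b) ℤ.* x ≡ ℤ.- (a ℤ.* y ℤ.+ b ℤ.* x)
    lem₂ = ℤ.solve-∀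

  -- (3 + 4i)² ≡ 3 + 4i modulo 5, so no power of 3 + 4i is real.
  pow[3+4i] : ∀ d → ∃ λ x → ∃ λ y → pow (+ 3 , + 4) (suc d) ≡ (+ 3 ℤ.+ + 5 ℤ.* x , + 4 ℤ.+ + 5 ℤ.* y)
  pow[3+4i] zero    = + 0 , + 0 , refl
  pow[3+4i] (suc d) with pow[3+4i] d
  ... | x , y , eq = ℤ.- + 2 ℤ.+ + 3 ℤ.* x ℤ.- + 4 ℤ.* y , + 4 ℤ.+ + 4 ℤ.* x ℤ.+ + 3 ℤ.* y
                   , trans (cong ((+ 3 , + 4) ∙_) eq) (cong₂ _,_ (lem₁ x y) (lem₂ x y))
    where
    lem₁ : ∀ x y → + 3 ℤ.* (+ 3 ℤ.+ + 5 ℤ.* x) ℤ.- + 4 ℤ.* (+ 4 ℤ.+ + 5 ℤ.* y)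
                   ≡ + 3 ℤ.+ + 5 ℤ.* (ℤ.- + 2 ℤ.+ + 3 ℤ.* x ℤ.- + 4 ℤ.* y)
    lem₁ = ℤ.solve-∀
    lem₂ : ∀ x y → + 3 ℤ.* (+ 4 ℤ.+ + 5 ℤ.* y) ℤ.+ + 4 ℤ.* (+ 3 ℤ.+ + 5 ℤ.* x)
                   ≡ + 4 ℤ.+ + 5 ℤ.* (+ 4 ℤ.+ + 4 ℤ.* x ℤ.+ + 3 ℤ.* y)
    lem₂ = ℤ.solve-∀

  0<∣4+5y∣ : ∀ y → 0 ℕ.< ℤ.∣ + 4 ℤ.+ + 5 ℤ.* y ∣
  0<∣4+5y∣ y = ℕ.n≢0⇒n>0 λ ∣∣≡0 → 5n≢4 ℤ.∣ y ∣ (trans (sym (ℤ.abs-* (+ 5) y))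
      (cong ℤ.∣_∣ (trans (lem y) (cong (ℤ._- (+ 4)) (ℤ.∣i∣≡0⇒i≡0 {+ 4 ℤ.+ + 5 ℤ.* y} ∣∣≡0)))))
    where
    lem : ∀ y → + 5 ℤ.* y ≡ + 4 ℤ.+ + 5 ℤ.* y ℤ.- + 4
    lem = ℤ.solve-∀
    5n≢4 : ∀ n → 5 ℕ.* n ≢ 4
    5n≢4 zero    ()
    5n≢4 (suc n) eq = ℕ.<-irrefl (sym eq) (ℕ.≤-trans (ℕ.m≤m+n 5 (5 ℕ.* n)) (ℕ.≤-reflexive (sym (ℕ.*-suc 5 n))))

  Re Im : ℤ[i] → ℤ
  Re = proj₁
  Im = proj₂

  n<4^n : ∀ n → n ℕ.< 4 ℕ.^ n
  n<4^n zero    = ℕ.s≤s ℕ.z≤n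
  n<4^n (suc n) = ℕ.≤-trans (ℕ.+-mono-≤ (ℕ.≤-trans (ℕ.s≤s ℕ.z≤n) (n<4^n n)) (n<4^n n))
    (ℕ.+-monoʳ-≤ (4 ℕ.^ n) (ℕ.m≤m+n (4 ℕ.^ n) _))

  Re-square : ∀ a b → a ℤ.* a ℤ.- b ℤ.* b ≡ (ℤ.∣ a ∣ ℕ.* ℤ.∣ a ∣) ℤ.⊖ (ℤ.∣ b ∣ ℕ.* ℤ.∣ b ∣)
  Re-square a b = trans (cong₂ ℤ._-_ (sq a) (sq b)) (ℤ.m-n≡m⊖n (ℤ.∣ a ∣ ℕ.* ℤ.∣ a ∣) (ℤ.∣ b ∣ ℕ.* ℤ.∣ b ∣))
    where
    sq : ∀ a → a ℤ.* a ≡ + (ℤ.∣ a ∣ ℕ.* ℤ.∣ a ∣)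
    sq (+ n)     = sym (ℤ.pos-* n n)
    sq -[1+ n ]  = refl

  ∣Im-square∣ : ∀ a b → ℤ.∣ a ℤ.* b ℤ.+ b ℤ.* a ∣ ≡ 2 ℕ.* (ℤ.∣ a ∣ ℕ.* ℤ.∣ b ∣)
  ∣Im-square∣ a b = trans (cong ℤ.∣_∣ (lem a b)) (trans (ℤ.abs-* (+ 2) (a ℤ.* b)) (cong (2 ℕ.*_) (ℤ.abs-* a b)))
    where
    lem : ∀ a b → a ℤ.* b ℤ.+ b ℤ.* a ≡ + 2 ℤ.* (a ℤ.* b)
    lem = ℤ.solve-∀

  -- Squaring doubles the argument: it at least halves |Re / Im| as long as the
  -- real part stays nonnegative.
  squarings : ∀ k (z w : ℤ[i]) d → pow w d ≡ z → 0 ℕ.< ℤ.∣ Im z ∣ →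
    ℤ.∣ Re z ∣ ℕ.* ℤ.∣ Re z ∣ ℕ.< 4 ℕ.^ k ℕ.* (ℤ.∣ Im z ∣ ℕ.* ℤ.∣ Im z ∣) →
    ∃ λ w′ → Re (pow w′ d) ℤ.< + 0
  squarings k z@(a , b) w d eq 0<β lt with ℤ.∣ a ∣ ℕ.* ℤ.∣ a ∣ ℕ.<? ℤ.∣ b ∣ ℕ.* ℤ.∣ b ∣
  -- Here |Re z| < |Im z|, so z² = (w²)^d has negative real part.
  ... | yes α²<β² = w ∙ w , subst (λ v → Re v ℤ.< + 0) (sym (trans (pow-∙ w w d) (cong (λ v → v ∙ v) eq)))
    (subst (ℤ._< + 0) (sym (Re-square a b)) (⊖<0 α²<β²))
    where
    ⊖<0 : ∀ {m n} → m ℕ.< n → m ℤ.⊖ n ℤ.< + 0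
    ⊖<0 {m} {n} m<n = subst (ℤ._< + 0) (sym (ℤ.⊖-< m<n)) (neg<0 (ℕ.m<n⇒0<n∸m m<n))
      where
      neg<0 : ∀ {n} → 0 ℕ.< n → ℤ.- (+ n) ℤ.< + 0
      neg<0 {suc n} _ = ℤ.-<+
  squarings zero    z@(a , b) w d eq 0<β lt | no α²≮β² = contradiction (subst (ℤ.∣ a ∣ ℕ.* ℤ.∣ a ∣ ℕ.<_) (ℕ.+-identityʳ _) lt) α²≮β²
  squarings (suc k) z@(a , b) w d eq 0<β lt | no α²≮β² =
    squarings k (z ∙ z) (w ∙ w) d (trans (pow-∙ w w d) (cong (λ v → v ∙ v) eq)) 0<β′ lt′
    where
    α = ℤ.∣ a ∣
    β = ℤ.∣ b ∣
    β²≤α² : β ℕ.* β ℕ.≤ α ℕ.* α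
    β²≤α² = ℕ.≮⇒≥ α²≮β²
    instance
      β≢0 : ℕ.NonZero β
      β≢0 = ℕ.>-nonZero 0<β
      α≢0 : ℕ.NonZero α
      α≢0 = nz (ℕ.≤-trans (ℕ.*-mono-≤ 0<β 0<β) β²≤α²)
        where
        nz : ∀ {n} → 0 ℕ.< n ℕ.* n → ℕ.NonZero n
        nz {suc n} _ = _
    0<β′ : 0 ℕ.< ℤ.∣ Im (z ∙ z) ∣
    0<β′ = subst (0 ℕ.<_) (sym (∣Im-square∣ a b)) (ℕ.>-nonZero⁻¹ (2 ℕ.* (α ℕ.* β)) {{ℕ.m*n≢0 2 (α ℕ.* β) {{_}} {{ℕ.m*n≢0 α β}}}})
    ∣Re∣ : ℤ.∣ Re (z ∙ z) ∣ ≡ α ℕ.* α ℕ.∸ β ℕ.* β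
    ∣Re∣ = trans (cong ℤ.∣_∣ (Re-square a b)) (cong ℤ.∣_∣ (ℤ.⊖-≥ β²≤α²))
    ∣Re∣< : ℤ.∣ Re (z ∙ z) ∣ ℕ.≤ α ℕ.* α
    ∣Re∣< = subst (ℕ._≤ α ℕ.* α) (sym ∣Re∣) (ℕ.m∸n≤m (α ℕ.* α) (β ℕ.* β))
    -- |Re z²| is at most α² and |Im z²| is 2 α β, so the squared ratio falls by a factor of at
    -- least 4 and one power of 4 is used up.
    lt′ : ℤ.∣ Re (z ∙ z) ∣ ℕ.* ℤ.∣ Re (z ∙ z) ∣ ℕ.< 4 ℕ.^ k ℕ.* (ℤ.∣ Im (z ∙ z) ∣ ℕ.* ℤ.∣ Im (z ∙ z) ∣)
    lt′ = begin-strict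
      ℤ.∣ Re (z ∙ z) ∣ ℕ.* ℤ.∣ Re (z ∙ z) ∣                   ≤⟨ ℕ.*-mono-≤ ∣Re∣< ∣Re∣< ⟩
      (α ℕ.* α) ℕ.* (α ℕ.* α)                                <⟨ ℕ.*-monoʳ-< (α ℕ.* α) {{ℕ.m*n≢0 α α}} lt ⟩
      (α ℕ.* α) ℕ.* (4 ℕ.* 4 ℕ.^ k ℕ.* (β ℕ.* β))            ≡⟨ lem α β (4 ℕ.^ k) ⟩
      4 ℕ.^ k ℕ.* ((2 ℕ.* (α ℕ.* β)) ℕ.* (2 ℕ.* (α ℕ.* β)))
        ≡⟨ cong (λ x → 4 ℕ.^ k ℕ.* (x ℕ.* x)) (sym (∣Im-square∣ a b)) ⟩
      4 ℕ.^ k ℕ.* (ℤ.∣ Im (z ∙ z) ∣ ℕ.* ℤ.∣ Im (z ∙ z) ∣)    ∎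
      where
      open ℕ.≤-Reasoning
      lem : ∀ α β p → (α ℕ.* α) ℕ.* (4 ℕ.* p ℕ.* (β ℕ.* β)) ≡ p ℕ.* ((2 ℕ.* (α ℕ.* β)) ℕ.* (2 ℕ.* (α ℕ.* β)))
      lem = ℕ.solve-∀

  n<4^n*m² : ∀ n {m} → 0 ℕ.< m → n ℕ.< 4 ℕ.^ n ℕ.* (m ℕ.* m)
  n<4^n*m² n {m} 0<m = ℕ.<-≤-trans (n<4^n n) (ℕ.m≤m*n (4 ℕ.^ n) (m ℕ.* m) {{ℕ.>-nonZero (ℕ.*-mono-≤ 0<m 0<m)}})

  abstract
    -- The number 3 + 4i is squared until its d-th power turns into the left half plane. With a the
    -- real part of the initial d-th power, a² rounds suffice, since a² < 4^(a²) and the imaginary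
    -- part is a nonzero integer.
    negative-power : ∀ d .{{_ : ℕ.NonZero d}} → ∃ λ w → Re (pow w d) ℤ.< + 0
    negative-power (suc d) with pow[3+4i] d
    ... | x , y , eq = squarings (ℤ.∣ + 3 ℤ.+ + 5 ℤ.* x ∣ ℕ.* ℤ.∣ + 3 ℤ.+ + 5 ℤ.* x ∣)
      (+ 3 ℤ.+ + 5 ℤ.* x , + 4 ℤ.+ + 5 ℤ.* y) (+ 3 , + 4) (suc d) eq (0<∣4+5y∣ y)
      (n<4^n*m² (ℤ.∣ + 3 ℤ.+ + 5 ℤ.* x ∣ ℕ.* ℤ.∣ + 3 ℤ.+ + 5 ℤ.* x ∣) (0<∣4+5y∣ y))

  ι : ℚ → ℂ
  ι q = ℝ⇒ℂ (fromℚ q)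

  ι-+ : ∀ p q → ι (p ℚ.+ q) ≈ᶜ ι p +ᶜ ι q
  ι-+ p q = ≡⇒≈ᶜ {ι (p ℚ.+ q)} {ι p +ᶜ ι q} (λ _ → refl) (λ _ → refl)

  ι-* : ∀ p q → ι (p ℚ.* q) ≈ᶜ ι p *ᶜ ι q
  ι-* p q = ≡⇒≈ᶜ {ι (p ℚ.* q)} {ι p *ᶜ ι q}
    (λ _ → solve 2 (λ p q → p :* q := p :* q :- con 0ℚ :* con 0ℚ) refl p q)
    (λ _ → solve 2 (λ p q → con 0ℚ := p :* con 0ℚ :+ con 0ℚ :* q) refl p q)

  γ : ℤ[i] → ℂ
  γ (a , b) = mkℂ (fromℚ ⟦ a ⟧ᶻ) (fromℚ ⟦ b ⟧ᶻ)

  γ-∙ : ∀ z w → γ (z ∙ w) ≈ᶜ γ z *ᶜ γ w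
  γ-∙ (a , b) (c , e) = ≡⇒≈ᶜ {γ ((a , b) ∙ (c , e))} {γ (a , b) *ᶜ γ (c , e)}
    (λ _ → trans (⟦⟧ᶻ-+ (a ℤ.* c) (ℤ.- (b ℤ.* e)))
      (cong₂ ℚ._+_ (⟦⟧ᶻ-* a c) (trans (⟦⟧ᶻ-neg (b ℤ.* e)) (cong ℚ.-_ (⟦⟧ᶻ-* b e)))))
    (λ _ → trans (⟦⟧ᶻ-+ (a ℤ.* e) (b ℤ.* c)) (cong₂ ℚ._+_ (⟦⟧ᶻ-* a e) (⟦⟧ᶻ-* b c)))

  private
    module ℂᴾ = Powers ℂ-commutativeSemiring

  γ-pow : ∀ z d → γ (pow z d) ≈ᶜ γ z ^ᶜ d
  γ-pow z zero    = ≡⇒≈ᶜ {γ (+ 1 , + 0)} {1ᶜ} (λ _ → refl) (λ _ → refl)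
  γ-pow z (suc d) = ℂᴾ.power-suc {γ z} {γ (pow z d)} {γ (z ∙ pow z d)} d (γ-∙ z (pow z d)) (γ-pow z d)

  γ+conj : ∀ z → γ z +ᶜ γ (conj z) ≈ᶜ ι (⟦ 2 ⟧ ℚ.* ⟦ Re z ⟧ᶻ)
  γ+conj z@(a , b) = ≡⇒≈ᶜ {γ z +ᶜ γ (conj z)} {ι (⟦ 2 ⟧ ℚ.* ⟦ a ⟧ᶻ)}
    (λ _ → solve 1 (λ a → a :+ a := (con 1ℚ :+ con 1ℚ) :* a) refl ⟦ a ⟧ᶻ)
    (λ _ → trans (cong (⟦ b ⟧ᶻ ℚ.+_) (⟦⟧ᶻ-neg b)) (ℚ.+-inverseʳ ⟦ b ⟧ᶻ))

  ℝ⇒ℂ-* : ∀ x y → ℝ⇒ℂ (x * y) ≈ᶜ ℝ⇒ℂ x *ᶜ ℝ⇒ℂ y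
  ℝ⇒ℂ-* x y = ≡⇒≈ᶜ {ℝ⇒ℂ (x * y)} {ℝ⇒ℂ x *ᶜ ℝ⇒ℂ y}
    (λ m → solve 2 (λ a b → a :* b := a :* b :- con 0ℚ :* con 0ℚ) refl (seq x m) (seq y m))
    (λ m → solve 2 (λ a b → con 0ℚ := a :* con 0ℚ :+ con 0ℚ :* b) refl (seq x m) (seq y m))

  ℝ⇒ℂ-^ : ∀ x d → ℝ⇒ℂ (x ^ d) ≈ᶜ ℝ⇒ℂ x ^ᶜ d
  ℝ⇒ℂ-^ x zero    = ≡⇒≈ᶜ {ℝ⇒ℂ 1ℝ} {1ᶜ} (λ _ → refl) (λ _ → refl)
  ℝ⇒ℂ-^ x (suc d) = ℂᴾ.power-suc {ℝ⇒ℂ x} {ℝ⇒ℂ (x ^ d)} {ℝ⇒ℂ (x * x ^ d)} d (ℝ⇒ℂ-* x (x ^ d)) (ℝ⇒ℂ-^ x d)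

  transᶜ : ∀ {z w v} → z ≈ᶜ w → w ≈ᶜ v → z ≈ᶜ v
  transᶜ {z} {w} {v} = CommutativeRing.trans ℂ-commutativeRing {z} {w} {v}

  nonNegative-root : ∀ d .{{_ : ℕ.NonZero d}} q → 0ℚ ℚ.≤ q → ∃ λ r → ι q ≈ᶜ ℝ⇒ℂ r ^ᶜ d
  nonNegative-root d q 0≤q with real-root d q 0≤q
  ... | r , r^d≃q = r , transᶜ {ι q} {ℝ⇒ℂ (r ^ d)} {ℝ⇒ℂ r ^ᶜ d} (≃-sym {r ^ d} {fromℚ q} r^d≃q , ≃-refl {0ℝ}) (ℝ⇒ℂ-^ r d)

  -- t = w/(2a) is a quotient of two negative numbers; the inverse is taken of the positive c = -2a.
  negative-coefficient : ∀ a w → a ℚ.< 0ℚ → w ℚ.< 0ℚ → ∃ λ t → 0ℚ ℚ.≤ t × t ℚ.* (⟦ 2 ⟧ ℚ.* a) ≡ w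
  negative-coefficient a w a<0 w<0 = inv c 0<c ℚ.* (ℚ.- w) ,
    nonNeg-* (ℚ.<⇒≤ (inv-pos c 0<c)) (ℚ.neg-antimono-≤ (ℚ.<⇒≤ w<0)) ,
    trans (solve 3 (λ i w x → i :* (:- w) :* x := w :* ((:- x) :* i)) refl (inv c 0<c) w (⟦ 2 ⟧ ℚ.* a))
      (trans (cong (w ℚ.*_) (*-inv c 0<c)) (ℚ.*-identityʳ w))
    where
    c = ℚ.- (⟦ 2 ⟧ ℚ.* a)
    0<c : 0ℚ ℚ.< c
    0<c = subst (0ℚ ℚ.<_) (solve 2 (λ t a → t :* (:- a) := :- (t :* a)) refl ⟦ 2 ⟧ a)
      (pos-* (0<⟦suc⟧ 1) (ℚ.neg-antimono-< a<0))

  two-powersᶜ : ∀ d r z {t w} → ι t ≈ᶜ ℝ⇒ℂ r ^ᶜ d → t ℚ.* (⟦ 2 ⟧ ℚ.* ⟦ Re (pow z d) ⟧ᶻ) ≡ w →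
    (ℝ⇒ℂ r *ᶜ γ z) ^ᶜ d +ᶜ ((ℝ⇒ℂ r *ᶜ γ (conj z)) ^ᶜ d +ᶜ 0ᶜ) ≈ᶜ ι w
  two-powersᶜ d r z {t} {w} r^d eq =
    ℂᴾ.two-powers {ℝ⇒ℂ r} {γ z} {γ (conj z)} {γ (pow z d)} {γ (conj (pow z d))} {ι t}
      {ι (⟦ 2 ⟧ ℚ.* ⟦ Re (pow z d) ⟧ᶻ)} {ι w} d r^d (γ-pow z d)
      (subst (λ v → γ v ≈ᶜ γ (conj z) ^ᶜ d) (pow-conj z d) (γ-pow (conj z) d)) (γ+conj (pow z d))
      (subst (λ v → ι v ≈ᶜ ι t *ᶜ ι (⟦ 2 ⟧ ℚ.* ⟦ Re (pow z d) ⟧ᶻ)) eq (ι-* t (⟦ 2 ⟧ ℚ.* ⟦ Re (pow z d) ⟧ᶻ)))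

  SumOfTwoPowers : ℕ → ℚ → Set
  SumOfTwoPowers d w = ∃ λ ρs → length ρs ℕ.≤ 2 × sumᶜ ρs (_^ᶜ d) ≈ᶜ ι w

  -- A negative w takes two d-th powers, those of r z and r z̄ with Re (z^d) < 0.
  sum-of-two-powers : ∀ d .{{_ : ℕ.NonZero d}} w → SumOfTwoPowers d w
  sum-of-two-powers d w = by-sign (0ℚ ℚ.≤? w)
    where
    nonNegative : (∃ λ r → ι w ≈ᶜ ℝ⇒ℂ r ^ᶜ d) → SumOfTwoPowers d w
    nonNegative (r , r^d) = ℝ⇒ℂ r ∷ [] , ℕ.s≤s ℕ.z≤n , ℂᴾ.one-power {ℝ⇒ℂ r} {ι w} d r^d
    negative : ∀ z t → t ℚ.* (⟦ 2 ⟧ ℚ.* ⟦ Re (pow z d) ⟧ᶻ) ≡ w → (∃ λ r → ι t ≈ᶜ ℝ⇒ℂ r ^ᶜ d) → SumOfTwoPowers d w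
    negative z t eq (r , r^d) =
      ℝ⇒ℂ r *ᶜ γ z ∷ ℝ⇒ℂ r *ᶜ γ (conj z) ∷ [] , ℕ.≤-refl , two-powersᶜ d r z {t} {w} r^d eq
    coefficient : ∀ z → (∃ λ t → 0ℚ ℚ.≤ t × t ℚ.* (⟦ 2 ⟧ ℚ.* ⟦ Re (pow z d) ⟧ᶻ) ≡ w) → SumOfTwoPowers d w
    coefficient z (t , 0≤t , eq) = negative z t eq (nonNegative-root d t 0≤t)
    direction : w ℚ.< 0ℚ → (∃ λ z → Re (pow z d) ℤ.< + 0) → SumOfTwoPowers d w
    direction w<0 (z , Re<0) = coefficient z (negative-coefficient ⟦ Re (pow z d) ⟧ᶻ w (⟦⟧ᶻ-mono-< Re<0) w<0)
    by-sign : Dec (0ℚ ℚ.≤ w) → SumOfTwoPowers d w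
    by-sign (yes 0≤w) = nonNegative (nonNegative-root d w 0≤w)
    by-sign (no  0≰w) = direction (ℚ.≰⇒> 0≰w) (negative-power d)

open import Algebra.Bundles using (CommutativeRing; CommutativeSemiring)
import Algebra.Definitions.RawSemiring as RawSemiringDefs
open import Data.Bool.Base using (Bool)
open import Data.Fin.Base using (Fin)
open import Data.Integer.Base using (+_)
open import Data.List.Base as List using (List; []; _∷_; length)
import Data.List.Properties as List
open import Data.List.Membership.Propositional using (_∉_)
import Data.List.Relation.Unary.All as All
open import Data.Nat.Base as ℕ using (ℕ; zero; suc)
import Data.Nat.DivMod as ℕ
open import Data.Nat.Induction using (<-wellFounded)
open import Data.Nat.Logarithm
import Data.Nat.Properties as ℕ
open import Data.Product.Base using (∃; _×_; _,_; proj₁; proj₂)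
open import Data.Rational.Base as ℚ using (ℚ; 0ℚ; 1ℚ; ½; ∣_∣; _/_)
import Data.Rational.Properties as ℚ
open import Data.Rational.Solver using (module +-*-Solver)
open import Data.Vec.Base using (Vec)
open import Defs
open import Function.Base using (_∘_)
open import Function.Bundles using (mk⇔; Equivalence)
open import Induction.WellFounded using (Acc; acc)
open import Relation.Binary.PropositionalEquality
open import Relation.Nullary using (¬_; Dec; yes; no; contradiction)
open +-*-Solver using (solve; _:=_; _:+_; _:*_; _:-_; :-_; con)
open Estimates using (binomials≤; G)
open Colourings using (ZeroOne; zeroOnes; zeroOnes-complete; zeroOnes-sound; rainbow; ∑)
open BalancedColourings using (balanced-colourings)
open Rationals
open Polynomials using (module Coefficients; IsMultilinear⇔ZeroOne; zeroOnes-unique; ZeroOne⇒deg)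
open Characters using (ℚ-commutativeSemiring; signWeight; scale; scale>0)
open PowerSums using (zeroOne?; module SumOfPowers)
open ComplexNumbers
open Roots

-- Multilinear polynomials with rational coefficients

module ℝᶜ = Coefficients ℝ-commutativeSemiring
module ℂᶜ = Coefficients ℂ-commutativeSemiring
module ℂˢ = SumOfPowers ℂ-commutativeSemiring
module ℂᴿ = CommutativeRing ℂ-commutativeRing

module _ {n : ℕ} (d : ℕ) (c : Vec ℕ n → ℚ) where

  multilinearPoly : ℝ[x].Poly n
  multilinearPoly = List.map (λ e → fromℚ (c e) , e) (zeroOnes n d)

  private
    ∉-zeroOnes : ∀ {e} → ¬ ZeroOne d e → e ∉ zeroOnes n d
    ∉-zeroOnes ¬b e∈ = ¬b (All.lookup (zeroOnes-sound n d) e∈)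

  coeff-ZeroOne : ∀ {e} → ZeroOne d e → ℝ[x].coeff multilinearPoly e ≃ fromℚ (c e)
  coeff-ZeroOne b = ℝᶜ.coeff-terms-∈ (fromℚ ∘ c) (zeroOnes-unique n d) (zeroOnes-complete b)

  coeff-¬ZeroOne : ∀ e → ¬ ZeroOne d e → ℝ[x].coeff multilinearPoly e ≃ 0ℝ
  coeff-¬ZeroOne e ¬b = ℝᶜ.coeff-terms-∉ (fromℚ ∘ c) (zeroOnes n d) e (∉-zeroOnes ¬b)

  complexify≡ : complexify multilinearPoly ≡ List.map (λ e → ι (c e) , e) (zeroOnes n d)
  complexify≡ = sym (List.map-∘ (zeroOnes n d))

  complexify-ZeroOne : ∀ {e} → ZeroOne d e → ℂ[x].coeff (complexify multilinearPoly) e ≈ᶜ ι (c e)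
  complexify-ZeroOne {e} b = subst (λ p → ℂ[x].coeff p e ≈ᶜ ι (c e)) (sym complexify≡)
    (ℂᶜ.coeff-terms-∈ (ι ∘ c) (zeroOnes-unique n d) (zeroOnes-complete b))

  complexify-¬ZeroOne : ∀ e → ¬ ZeroOne d e → ℂ[x].coeff (complexify multilinearPoly) e ≈ᶜ 0ᶜ
  complexify-¬ZeroOne e ¬b = subst (λ p → ℂ[x].coeff p e ≈ᶜ 0ᶜ) (sym complexify≡)
    (ℂᶜ.coeff-terms-∉ (ι ∘ c) (zeroOnes n d) e (∉-zeroOnes ¬b))

  isSumOfPowers : ∀ {ℓs : List (ℂ[x].LinearForm n)} →
    (∀ {e} → ZeroOne d e → ℂ[x].coeff (ℂˢ.powerSum d ℓs) e ≈ᶜ ι (c e)) →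
    (∀ e → ¬ ZeroOne d e → ℂ[x].coeff (ℂˢ.powerSum d ℓs) e ≈ᶜ 0ᶜ) →
    IsSumOfPowers d (complexify multilinearPoly) (length ℓs)
  isSumOfPowers {ℓs} on off = List.lookup ℓs , λ e → by-cases e (zeroOne? d e)
    where
    p = ℂˢ.powerSum d ℓs
    by-cases : ∀ e → Dec (ZeroOne d e) → ℂ[x].coeff (complexify multilinearPoly) e ≈ᶜ ℂ[x].coeff p e
    by-cases e (yes b) = ℂᴿ.trans {ℂ[x].coeff (complexify multilinearPoly) e} {ι (c e)} {ℂ[x].coeff p e}
      (complexify-ZeroOne b) (ℂᴿ.sym {ℂ[x].coeff p e} {ι (c e)} (on b))
    by-cases e (no ¬b) = ℂᴿ.trans {ℂ[x].coeff (complexify multilinearPoly) e} {0ᶜ} {ℂ[x].coeff p e}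
      (complexify-¬ZeroOne e ¬b) (ℂᴿ.sym {ℂ[x].coeff p e} {0ᶜ} (off e ¬b))

fromℚ-≄0 : ∀ {x q} → x ≃ fromℚ q → 0ℚ ℚ.< q → ¬ (x ≃ 0ℝ)
fromℚ-≄0 {x} {q} x≃q 0<q x≃0 = absurd (≃-trans {0ℝ} {x} {fromℚ q} (≃-sym {x} {0ℝ} x≃0) x≃q q 0<q)
  where
  absurd : ¬ (Eventually λ _ → ∣ 0ℚ ℚ.- q ∣ ℚ.< q)
  absurd (N , h) = ℚ.<-irrefl refl (subst (ℚ._< q) (trans (cong ∣_∣ (ℚ.+-identityˡ (ℚ.- q)))
    (trans (ℚ.∣-p∣≡∣p∣ q) (ℚ.0≤p⇒∣p∣≡p (ℚ.<⇒≤ 0<q)))) (h N ℕ.≤-refl))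

≤-fromℚ : ∀ {x y} q → y ≃ fromℚ q → (Eventually λ m → seq x m ℚ.≤ q) → x ≤ y
≤-fromℚ {x} {y} q y≃q x≤q δ 0<δ = Eventually-map₂
  {λ m → ∣ seq y m ℚ.- q ∣ ℚ.< δ} {λ m → seq x m ℚ.≤ q} {λ m → seq x m ℚ.< seq y m ℚ.+ δ}
  (λ {m} → lower (seq y m) (seq x m)) (y≃q δ 0<δ) x≤q
  where
  lower : ∀ y x → ∣ y ℚ.- q ∣ ℚ.< δ → x ℚ.≤ q → x ℚ.< y ℚ.+ δ
  lower y x lt x≤q = ℚ.≤-<-trans x≤q (subst (ℚ._< y ℚ.+ δ) (solve 2 (λ y q → y :+ (:- (y :- q)) := q) refl y q)
    (ℚ.+-monoʳ-< y (ℚ.≤-<-trans (p≤∣p∣ (ℚ.- (y ℚ.- q))) (subst (ℚ._< δ) (sym (ℚ.∣-p∣≡∣p∣ (y ℚ.- q))) lt))))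

fromℚ-≤ : ∀ {x y} q → x ≃ fromℚ q → (Eventually λ m → q ℚ.≤ seq y m) → x ≤ y
fromℚ-≤ {x} {y} q x≃q q≤y δ 0<δ = Eventually-map₂
  {λ m → ∣ seq x m ℚ.- q ∣ ℚ.< δ} {λ m → q ℚ.≤ seq y m} {λ m → seq x m ℚ.< seq y m ℚ.+ δ}
  (λ {m} → upper (seq x m) (seq y m)) (x≃q δ 0<δ) q≤y
  where
  upper : ∀ x y → ∣ x ℚ.- q ∣ ℚ.< δ → q ℚ.≤ y → x ℚ.< y ℚ.+ δ
  upper x y lt q≤y = ℚ.<-≤-trans (subst (ℚ._< q ℚ.+ δ) (solve 2 (λ x q → q :+ (x :- q) := x) refl x q)
    (ℚ.+-monoʳ-< q (ℚ.≤-<-trans (p≤∣p∣ (x ℚ.- q)) lt))) (ℚ.+-monoˡ-≤ δ q≤y)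

module _ {n d : ℕ} {c : Vec ℕ n → ℚ} {ε : ℝ} where

  admissible : (∀ {e} → ZeroOne d e → 0ℚ ℚ.< c e) →
    (Eventually λ m → ∀ {e} → ZeroOne d e → 1ℚ ℚ.- seq ε m ℚ.≤ c e × c e ℚ.≤ 1ℚ ℚ.+ seq ε m) →
    IsAdmissible n d ε (multilinearPoly d c)
  admissible 0<c within = record
    { homogeneous = λ e deg≢d → coeff-¬ZeroOne d c e (deg≢d ∘ ZeroOne⇒deg)
    ; support     = λ e → mk⇔ (Equivalence.from IsMultilinear⇔ZeroOne ∘ nonzero⇒ e)
        λ ml → let b = Equivalence.to IsMultilinear⇔ZeroOne ml in fromℚ-≄0 {ℝ[x].coeff (multilinearPoly d c) e} {c e} (coeff-ZeroOne d c b) (0<c b)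
    ; range       = λ e ≄0 → bounds e (nonzero⇒ e ≄0)
    }
    where
    nonzero⇒ : ∀ e → ¬ (ℝ[x].coeff (multilinearPoly d c) e ≃ 0ℝ) → ZeroOne d e
    nonzero⇒ e ≄0 with zeroOne? d e
    ... | yes b = b
    ... | no ¬b = contradiction (coeff-¬ZeroOne d c e ¬b) ≄0
    bounds : ∀ e → ZeroOne d e → 1ℝ - ε ≤ ℝ[x].coeff (multilinearPoly d c) e × ℝ[x].coeff (multilinearPoly d c) e ≤ 1ℝ + ε
    bounds e b =
      ≤-fromℚ {1ℝ - ε} {ℝ[x].coeff (multilinearPoly d c) e} (c e) (coeff-ZeroOne d c b)
        (proj₁ within , λ m N≤m → proj₁ (proj₂ within m N≤m b)) ,
      fromℚ-≤ {ℝ[x].coeff (multilinearPoly d c) e} {1ℝ + ε} (c e) (coeff-ZeroOne d c b)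
        (proj₁ within , λ m N≤m → proj₂ (proj₂ within m N≤m b))


-- Integer approximations to 1/ε and log₂ n

Eventually-shift : ∀ {P : ℕ → Set} N → Eventually P → Eventually (λ m → P (N ℕ.+ m))
Eventually-shift N (M , h) = M , λ m M≤m → h (N ℕ.+ m) (ℕ.m≤n⇒m≤o+n N M≤m)

-- With x half of a late term of ε, all later terms lie between x and 3x. Taking q′ as the integer
-- part of 1/x and q = q′ + 1 gives 1 ≤ q x, and q · 3x ≤ 3 (q′ x + x) ≤ 6.
reciprocal-approx : ∀ ε → 0ℝ < ε → ε < 1ℝ → ∃ λ q′ → 1 ℕ.≤ q′ ×
  (Eventually λ m → 1ℚ ℚ.≤ ⟦ suc q′ ⟧ ℚ.* seq ε m × ⟦ suc q′ ⟧ ℚ.* seq ε m ℚ.≤ ⟦ 6 ⟧)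
reciprocal-approx ε (η , 0<η , N₁ , h₁) (δ , 0<δ , N₂ , h₂) = a , 1≤a , M , λ m M≤m →
  ℚ.≤-trans 1≤qx (*-mono-≤ (0≤⟦⟧ (suc a)) (ℚ.<⇒≤ 0<x) ℚ.≤-refl (ℚ.<⇒≤ (x<ε m M≤m))) ,
  ℚ.≤-trans (*-mono-≤ (0≤⟦⟧ (suc a)) (ℚ.<⇒≤ (ℚ.<-trans 0<x (x<ε m M≤m))) ℚ.≤-refl (ℚ.<⇒≤ (ε<3x m M≤m))) q3x≤6
  where
  -- The tolerance η/2 is below x = e₀/2, because η bounds the late terms of ε from below.
  C = cauchy ε (½ ℚ.* η) (pos-* (ℚ.positive⁻¹ ½) 0<η)
  M = N₁ ℕ.⊔ (N₂ ℕ.⊔ proj₁ C)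
  e₀ = seq ε M
  x = ½ ℚ.* e₀
  N₁≤ : ∀ {m} → M ℕ.≤ m → N₁ ℕ.≤ m
  N₁≤ = ℕ.m⊔n≤o⇒m≤o N₁ (N₂ ℕ.⊔ proj₁ C)
  N₂≤ : ∀ {m} → M ℕ.≤ m → N₂ ℕ.≤ m
  N₂≤ M≤m = ℕ.m⊔n≤o⇒m≤o N₂ (proj₁ C) (ℕ.m⊔n≤o⇒n≤o N₁ (N₂ ℕ.⊔ proj₁ C) M≤m)
  N₃≤ : ∀ {m} → M ℕ.≤ m → proj₁ C ℕ.≤ m
  N₃≤ M≤m = ℕ.m⊔n≤o⇒n≤o N₂ (proj₁ C) (ℕ.m⊔n≤o⇒n≤o N₁ (N₂ ℕ.⊔ proj₁ C) M≤m)
  η<e₀ : η ℚ.< e₀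
  η<e₀ = subst (ℚ._< e₀) (ℚ.+-identityˡ η) (h₁ M (N₁≤ ℕ.≤-refl))
  0<e₀ : 0ℚ ℚ.< e₀
  0<e₀ = ℚ.<-trans 0<η η<e₀
  0<x : 0ℚ ℚ.< x
  0<x = pos-* (ℚ.positive⁻¹ ½) 0<e₀
  e₀<1 : e₀ ℚ.< 1ℚ
  e₀<1 = ℚ.≤-<-trans (subst (ℚ._≤ e₀ ℚ.+ δ) (ℚ.+-identityʳ e₀) (ℚ.+-monoʳ-≤ e₀ (ℚ.<⇒≤ 0<δ))) (h₂ M (N₂≤ ℕ.≤-refl))
  x<1 : x ℚ.< 1ℚ
  x<1 = ℚ.<-trans (subst₂ ℚ._<_ (ℚ.+-identityʳ x) (solve 1 (λ e → con ½ :* e :+ con ½ :* e := e) refl e₀) (ℚ.+-monoʳ-< x 0<x)) e₀<1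
  ½η<x : ½ ℚ.* η ℚ.< x
  ½η<x = ℚ.*-monoʳ-<-pos ½ η<e₀
  close : ∀ m → M ℕ.≤ m → ∣ seq ε m ℚ.- e₀ ∣ ℚ.< x
  close m M≤m = ℚ.<-trans (proj₂ C m M (N₃≤ M≤m) (N₃≤ ℕ.≤-refl)) ½η<x
  x<ε : ∀ m → M ℕ.≤ m → x ℚ.< seq ε m
  x<ε m M≤m = subst₂ ℚ._<_
    (solve 2 (λ e s → (:- (s :- e)) :+ (s :- con ½ :* e) := con ½ :* e) refl e₀ (seq ε m))
    (solve 2 (λ e s → con ½ :* e :+ (s :- con ½ :* e) := s) refl e₀ (seq ε m))
    (ℚ.+-monoˡ-< (seq ε m ℚ.- x) (ℚ.≤-<-trans (p≤∣p∣ (ℚ.- (seq ε m ℚ.- e₀)))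
      (subst (ℚ._< x) (sym (ℚ.∣-p∣≡∣p∣ (seq ε m ℚ.- e₀))) (close m M≤m))))
  ε<3x : ∀ m → M ℕ.≤ m → seq ε m ℚ.< ⟦ 3 ⟧ ℚ.* x
  ε<3x m M≤m = subst₂ ℚ._<_
    (solve 2 (λ e s → (s :- e) :+ e := s) refl e₀ (seq ε m))
    (solve 1 (λ e → con ½ :* e :+ e := con ⟦ 3 ⟧ :* (con ½ :* e)) refl e₀)
    (ℚ.+-monoˡ-< e₀ (ℚ.≤-<-trans (p≤∣p∣ (seq ε m ℚ.- e₀)) (close m M≤m)))
  B = upperBound (inv x 0<x)
  found = search (λ a → ⟦ a ⟧ ℚ.* x ℚ.≤? 1ℚ) (ℚ.≤-trans (ℚ.≤-reflexive (ℚ.*-zeroˡ x)) 0≤1) (proj₁ B) λ Bx≤1 →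
    ℚ.<-irrefl refl (ℚ.<-≤-trans (subst (ℚ._< ⟦ proj₁ B ⟧ ℚ.* x) (trans (ℚ.*-comm (inv x 0<x) x) (*-inv x 0<x))
      (ℚ.*-monoˡ-<-pos x {{ℚ.positive 0<x}} (proj₂ B))) Bx≤1)
  a = proj₁ found
  1≤qx : 1ℚ ℚ.≤ ⟦ suc a ⟧ ℚ.* x
  1≤qx = ℚ.<⇒≤ (ℚ.≰⇒> (proj₂ (proj₂ found)))
  -- This is where ε < 1 enters: x < 1 makes q′ positive, which later makes the coefficients
  -- positive.
  1≤a : 1 ℕ.≤ a
  1≤a = ℕ.n≢0⇒n>0 λ a≡0 → ℚ.<-irrefl refl (ℚ.≤-<-trans (subst (1ℚ ℚ.≤_)
    (trans (cong (λ a → ⟦ suc a ⟧ ℚ.* x) a≡0) (ℚ.*-identityˡ x)) 1≤qx) x<1)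
  q3x≤6 : ⟦ suc a ⟧ ℚ.* (⟦ 3 ⟧ ℚ.* x) ℚ.≤ ⟦ 6 ⟧
  q3x≤6 = begin
    ⟦ suc a ⟧ ℚ.* (⟦ 3 ⟧ ℚ.* x)            ≡⟨ cong (ℚ._* (⟦ 3 ⟧ ℚ.* x)) (⟦⟧-+ 1 a) ⟩
    (1ℚ ℚ.+ ⟦ a ⟧) ℚ.* (⟦ 3 ⟧ ℚ.* x)
      ≡⟨ solve 2 (λ a x → (con 1ℚ :+ a) :* (con ⟦ 3 ⟧ :* x) := con ⟦ 3 ⟧ :* (a :* x :+ x)) refl ⟦ a ⟧ x ⟩
    ⟦ 3 ⟧ ℚ.* (⟦ a ⟧ ℚ.* x ℚ.+ x)
      ≤⟨ ℚ.*-monoˡ-≤-nonNeg ⟦ 3 ⟧ (ℚ.+-mono-≤ (proj₁ (proj₂ found)) (ℚ.<⇒≤ x<1)) ⟩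
    ⟦ 6 ⟧                                  ∎
    where open ℚ.≤-Reasoning

-- The m-th term of the reciprocal inverts the term of x at index N + m, so estimates on ε have to
-- be shifted by N before they meet those on its reciprocal.
recip-inverse : ∀ x (0<x : 0ℝ < x) m → let N = proj₁ (proj₂ (proj₂ 0<x)) in
  0ℚ ℚ.< seq (recip x 0<x) m × seq x (N ℕ.+ m) ℚ.* seq (recip x 0<x) m ≡ 1ℚ
recip-inverse x (η , 0<η , N , h) m = inv-pos (seq x (N ℕ.+ m)) 0<xₘ , *-inv (seq x (N ℕ.+ m)) 0<xₘ
  where
  0<xₘ : 0ℚ ℚ.< seq x (N ℕ.+ m)
  0<xₘ = ℚ.<-trans 0<η (subst (ℚ._< seq x (N ℕ.+ m)) (ℚ.+-identityˡ η) (h (N ℕ.+ m) (ℕ.m≤m+n N m)))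

-- From 2^l ≤ n follows 2^(l(j+1)) ≤ n^(j+1), so the lower bound holds at every index of the
-- approximating sequence.
log₂-lower : ∀ n l j .{{_ : ℕ.NonZero n}} → 2 ℕ.^ l ℕ.≤ n → ⟦ l ⟧ ℚ.≤ seq (log₂ n) j
log₂-lower n@(suc _) l j 2^l≤n = ⟦⟧≤/ l _ j (subst (ℕ._≤ ⌊log₂ n ℕ.^ suc j ⌋) (⌊log₂[2^n]⌋≡n (l ℕ.* suc j))
  (⌊log₂⌋-mono-≤ (subst (ℕ._≤ n ℕ.^ suc j) (ℕ.^-*-assoc 2 l (suc j)) (ℕ.^-monoˡ-≤ (suc j) 2^l≤n))))

-- L is the integer part l of the logarithm plus 1. For n ≥ 2 this l is at least 1, so L ≤ 2 l.
log₂-approx : ∀ n → 2 ℕ.≤ n → ∃ λ L → ℕ.NonZero L × n ℕ.≤ 2 ℕ.^ L × (∀ j → ⟦ L ⟧ ℚ.≤ ⟦ 2 ⟧ ℚ.* seq (log₂ n) j)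
log₂-approx n 2≤n = suc l , _ , ℕ.<⇒≤ (ℕ.≰⇒> (proj₂ (proj₂ found))) , λ j → begin
  ⟦ suc l ⟧                     ≤⟨ ⟦⟧-mono-≤ (ℕ.≤-trans (ℕ.+-monoˡ-≤ l 1≤l) (ℕ.≤-reflexive (cong (l ℕ.+_) (sym (ℕ.+-identityʳ l))))) ⟩
  ⟦ 2 ℕ.* l ⟧                   ≡⟨ ⟦⟧-* 2 l ⟩
  ⟦ 2 ⟧ ℚ.* ⟦ l ⟧               ≤⟨ ℚ.*-monoˡ-≤-nonNeg ⟦ 2 ⟧ (log₂-lower n l j {{ℕ.>-nonZero (ℕ.<⇒≤ 2≤n)}} (proj₁ (proj₂ found))) ⟩
  ⟦ 2 ⟧ ℚ.* seq (log₂ n) j      ∎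
  where
  open ℚ.≤-Reasoning
  n<2^n : ∀ n → n ℕ.< 2 ℕ.^ n
  n<2^n zero    = ℕ.s≤s ℕ.z≤n
  n<2^n (suc n) = ℕ.≤-trans (ℕ.+-mono-≤ (ℕ.≤-trans (ℕ.s≤s ℕ.z≤n) (n<2^n n)) (n<2^n n))
    (ℕ.≤-reflexive (cong (2 ℕ.^ n ℕ.+_) (sym (ℕ.+-identityʳ (2 ℕ.^ n)))))
  found = search (λ l → 2 ℕ.^ l ℕ.≤? n) (ℕ.<⇒≤ 2≤n) n (ℕ.<⇒≱ (n<2^n n))
  l = proj₁ found
  1≤l : 1 ℕ.≤ l
  1≤l = ℕ.n≢0⇒n>0 λ l≡0 → proj₂ (proj₂ found) (subst (λ l → 2 ℕ.^ suc l ℕ.≤ n) (sym l≡0) 2≤n)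

-- P need not be decidable, so the least number principle is obtained only up to double negation: if
-- no least element existed, well-founded induction would refute P everywhere.
IsLeast-¬¬ : ∀ {P : ℕ → Set} r → P r → ¬ ¬ ∃ (IsLeast P)
IsLeast-¬¬ {P} r Pr none = go (<-wellFounded r) Pr
  where
  go : ∀ {r} → Acc ℕ._<_ r → ¬ P r
  go {r} (acc rs) Pr = none (r , Pr , λ k Pk → ℕ.≮⇒≥ λ k<r → go (rs k<r) Pk)

-- Short power sums and the final bound

open RawSemiringDefs (CommutativeSemiring.rawSemiring ℚ-commutativeSemiring) using () renaming (_^_ to _^ℚ_)
open RawSemiringDefs ℂ-rawSemiring using () renaming (_^_ to _^ᶜ_)
module ℂᵂ = ℂˢ.WithRationals ι
  (≡⇒≈ᶜ {ι 0ℚ} {0ᶜ} (λ _ → refl) (λ _ → refl)) (≡⇒≈ᶜ {ι 1ℚ} {1ᶜ} (λ _ → refl) (λ _ → refl)) ι-+ ι-*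

-- The construction without real numbers in its bounds: with q = suc q′ the coefficients lie in
-- [1 - 1/q, 1 + 1/q], and `size` says rank ≤ 32 q² L · 31 G · 4.075^d.
record ShortPowerSum (n d q′ L : ℕ) : Set where
  field
    rank   : ℕ
    c      : Vec ℕ n → ℚ
    range  : ∀ {e} → ZeroOne d e → ⟦ q′ ⟧ ℚ.≤ ⟦ suc q′ ⟧ ℚ.* c e × ⟦ suc q′ ⟧ ℚ.* c e ℚ.≤ ⟦ 2 ℕ.+ q′ ⟧
    powers : IsSumOfPowers d (complexify (multilinearPoly d c)) rank
    size   : rank ℕ.* 1000 ℕ.^ d ℕ.≤ 32 ℕ.* suc q′ ℕ.* suc q′ ℕ.* L ℕ.* (G ℕ.* 31) ℕ.* 4075 ℕ.^ d

module _ {k n d q′ L} (ψ : List (Vec (Fin k) n)) (D : ℕ) .{{_ : ℕ.NonZero d}} {{_ : ℕ.NonZero D}}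
  (balanced : ∀ {e} → ZeroOne d e →
    q′ ℕ.* D ℕ.≤ suc q′ ℕ.* ∑ ψ (rainbow e) × suc q′ ℕ.* ∑ ψ (rainbow e) ℕ.≤ (2 ℕ.+ q′) ℕ.* D)
  (size : length ψ ℕ.* (2 ℕ.* binomials≤ k (d ℕ./ 2)) ℕ.* 1000 ℕ.^ d
          ℕ.≤ 32 ℕ.* suc q′ ℕ.* suc q′ ℕ.* L ℕ.* (G ℕ.* 31) ℕ.* 4075 ℕ.^ d) where

  private
    0<D : 0ℚ ℚ.< ⟦ D ⟧
    0<D = ⟦⟧-mono-< {0} {D} (ℕ.>-nonZero⁻¹ D)

    D⁻¹ : ℚ
    D⁻¹ = inv ⟦ D ⟧ 0<D

    V : ℚ
    V = ⟦ d ℕ.! ⟧ ℚ.* scale {k} d (d ℕ./ 2)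

    0<V : 0ℚ ℚ.< V
    0<V = pos-* (⟦⟧-mono-< {0} {d ℕ.!} (ℕ.1≤n! d)) (scale>0 {k} d (d ℕ./ 2))

    -- Cancels the multinomial coefficient d! and `scale`, and divides by D, so that the coefficient
    -- of e becomes its rainbow count over D.
    κ : ℚ
    κ = inv V 0<V ℚ.* D⁻¹

    c : Vec ℕ n → ℚ
    c e = ⟦ ∑ ψ (rainbow e) ⟧ ℚ.* D⁻¹

    normalised : ∀ f s i j x → f ℚ.* s ℚ.* i ≡ 1ℚ → f ℚ.* (i ℚ.* j ℚ.* s ℚ.* x) ≡ x ℚ.* j
    normalised f s i j x eq = trans
      (solve 5 (λ f s i j x → f :* (i :* j :* s :* x) := (f :* s :* i) :* (x :* j)) refl f s i j x)
      (trans (cong (ℚ._* (x ℚ.* j)) eq) (ℚ.*-identityˡ (x ℚ.* j)))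

    ρs : Vec Bool k → List ℂ
    ρs I = proj₁ (sum-of-two-powers d (κ ℚ.* signWeight d I))

    ∑ρ^d : ∀ I → ℂˢ.sumᴿ (ρs I) (_^ᶜ d) ≈ᶜ ι (κ ℚ.* signWeight d I)
    ∑ρ^d I = proj₂ (proj₂ (sum-of-two-powers d (κ ℚ.* signWeight d I)))

    forms : List (ℂ[x].LinearForm n)
    forms = ℂᵂ.forms d κ ψ ρs ∑ρ^d

    divided : ∀ {a b} → a ℕ.* D ℕ.≤ b → ⟦ a ⟧ ℚ.≤ ⟦ b ⟧ ℚ.* D⁻¹
    divided {a} {b} le = begin
      ⟦ a ⟧                    ≡⟨ sym (trans (cong (⟦ a ⟧ ℚ.*_) (*-inv ⟦ D ⟧ 0<D)) (ℚ.*-identityʳ ⟦ a ⟧)) ⟩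
      ⟦ a ⟧ ℚ.* (⟦ D ⟧ ℚ.* D⁻¹)  ≡⟨ sym (ℚ.*-assoc ⟦ a ⟧ ⟦ D ⟧ D⁻¹) ⟩
      ⟦ a ⟧ ℚ.* ⟦ D ⟧ ℚ.* D⁻¹    ≡⟨ cong (ℚ._* D⁻¹) (sym (⟦⟧-* a D)) ⟩
      ⟦ a ℕ.* D ⟧ ℚ.* D⁻¹      ≤⟨ ℚ.*-monoʳ-≤-nonNeg D⁻¹ {{ℚ.nonNegative (ℚ.<⇒≤ (inv-pos ⟦ D ⟧ 0<D))}} (⟦⟧-mono-≤ le) ⟩
      ⟦ b ⟧ ℚ.* D⁻¹            ∎
      where open ℚ.≤-Reasoning

    divided′ : ∀ {a b} → b ℕ.≤ a ℕ.* D → ⟦ b ⟧ ℚ.* D⁻¹ ℚ.≤ ⟦ a ⟧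
    divided′ {a} {b} le = begin
      ⟦ b ⟧ ℚ.* D⁻¹            ≤⟨ ℚ.*-monoʳ-≤-nonNeg D⁻¹ {{ℚ.nonNegative (ℚ.<⇒≤ (inv-pos ⟦ D ⟧ 0<D))}} (⟦⟧-mono-≤ le) ⟩
      ⟦ a ℕ.* D ⟧ ℚ.* D⁻¹      ≡⟨ cong (ℚ._* D⁻¹) (⟦⟧-* a D) ⟩
      ⟦ a ⟧ ℚ.* ⟦ D ⟧ ℚ.* D⁻¹    ≡⟨ ℚ.*-assoc ⟦ a ⟧ ⟦ D ⟧ D⁻¹ ⟩
      ⟦ a ⟧ ℚ.* (⟦ D ⟧ ℚ.* D⁻¹)  ≡⟨ trans (cong (⟦ a ⟧ ℚ.*_) (*-inv ⟦ D ⟧ 0<D)) (ℚ.*-identityʳ ⟦ a ⟧) ⟩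
      ⟦ a ⟧                    ∎
      where open ℚ.≤-Reasoning

    scaled : ∀ e → ⟦ suc q′ ℕ.* ∑ ψ (rainbow e) ⟧ ℚ.* D⁻¹ ≡ ⟦ suc q′ ⟧ ℚ.* c e
    scaled e = trans (cong (ℚ._* D⁻¹) (⟦⟧-* (suc q′) (∑ ψ (rainbow e)))) (ℚ.*-assoc ⟦ suc q′ ⟧ ⟦ ∑ ψ (rainbow e) ⟧ D⁻¹)

  rainbow-powerSum : ShortPowerSum n d q′ L
  rainbow-powerSum = record
    { rank   = length forms
    ; c      = c
    ; range  = λ {e} b → subst (⟦ q′ ⟧ ℚ.≤_) (scaled e) (divided {q′} {suc q′ ℕ.* ∑ ψ (rainbow e)} (proj₁ (balanced b)))
                       , subst (ℚ._≤ ⟦ 2 ℕ.+ q′ ⟧) (scaled e) (divided′ {2 ℕ.+ q′} {suc q′ ℕ.* ∑ ψ (rainbow e)} (proj₂ (balanced b)))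
    ; powers = isSumOfPowers d c {forms}
        (λ {e} b → subst (λ x → ℂ[x].coeff (ℂˢ.powerSum d forms) e ≈ᶜ ι x)
          (normalised ⟦ d ℕ.! ⟧ (scale {k} d (d ℕ./ 2)) (inv V 0<V) D⁻¹ ⟦ ∑ ψ (rainbow e) ⟧ (*-inv V 0<V))
          (ℂᵂ.coeff-ZeroOne d κ ψ ρs ∑ρ^d b))
        (ℂᵂ.coeff-¬ZeroOne d κ ψ ρs ∑ρ^d)
    ; size   = ℕ.≤-trans (ℕ.*-monoˡ-≤ (1000 ℕ.^ d) (ℂᵂ.length-forms d κ ψ ρs ∑ρ^d λ I →
                 proj₁ (proj₂ (sum-of-two-powers d (κ ℚ.* signWeight d I))))) size
    }

-- In degree 0 the power of any form is the constant 1, so one form is enough. This case is separate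
-- because the rainbow construction needs d-th roots with d positive.
degree₀-powerSum : ∀ n d q′ L .{{_ : ℕ.NonZero L}} {f} (ℓs : List (ℂ[x].LinearForm n)) → d ≡ 0 → ℓs ≡ f ∷ [] →
                   ShortPowerSum n d q′ L
degree₀-powerSum n d q′ L {f} ℓs d≡0 ℓs≡ = record
  { rank   = length ℓs
  ; c      = λ _ → 1ℚ
  ; range  = λ _ → subst (⟦ q′ ⟧ ℚ.≤_) (sym (ℚ.*-identityʳ ⟦ suc q′ ⟧)) (⟦⟧-mono-≤ (ℕ.n≤1+n q′))
                 , subst (ℚ._≤ ⟦ 2 ℕ.+ q′ ⟧) (sym (ℚ.*-identityʳ ⟦ suc q′ ⟧)) (⟦⟧-mono-≤ (ℕ.n≤1+n (suc q′)))
  ; powers = isSumOfPowers d (λ _ → 1ℚ) {ℓs}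
      (ℂˢ.coeff-power₀-ZeroOne {n} {d} {f} {ℓs} d≡0 ℓs≡) (ℂˢ.coeff-power₀-¬ZeroOne {n} {d} {f} {ℓs} d≡0 ℓs≡)
  ; size   = subst₂ (λ l d → l ℕ.* 1000 ℕ.^ d ℕ.≤ 32 ℕ.* suc q′ ℕ.* suc q′ ℕ.* L ℕ.* (G ℕ.* 31) ℕ.* 4075 ℕ.^ d)
      (sym (cong length ℓs≡)) (sym d≡0) (one≤ G)
  }
  where
  one≤ : ∀ g .{{_ : ℕ.NonZero g}} → 1 ℕ.≤ 32 ℕ.* suc q′ ℕ.* suc q′ ℕ.* L ℕ.* (g ℕ.* 31) ℕ.* 1
  one≤ g = ℕ.>-nonZero⁻¹ (32 ℕ.* suc q′ ℕ.* suc q′ ℕ.* L ℕ.* (g ℕ.* 31) ℕ.* 1)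
    {{ℕ.m*n≢0 _ 1 {{ℕ.m*n≢0 _ (g ℕ.* 31) {{ℕ.m*n≢0 (32 ℕ.* suc q′ ℕ.* suc q′) L}} {{ℕ.m*n≢0 g 31}}}}}}

shortPowerSum : ∀ n d q′ L .{{_ : ℕ.NonZero n}} .{{_ : ℕ.NonZero L}} → n ℕ.≤ 2 ℕ.^ L → ShortPowerSum n d q′ L
shortPowerSum n zero      q′ L n≤2^L = degree₀-powerSum n zero q′ L {λ _ → 0ᶜ} _ refl refl
shortPowerSum n d@(suc _) q′ L n≤2^L = from (balanced-colourings n d q′ L n≤2^L)
  where
  from : (∃ λ k → ∃ λ (ψ : List (Vec (Fin k) n)) → ∃ λ D → ℕ.NonZero D ×
    (∀ {e} → ZeroOne d e → q′ ℕ.* D ℕ.≤ suc q′ ℕ.* ∑ ψ (rainbow e) × suc q′ ℕ.* ∑ ψ (rainbow e) ℕ.≤ (2 ℕ.+ q′) ℕ.* D) ×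
    length ψ ℕ.* (2 ℕ.* binomials≤ k (d ℕ./ 2)) ℕ.* 1000 ℕ.^ d
      ℕ.≤ 32 ℕ.* suc q′ ℕ.* suc q′ ℕ.* L ℕ.* (G ℕ.* 31) ℕ.* 4075 ℕ.^ d) → ShortPowerSum n d q′ L
  from (k , ψ , D , D≢0 , balanced , size) = rainbow-powerSum {k} {n} {d} {q′} {L} ψ D {{_}} {{D≢0}} balanced size

^ℚ-distrib-* : ∀ p q d → (p ℚ.* q) ^ℚ d ≡ p ^ℚ d ℚ.* q ^ℚ d
^ℚ-distrib-* p q zero    = refl
^ℚ-distrib-* p q (suc d) = trans (cong (p ℚ.* q ℚ.*_) (^ℚ-distrib-* p q d))
  (solve 4 (λ p q x y → (p :* q) :* (x :* y) := (p :* x) :* (q :* y)) refl p q (p ^ℚ d) (q ^ℚ d))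

⟦⟧-^ : ∀ a d → ⟦ a ℕ.^ d ⟧ ≡ ⟦ a ⟧ ^ℚ d
⟦⟧-^ a zero    = refl
⟦⟧-^ a (suc d) = trans (⟦⟧-* a (a ℕ.^ d)) (cong (⟦ a ⟧ ℚ.*_) (⟦⟧-^ a d))

-- ρ stands for 1/ε and l for log₂ n. The constant is 2304 = 32 · 6² · 2, from q ≤ 6 ρ used twice
-- and L ≤ 2 l.
rational-bound : ∀ {R d q L g s t r ρ l} .{{_ : ℕ.NonZero t}} →
  R ℕ.* t ℕ.^ d ℕ.≤ 32 ℕ.* q ℕ.* q ℕ.* L ℕ.* g ℕ.* s ℕ.^ d → r ℚ.* ⟦ t ⟧ ≡ ⟦ s ⟧ → 0ℚ ℚ.≤ r →
  0ℚ ℚ.≤ ρ → ⟦ q ⟧ ℚ.≤ ⟦ 6 ⟧ ℚ.* ρ → ⟦ L ⟧ ℚ.≤ ⟦ 2 ⟧ ℚ.* l →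
  ⟦ R ⟧ ℚ.≤ ⟦ 2304 ℕ.* g ⟧ ℚ.* r ^ℚ d ℚ.* (ρ ℚ.* (ρ ℚ.* 1ℚ)) ℚ.* l
rational-bound {R} {d} {q} {L} {g} {s} {t} {r} {ρ} {l} R≤ rt≡s 0≤r 0≤ρ q≤ L≤ =
  ℚ.*-cancelʳ-≤-pos (⟦ t ⟧ ^ℚ d) {{ℚ.positive 0<t^d}} (begin
  ⟦ R ⟧ ℚ.* ⟦ t ⟧ ^ℚ d                     ≡⟨ trans (cong (⟦ R ⟧ ℚ.*_) (sym (⟦⟧-^ t d))) (sym (⟦⟧-* R (t ℕ.^ d))) ⟩
  ⟦ R ℕ.* t ℕ.^ d ⟧                        ≤⟨ ⟦⟧-mono-≤ R≤ ⟩
  ⟦ 32 ℕ.* q ℕ.* q ℕ.* L ℕ.* g ℕ.* s ℕ.^ d ⟧ ≡⟨ expand ⟩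
  ((⟦ q ⟧ ℚ.* ⟦ q ⟧) ℚ.* ⟦ L ⟧) ℚ.* (⟦ 32 ⟧ ℚ.* ⟦ g ⟧ ℚ.* ⟦ s ⟧ ^ℚ d)
    ≤⟨ ℚ.*-monoʳ-≤-nonNeg _ {{ℚ.nonNegative 0≤tail}}
         (*-mono-≤ (nonNeg-* (0≤⟦⟧ q) (0≤⟦⟧ q)) (0≤⟦⟧ L) (*-mono-≤ (0≤⟦⟧ q) (0≤⟦⟧ q) q≤ q≤) L≤) ⟩
  (((⟦ 6 ⟧ ℚ.* ρ) ℚ.* (⟦ 6 ⟧ ℚ.* ρ)) ℚ.* (⟦ 2 ⟧ ℚ.* l)) ℚ.* (⟦ 32 ⟧ ℚ.* ⟦ g ⟧ ℚ.* ⟦ s ⟧ ^ℚ d)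
    ≡⟨ cong (λ x → (((⟦ 6 ⟧ ℚ.* ρ) ℚ.* (⟦ 6 ⟧ ℚ.* ρ)) ℚ.* (⟦ 2 ⟧ ℚ.* l)) ℚ.* (⟦ 32 ⟧ ℚ.* ⟦ g ⟧ ℚ.* x))
         (trans (cong (_^ℚ d) (sym rt≡s)) (^ℚ-distrib-* r ⟦ t ⟧ d)) ⟩
  (((⟦ 6 ⟧ ℚ.* ρ) ℚ.* (⟦ 6 ⟧ ℚ.* ρ)) ℚ.* (⟦ 2 ⟧ ℚ.* l)) ℚ.* (⟦ 32 ⟧ ℚ.* ⟦ g ⟧ ℚ.* (r ^ℚ d ℚ.* ⟦ t ⟧ ^ℚ d))
    ≡⟨ solve 5 (λ ρ l g x y → (((con ⟦ 6 ⟧ :* ρ) :* (con ⟦ 6 ⟧ :* ρ)) :* (con ⟦ 2 ⟧ :* l)) :* (con ⟦ 32 ⟧ :* g :* (x :* y))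
                           := (con ⟦ 2304 ⟧ :* g) :* x :* (ρ :* (ρ :* con 1ℚ)) :* l :* y) refl ρ l ⟦ g ⟧ (r ^ℚ d) (⟦ t ⟧ ^ℚ d) ⟩
  (⟦ 2304 ⟧ ℚ.* ⟦ g ⟧) ℚ.* r ^ℚ d ℚ.* (ρ ℚ.* (ρ ℚ.* 1ℚ)) ℚ.* l ℚ.* ⟦ t ⟧ ^ℚ d
    ≡⟨ cong (λ x → x ℚ.* r ^ℚ d ℚ.* (ρ ℚ.* (ρ ℚ.* 1ℚ)) ℚ.* l ℚ.* ⟦ t ⟧ ^ℚ d) (sym (⟦⟧-* 2304 g)) ⟩
  ⟦ 2304 ℕ.* g ⟧ ℚ.* r ^ℚ d ℚ.* (ρ ℚ.* (ρ ℚ.* 1ℚ)) ℚ.* l ℚ.* ⟦ t ⟧ ^ℚ d ∎)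
  where
  open ℚ.≤-Reasoning
  0<t^d : 0ℚ ℚ.< ⟦ t ⟧ ^ℚ d
  0<t^d = subst (0ℚ ℚ.<_) (⟦⟧-^ t d) (⟦⟧-mono-< {0} {t ℕ.^ d} (ℕ.>-nonZero⁻¹ (t ℕ.^ d) {{ℕ.m^n≢0 t d}}))
  0≤tail : 0ℚ ℚ.≤ ⟦ 32 ⟧ ℚ.* ⟦ g ⟧ ℚ.* ⟦ s ⟧ ^ℚ d
  0≤tail = nonNeg-* (nonNeg-* (0≤⟦⟧ 32) (0≤⟦⟧ g)) (^-nonNeg d (0≤⟦⟧ s))
  expand : ⟦ 32 ℕ.* q ℕ.* q ℕ.* L ℕ.* g ℕ.* s ℕ.^ d ⟧ ≡ ((⟦ q ⟧ ℚ.* ⟦ q ⟧) ℚ.* ⟦ L ⟧) ℚ.* (⟦ 32 ⟧ ℚ.* ⟦ g ⟧ ℚ.* ⟦ s ⟧ ^ℚ d)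
  expand = trans (homs 32 q q L g (s ℕ.^ d)) (trans (cong (⟦ 32 ⟧ ℚ.* ⟦ q ⟧ ℚ.* ⟦ q ⟧ ℚ.* ⟦ L ⟧ ℚ.* ⟦ g ⟧ ℚ.*_) (⟦⟧-^ s d))
    (solve 5 (λ a q l g x → a :* q :* q :* l :* g :* x := ((q :* q) :* l) :* (a :* g :* x)) refl ⟦ 32 ⟧ ⟦ q ⟧ ⟦ L ⟧ ⟦ g ⟧ (⟦ s ⟧ ^ℚ d)))
    where
    homs : ∀ a b c e f g → ⟦ a ℕ.* b ℕ.* c ℕ.* e ℕ.* f ℕ.* g ⟧ ≡ ⟦ a ⟧ ℚ.* ⟦ b ⟧ ℚ.* ⟦ c ⟧ ℚ.* ⟦ e ⟧ ℚ.* ⟦ f ⟧ ℚ.* ⟦ g ⟧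
    homs a b c e f g = trans (⟦⟧-* (a ℕ.* b ℕ.* c ℕ.* e ℕ.* f) g) (cong (ℚ._* ⟦ g ⟧)
      (trans (⟦⟧-* (a ℕ.* b ℕ.* c ℕ.* e) f) (cong (ℚ._* ⟦ f ⟧) (trans (⟦⟧-* (a ℕ.* b ℕ.* c) e)
        (cong (ℚ._* ⟦ e ⟧) (trans (⟦⟧-* (a ℕ.* b) c) (cong (ℚ._* ⟦ c ⟧) (⟦⟧-* a b))))))))

-- Both bounds are multiplied by q = suc q′: the deviation of c from 1 is at most 1/q, and 1/q ≤ e.
within-ε : ∀ q′ c e → ⟦ q′ ⟧ ℚ.≤ ⟦ suc q′ ⟧ ℚ.* c → ⟦ suc q′ ⟧ ℚ.* c ℚ.≤ ⟦ 2 ℕ.+ q′ ⟧ → 1ℚ ℚ.≤ ⟦ suc q′ ⟧ ℚ.* e →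
           1ℚ ℚ.- e ℚ.≤ c × c ℚ.≤ 1ℚ ℚ.+ e
within-ε q′ c e lower upper 1≤qe =
  ℚ.*-cancelˡ-≤-pos q {{ℚ.positive 0<q}} (begin
    q ℚ.* (1ℚ ℚ.- e)      ≡⟨ solve 2 (λ q e → q :* (con 1ℚ :- e) := q :- q :* e) refl q e ⟩
    q ℚ.- q ℚ.* e         ≤⟨ ℚ.+-monoʳ-≤ q (ℚ.neg-antimono-≤ 1≤qe) ⟩
    q ℚ.- 1ℚ              ≡⟨ cong (ℚ._- 1ℚ) (⟦⟧-+ 1 q′) ⟩
    1ℚ ℚ.+ ⟦ q′ ⟧ ℚ.- 1ℚ   ≡⟨ solve 1 (λ x → con 1ℚ :+ x :- con 1ℚ := x) refl ⟦ q′ ⟧ ⟩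
    ⟦ q′ ⟧                ≤⟨ lower ⟩
    q ℚ.* c               ∎) ,
  ℚ.*-cancelˡ-≤-pos q {{ℚ.positive 0<q}} (begin
    q ℚ.* c               ≤⟨ upper ⟩
    ⟦ 2 ℕ.+ q′ ⟧          ≡⟨ ⟦⟧-+ 1 (suc q′) ⟩
    1ℚ ℚ.+ q              ≤⟨ ℚ.+-monoˡ-≤ q 1≤qe ⟩
    q ℚ.* e ℚ.+ q         ≡⟨ solve 2 (λ q e → q :* e :+ q := q :* (con 1ℚ :+ e)) refl q e ⟩
    q ℚ.* (1ℚ ℚ.+ e)      ∎)
  where
  open ℚ.≤-Reasoning
  q = ⟦ suc q′ ⟧
  0<q : 0ℚ ℚ.< q
  0<q = 0<⟦suc⟧ q′

coefficient-pos : ∀ q′ c → 1 ℕ.≤ q′ → ⟦ q′ ⟧ ℚ.≤ ⟦ suc q′ ⟧ ℚ.* c → 0ℚ ℚ.< c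
coefficient-pos q′ c 1≤q′ lower = ℚ.*-cancelˡ-<-nonNeg ⟦ suc q′ ⟧ {{ℚ.nonNegative (0≤⟦⟧ (suc q′))}}
  (subst (ℚ._< ⟦ suc q′ ⟧ ℚ.* c) (sym (ℚ.*-zeroʳ ⟦ suc q′ ⟧)) (ℚ.<-≤-trans (⟦⟧-mono-< {0} {q′} 1≤q′) lower))

≤6*recip : ∀ q e ρ → q ℚ.* e ℚ.≤ ⟦ 6 ⟧ → e ℚ.* ρ ≡ 1ℚ → 0ℚ ℚ.< ρ → q ℚ.≤ ⟦ 6 ⟧ ℚ.* ρ
≤6*recip q e ρ qe≤6 eρ≡1 0<ρ = begin
  q                   ≡⟨ sym (ℚ.*-identityʳ q) ⟩
  q ℚ.* 1ℚ            ≡⟨ cong (q ℚ.*_) (sym eρ≡1) ⟩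
  q ℚ.* (e ℚ.* ρ)     ≡⟨ sym (ℚ.*-assoc q e ρ) ⟩
  q ℚ.* e ℚ.* ρ       ≤⟨ ℚ.*-monoʳ-≤-nonNeg ρ {{ℚ.nonNegative (ℚ.<⇒≤ 0<ρ)}} qe≤6 ⟩
  ⟦ 6 ⟧ ℚ.* ρ         ∎
  where open ℚ.≤-Reasoning

fromℕ-≤ : ∀ {a x} → (Eventually λ m → ⟦ a ⟧ ℚ.≤ seq x m) → fromℕ a ≤ x
fromℕ-≤ {a} {x} (N , h) δ 0<δ = N , λ m N≤m → ℚ.≤-<-trans (h m N≤m)
  (subst (ℚ._< seq x m ℚ.+ δ) (ℚ.+-identityʳ (seq x m)) (ℚ.+-monoʳ-< (seq x m) 0<δ))

module Bound (n d : ℕ) (ε : ℝ) (0<ε : 0ℝ < ε) (q′ : ℕ) (1≤q′ : 1 ℕ.≤ q′)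
  (q≈1/ε : Eventually λ m → 1ℚ ℚ.≤ ⟦ suc q′ ⟧ ℚ.* seq ε m × ⟦ suc q′ ⟧ ℚ.* seq ε m ℚ.≤ ⟦ 6 ⟧)
  (L : ℕ) (L≤ : ∀ j → ⟦ L ⟧ ℚ.≤ ⟦ 2 ⟧ ℚ.* seq (log₂ n) j) (P : ShortPowerSum n d q′ L) where

  open ShortPowerSum P

  isAdmissible : IsAdmissible n d ε (multilinearPoly d c)
  isAdmissible = admissible {n} {d} {c} {ε}
    (λ {e} b → coefficient-pos q′ (c e) 1≤q′ (proj₁ (range b)))
    (proj₁ q≈1/ε , λ m N≤m {e} b →
      within-ε q′ (c e) (seq ε m) (proj₁ (range b)) (proj₂ (range b)) (proj₁ (proj₂ q≈1/ε m N≤m)))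

  -- Two nested minima: first the Waring rank of the constructed polynomial, then the least rank
  -- among all admissible polynomials.
  exists : ¬ ¬ (∃ λ a → IsA n d ε a)
  exists none = IsLeast-¬¬ rank powers λ (r , least) → IsLeast-¬¬ r (multilinearPoly d c , isAdmissible , least) none

  -- The Waring rank of the constructed polynomial is available only under double negation; since a
  -- ≤ rank is decidable, refuting its negation suffices.
  ≤rank : ∀ a → IsA n d ε a → a ℕ.≤ rank
  ≤rank a (_ , minimal) with a ℕ.≤? rank
  ... | yes a≤rank = a≤rank
  ... | no  a≰rank = contradiction (λ (r , least) → a≰rank (ℕ.≤-trans
    (minimal r (multilinearPoly d c , isAdmissible , least)) (proj₂ least rank powers))) (IsLeast-¬¬ rank powers)

  bound : ∀ a → IsA n d ε a →
    fromℕ a ≤ fromℚ ⟦ 2304 ℕ.* (G ℕ.* 31) ⟧ * fromℚ (+ 4075 / 1000) ^ d * recip ε 0<ε ^ 2 * log₂ n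
  bound a isA = fromℕ-≤ {a} {X} (proj₁ shifted , λ m N≤m → ℚ.≤-trans (⟦⟧-mono-≤ (≤rank a isA)) (value m N≤m))
    where
    X = fromℚ ⟦ 2304 ℕ.* (G ℕ.* 31) ⟧ * fromℚ (+ 4075 / 1000) ^ d * recip ε 0<ε ^ 2 * log₂ n
    N = proj₁ (proj₂ (proj₂ 0<ε))
    shifted = Eventually-shift {λ m → 1ℚ ℚ.≤ ⟦ suc q′ ⟧ ℚ.* seq ε m × ⟦ suc q′ ⟧ ℚ.* seq ε m ℚ.≤ ⟦ 6 ⟧} N q≈1/ε
    value : ∀ m → proj₁ shifted ℕ.≤ m → ⟦ rank ⟧ ℚ.≤ seq X m
    value m N≤m = subst (λ x → ⟦ rank ⟧ ℚ.≤ ⟦ 2304 ℕ.* (G ℕ.* 31) ⟧ ℚ.* x ℚ.* (ρ ℚ.* (ρ ℚ.* 1ℚ)) ℚ.* seq (log₂ n) m)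
      (sym (seq-^ (fromℚ (+ 4075 / 1000)) d m))
      (rational-bound {rank} {d} {suc q′} {L} {G ℕ.* 31} {4075} {1000} {+ 4075 / 1000} {ρ} {seq (log₂ n) m}
        size refl (ℚ.nonNegative⁻¹ (+ 4075 / 1000)) (ℚ.<⇒≤ (proj₁ (recip-inverse ε 0<ε m)))
        (≤6*recip ⟦ suc q′ ⟧ (seq ε (N ℕ.+ m)) ρ (proj₂ (proj₂ shifted m N≤m))
          (proj₂ (recip-inverse ε 0<ε m)) (proj₁ (recip-inverse ε 0<ε m)))
        (L≤ m))
      where
      ρ = seq (recip ε 0<ε) m

theorem58 :
    ∃ λ (C : ℝ) →
    ∀ (n d : ℕ) → 2 ℕ.≤ n →
    ∀ (ε : ℝ) (0<ε : 0ℝ < ε) → ε < 1ℝ →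
      (¬ ¬ (∃ λ a → IsA n d ε a)) ×
      (∀ a → IsA n d ε a →
        fromℕ a ≤ C * fromℚ (+ 4075 / 1000) ^ d * recip ε 0<ε ^ 2 * log₂ n)
theorem58 = fromℚ ⟦ 2304 ℕ.* (G ℕ.* 31) ⟧ , λ n d 2≤n ε 0<ε ε<1 →
  main n d 2≤n ε 0<ε (reciprocal-approx ε 0<ε ε<1) (log₂-approx n 2≤n)
  where
  main : ∀ n d → 2 ℕ.≤ n → ∀ ε (0<ε : 0ℝ < ε) →
    (∃ λ q′ → 1 ℕ.≤ q′ × (Eventually λ m → 1ℚ ℚ.≤ ⟦ suc q′ ⟧ ℚ.* seq ε m × ⟦ suc q′ ⟧ ℚ.* seq ε m ℚ.≤ ⟦ 6 ⟧)) →
    (∃ λ L → ℕ.NonZero L × n ℕ.≤ 2 ℕ.^ L × (∀ j → ⟦ L ⟧ ℚ.≤ ⟦ 2 ⟧ ℚ.* seq (log₂ n) j)) →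
    (¬ ¬ (∃ λ a → IsA n d ε a)) ×
    (∀ a → IsA n d ε a →
      fromℕ a ≤ fromℚ ⟦ 2304 ℕ.* (G ℕ.* 31) ⟧ * fromℚ (+ 4075 / 1000) ^ d * recip ε 0<ε ^ 2 * log₂ n)
  main n d 2≤n ε 0<ε (q′ , 1≤q′ , q≈1/ε) (L , L≢0 , n≤2^L , L≤) = exists , bound
    where open Bound n d ε 0<ε q′ 1≤q′ q≈1/ε L L≤
                 (shortPowerSum n d q′ L {{ℕ.>-nonZero (ℕ.<⇒≤ 2≤n)}} {{L≢0}} n≤2^L)
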